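{- Let $\mathcal{W}$ be a symmetrical $3$-web on $N=3n$ boundary vertices. Then $D_{\mathcal{W}}=F(T_{\mathcal{W}})$.
   Context: A $3$-web is a directed bipartite graph drawn in the plane such that: (1) there are $N=3n$ boundary vertices on a horizontal boundary line, labelled $1,\dots,N$ from left to right, each of degree $1$ and a source; (2) all other (internal) vertices have degree $3$ and are either sources or sinks; (3) all edges lie above the boundary line; (4) every internal face (face not incident with the boundary line) has at least $6$ sides. For $1\le k\le N-1$, $B_k$ is the boundary face incident with boundary vertices $k$ and $k+1$, and $B_0=B_N$ is the outer face. $\mathrm{webdist}(X,Y)$ is the minimal number of edges one must cross to get from face $X$ to face $Y$. The web is symmetrical if it is invariant under reflection in a vertical line, the reflection sending boundary vertex $k$ to $N+1-k$ (so $B_j$ corresponds to $B_{N-j}$). Row-index word: for a standard tableau $T$ with entries $1,\dots,N$, $w(T)=w_1\cdots w_N$ where $w_j=r$ if $j$ lies in row $r$; for a straight shape $w(T)$ determines $T$. $T_{\mathcal{W}}$: let $d_i=\mathrm{webdist}(B_0,B_i)$ for $0\le i\le N$ and $w_i=\Phi(d_{i-1}-d_i)$ for $1\le i\le N$, where $\Phi(-1)=1,\Phi(0)=2,\Phi(1)=3$; $T_{\mathcal{W}}$ is the tableau of shape $(n,n,n)$ with $w(T_{\mathcal{W}})=w_1\cdots w_N$. $D_{\mathcal{W}}$: let $h_j=\mathrm{webdist}(B_j,B_{N-j})$ for $0\le j\le\lfloor N/2\rfloor$; for $1\le j\le\lfloor N/2\rfloor$ set $(w_{N+1-2j},w_{N+2-2j})=\Lambda(h_j-h_{j-1})$,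 where $\Lambda(-2)=(1,1)$, $\Lambda(-1)=(1,2)$, $\Lambda(0)=(2,2)$, $\Lambda(1)=(2,3)$, $\Lambda(2)=(3,3)$; if $N$ is odd set $w_1=1$. $D_{\mathcal{W}}$ is the tableau of shape $(n,n,n)$ with row-index word $w_1\cdots w_N$. Folding: for a tableau of straight shape with $N$ boxes, promotion $P$ deletes the entry $1$, slides into the empty box repeatedly the smaller of the entries immediately right of and immediately below it until none exist, subtracts $1$ from all entries and puts $N$ in the empty box. $P_k(T)$ applies promotion to the subtableau of entries $\le k$ and fixes the entries $>k$. For $j=1,\dots,\lfloor N/2\rfloor$, $f^j=P_{N-2j+2}\circ P_{N-2j+4}\circ\cdots\circ P_N$, and $F=f^{\lfloor N/2\rfloor}$. -}

module Defs where

open import Data.Nat using (ℕ; zero; suc; _+_; _*_; _∸_; _≤_; _<_; _≤ᵇ_; _<ᵇ_; _/_)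
open import Data.Nat.Base using (_≡ᵇ_)
open import Data.Bool using (Bool; true; false; if_then_else_; _∧_; not)
open import Data.Fin using (Fin; toℕ; fromℕ; inject₁; _↑ˡ_; opposite)
open import Data.List using (List; []; _∷_; _++_; map; upTo; allFin; concat; length)
open import Data.Nat.ListAction using (sum)
open import Data.Bool.ListAction using (all)
open import Data.Maybe using (Maybe; just; nothing)
open import Data.Integer using (ℤ; +_; -[1+_]; _⊖_)
open import Data.Product using (Σ; ∃; _×_; _,_; proj₁; proj₂)
open import Data.Sum using (_⊎_)
open import Relation.Binary.PropositionalEquality using (_≡_; _≢_)
open import Relation.Nullary using (¬_)

iter : ∀ {A : Set} → (A → A) → ℕ → A → A
iter f zero    x = x
iter f (suc i) x = f (iter f i x)

cpred : ∀ {N} → Fin N → Fin N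
cpred {suc m} Fin.zero    = fromℕ m
cpred {suc m} (Fin.suc i) = inject₁ i

isOrbitMin : ∀ {D} → (Fin D → Fin D) → Fin D → Bool
isOrbitMin {D} f d = all (λ i → toℕ d ≤ᵇ toℕ (iter f i d)) (upTo D)

numOrbits : ∀ {D} → (Fin D → Fin D) → ℕ
numOrbits {D} f = sum (map (λ d → if isOrbitMin f d then 1 else 0) (allFin D))

walk : ∀ {A : Set} → (A → A) → (A → A) → List Bool → A → A
walk s a []            x = x
walk s a (true  ∷ ws)  x = s (walk s a ws x)
walk s a (false ∷ ws)  x = a (walk s a ws x)

-- 3-webs, encoded as combinatorial maps (rotation systems).
--
-- The boundary line is contracted to a single "hub" vertex of degree N.
-- Darts are Fin (N + M); the first N darts are the hub darts
-- h_1,…,h_N (dart with toℕ = k-1 is h_k, i.e. the end at boundary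
-- vertex k of the edge leaving boundary vertex k).  The remaining M
-- darts are half-edges at internal vertices.
--   α : edge involution,  σ : rotation (counterclockwise) at vertices,
--   φ = σ ∘ α : faces are the φ-orbits.
-- At the hub, σ h_k = h_{k-1} (cyclically): boundary vertices 1..N from
-- left to right.  colour true = source, false = sink.

record Web (n : ℕ) : Set where
  field
    M      : ℕ
  N : ℕ
  N = 3 * n
  Dart : Set
  Dart = Fin (N + M)
  hub : Fin N → Dart
  hub k = k ↑ˡ M
  isHub : Dart → Set
  isHub d = toℕ d < N
  field
    α      : Dart → Dart
    σ      : Dart → Dart
    colour : Dart → Bool
    α-invol   : ∀ d → α (α d) ≡ d
    α-nofix   : ∀ d → α d ≢ d
    σ-hub     : ∀ k → σ (hub k) ≡ hub (cpred k)
    σ-deg3    : ∀ d → ¬ isHub d → iter σ 3 d ≡ d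
    σ-nofix   : ∀ d → ¬ isHub d → σ d ≢ d
    colour-σ   : ∀ d → colour (σ d) ≡ colour d
    colour-hub : ∀ k → colour (hub k) ≡ true
    colour-α   : ∀ d → colour (α d) ≢ colour d
    connected : ∀ d → Σ (List Bool) λ ws → Σ (Fin N) λ k → walk σ α ws (hub k) ≡ d
    -- planar (genus 0): V - E + F = 2, or the empty map
    planar : (N + M ≡ 0) ⊎
             (numOrbits σ + numOrbits (λ d → σ (α d)) ≡ 2 + numOrbits α)
  φ : Dart → Dart
  φ d = σ (α d)
  field
    internal-face-≥6 : ∀ d → (∀ i → ¬ isHub (iter φ i d)) →
                       ∀ i → 1 ≤ i → i < 6 → iter φ i d ≢ d

  sameFace : Dart → Dart → Set
  sameFace x y = Σ ℕ λ i → iter φ i x ≡ y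

  -- paths in the dual graph: crossing the edge {z , α z}
  data DPath : ℕ → Dart → Dart → Set where
    stay  : ∀ {x y} → sameFace x y → DPath 0 x y
    cross : ∀ {k x z y} → sameFace x z → DPath k (α z) y → DPath (suc k) x y

  IsWebdist : Dart → Dart → ℕ → Set
  IsWebdist x y k = DPath k x y × (∀ j → j < k → ¬ DPath j x y)

  -- x is a dart lying in face B_j  (B_j = face of h_j, B_0 = B_N)
  IsB : ℕ → Dart → Set
  IsB j x = Σ (Fin N) λ k → (x ≡ hub k) ×
              ((suc (toℕ k) ≡ j) ⊎ ((j ≡ 0) × (suc (toℕ k) ≡ N)))

  WD : ℕ → ℕ → ℕ → Set
  WD a b k = ∀ x y → IsB a x → IsB b y → IsWebdist x y k

open Web public

-- invariance under reflection in a vertical line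
Symmetrical : ∀ {n} → Web n → Set
Symmetrical W = Σ (Dart W → Dart W) λ ρ →
    (∀ d → ρ (ρ d) ≡ d)
  × (∀ d → ρ (α W d) ≡ α W (ρ d))
  × (∀ d → σ W (ρ (σ W d)) ≡ ρ d)          -- ρ σ = σ⁻¹ ρ (orientation reversing)
  × (∀ k → ρ (hub W k) ≡ hub W (opposite k))
  × (∀ d → colour W (ρ d) ≡ colour W d)

-- Tableaux: list of rows (row 1 first), entries 1..N

Tab : Set
Tab = List (List ℕ)

nth : ∀ {A : Set} → List A → ℕ → Maybe A
nth []       _       = nothing
nth (x ∷ xs) zero    = just x
nth (x ∷ xs) (suc i) = nth xs i

setNth : ∀ {A : Set} → List A → ℕ → (A → A) → List A
setNth []       _       f = []
setNth (x ∷ xs) zero    f = f x ∷ xs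
setNth (x ∷ xs) (suc i) f = x ∷ setNth xs i f

get : Tab → ℕ → ℕ → Maybe ℕ
get T r c with nth T r
... | nothing  = nothing
... | just row = nth row c

set : Tab → ℕ → ℕ → ℕ → Tab
set T r c v = setNth T r (λ row → setNth row c (λ _ → v))

positionsOf : ℕ → List ℕ → ℕ → List ℕ
positionsOf r []       i = []
positionsOf r (x ∷ xs) i = if x ≡ᵇ r then i ∷ positionsOf r xs (suc i)
                                      else positionsOf r xs (suc i)

tabOf : List ℕ → Tab
tabOf w = positionsOf 1 w 1 ∷ positionsOf 2 w 1 ∷ positionsOf 3 w 1 ∷ []

findRow : ℕ → List ℕ → ℕ → Maybe ℕ
findRow v []       c = nothing
findRow v (x ∷ xs) c = if x ≡ᵇ v then just c else findRow v xs (suc c)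

find : ℕ → Tab → ℕ → ℕ × ℕ
find v []         r = (r , 0)
find v (row ∷ T)  r with findRow v row 0
... | just c  = (r , c)
... | nothing = find v T (suc r)

getLe : ℕ → Tab → ℕ → ℕ → Maybe ℕ
getLe k T r c with get T r c
... | nothing = nothing
... | just x  = if x ≤ᵇ k then just x else nothing

-- jeu de taquin slides of the empty box (r,c) within entries ≤ k
slide : ℕ → ℕ → Tab → ℕ → ℕ → Tab × (ℕ × ℕ)
slide zero     k T r c = (T , (r , c))
slide (suc fu) k T r c with getLe k T r (suc c) | getLe k T (suc r) c
... | nothing | nothing = (T , (r , c))
... | just a  | nothing = slide fu k (set T r c a) r (suc c)
... | nothing | just b  = slide fu k (set T r c b) (suc r) c
... | just a  | just b  = if a <ᵇ b then slide fu k (set T r c a) r (suc c)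
                                    else slide fu k (set T r c b) (suc r) c

promo : ℕ → Tab → Tab
promo k T =
  let p  = find 1 T 0
      s  = slide (length (concat T)) k T (proj₁ p) (proj₂ p)
      T' = map (map (λ x → if x ≤ᵇ k then x ∸ 1 else x)) (proj₁ s)
  in set T' (proj₁ (proj₂ s)) (proj₂ (proj₂ s)) k

fold : ℕ → ℕ → Tab → Tab
fold N zero    T = T
fold N (suc j) T = promo (N + 2 ∸ 2 * suc j) (fold N j T)

Fold : ℕ → Tab → Tab
Fold N = fold N (N / 2)

Φ : ℤ → ℕ
Φ -[1+ 0 ]    = 1
Φ (+ 0)       = 2
Φ (+ 1)       = 3
Φ _           = 0

Λ : ℤ → List ℕ
Λ -[1+ 1 ]    = 1 ∷ 1 ∷ []
Λ -[1+ 0 ]    = 1 ∷ 2 ∷ []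
Λ (+ 0)       = 2 ∷ 2 ∷ []
Λ (+ 1)       = 2 ∷ 3 ∷ []
Λ (+ 2)       = 3 ∷ 3 ∷ []
Λ _           = 0 ∷ 0 ∷ []

wordT : ℕ → (ℕ → ℕ) → List ℕ
wordT N ds = map (λ i → Φ (ds i ⊖ ds (suc i))) (upTo N)

wordDpairs : (ℕ → ℕ) → ℕ → List ℕ
wordDpairs hs zero    = []
wordDpairs hs (suc j) = Λ (hs (suc j) ⊖ hs j) ++ wordDpairs hs j

isOdd : ℕ → Bool
isOdd zero          = false
isOdd (suc zero)    = true
isOdd (suc (suc m)) = isOdd m

wordD : ℕ → (ℕ → ℕ) → List ℕ
wordD N hs = (if isOdd N then 1 ∷ [] else []) ++ wordDpairs hs (N / 2)

{-# OPTIONS --safe #-}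
module Submission where

-- Faces of the web are the vertices of the dual triangulated disc; crossing an edge from left to right of its direction
-- is a directed step, and going against the direction costs two steps. Let U(i,j) and V(i,j) be the directed distances
-- from B_i to B_j and back. Then U = a + 2b and V = 2a + b for a dominant weight (a,b), the shape λ(i,j) modulo columns
-- of length 3.
--
-- For a set R of triangles whose complement is connected to the boundary, Euler's formula gives
-- Σ (6 − t − 3o) ≥ 6 over the faces that meet R in t corners forming o arcs. Since internal faces have at least six
-- sides, a simple directed closed walk has at least three turns around a single triangle. Flipping such turns
-- shows (i) U + V = 3 webdist, and (ii) a directed line with three triangles on one side at each of its inner faces is a
-- geodesic, and its reversal costs twice its length. The strips of alternately turning triangles that start at a
-- boundary edge are bounded by such lines, and they determine how U and V change from B_i to B_{i+1}: the row word of
-- λ(i+1,·) arises from that of λ(i,·) by removing the first letter, lowering a 2 where a first vanishes and then a 3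
-- where b first vanishes. This is promotion.
--
-- Folding thus reads off λ(j,N−j), λ(j−1,N−j), λ(j−1,N−j+1); reflection identifies λ(j−1,N−j) with λ(j,N−j+1), which
-- makes each pair of letters a function of the change of webdist(B_j,B_{N−j}).

-- The web is only a rotation system, so the inside of a closed curve has no geometric meaning. A
-- closed walk in the dual is therefore treated as an antisymmetric flow on darts. Planarity enters
-- through Euler's formula, which makes every such flow the difference of a winding number `w` on
-- the vertices of the web, normalised to 0 at the hub. The edges that leave the region w > 0 all
-- have the same colour at their inner ends, and likewise for w < 0. With such a boundary a face
-- contributes at most 2 to the total of at least 6, so three faces carry a sharp turn, and one of
-- them remains when the two ends of a digon are excluded. Every triangle is a directed 3-cycle;
-- hence a sharp turn can be pushed over the adjacent triangle without a change of length, and the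
-- sum of the absolute values of `w` is what decreases. The same winding number shows that closed
-- walks have length divisible by 3. Distances to neighbouring boundary faces thus differ by 1 or -2
-- only, and the strips have to supply no more than inequalities.

open import Defs
open import Data.Bool.Base using (Bool; true; false; if_then_else_; _∧_; not)
open import Data.Bool.ListAction using (all)
open import Data.Fin.Base using (Fin; zero; suc; toℕ; fromℕ<; fromℕ; splitAt; opposite)
import Data.Fin.Properties as F
open import Data.Fin.Permutation using (permutation)
open import Data.Integer.Base as ℤ using (ℤ; +_; 0ℤ; 1ℤ; _⊖_)
import Data.Integer.Properties as ℤ
open import Data.Integer.Tactic.RingSolver using (solve-∀)
open import Data.List.Base using (List; []; _∷_; map; upTo; tabulate; _++_; length; concat; applyUpTo)
import Data.List.Properties as L
open import Data.Nat.Base as ℕ using (ℕ; zero; suc; z≤n; s≤s; _+_; _*_; _∸_; _≤_; _<_; _≤ᵇ_; _<ᵇ_; _≡ᵇ_; _/_; _%_)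
import Data.Nat.ListAction as ℕL
import Data.Nat.Properties as ℕ
open import Data.Product.Base using (∃; _×_; _,_; proj₁; proj₂)
open import Data.Sum.Base using (_⊎_; inj₁; inj₂; [_,_]′)
open import Function.Base using (_∘_)
open import Relation.Binary.PropositionalEquality
open import Relation.Nullary using (¬_; Dec; yes; no; does; contradiction)
open import Relation.Nullary.Decidable using (dec-true; dec-false; map′; _×-dec_; ¬?)
open import Relation.Unary using (Decidable)
import Data.Bool.Properties as Bool
open import Data.Fin.Relation.Unary.Top using (view; ‵fromℕ; ‵inject₁; view-fromℕ; view-inject₁)
open import Relation.Binary.Definitions using (tri<; tri≈; tri>; Tri)
open import Data.Fin.Patterns
open import Data.Empty using (⊥; ⊥-elim)
open import Data.List.Membership.Propositional as Mem using (_∈_)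
open import Data.List.Relation.Unary.Any using (here; there; Any; any?)
open import Data.List.Membership.Propositional.Properties using (∈-∃++; ∈-++⁺ˡ; ∈-++⁺ʳ)
open import Data.Unit.Base using (⊤; tt)
import Data.Nat.Tactic.RingSolver as NR
open import Data.Nat.Divisibility using (_∣_; divides; ∣m+n∣m⇒∣n; ∣⇒≤)
open import Data.Maybe.Base using (Maybe; just; nothing)
open import Data.Nat.DivMod using (m%n<n; m≡m%n+[m/n]*n; m/n≤m)
import Algebra.Properties.CommutativeMonoid.Sum ℤ.+-0-commutativeMonoid as S

-- Sums of integers over Fin m

# : Bool → ℤ
# true  = 1ℤ
# false = 0ℤ

infix 4 _==_

_==_ : ∀ {m} → Fin m → Fin m → Bool
x == y = does (x F.≟ y)

==-≡ : ∀ {m} {x y : Fin m} → (x == y) ≡ true → x ≡ y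
==-≡ {x = x} {y} e with x F.≟ y
... | yes p = p

≡-== : ∀ {m} {x y : Fin m} → x ≡ y → (x == y) ≡ true
≡-== {x = x} {y} = dec-true (x F.≟ y)

≢-== : ∀ {m} {x y : Fin m} → x ≢ y → (x == y) ≡ false
≢-== {x = x} {y} = dec-false (x F.≟ y)

==-≢ : ∀ {m} {x y : Fin m} → (x == y) ≡ false → x ≢ y
==-≢ e p with () ← trans (sym e) (≡-== p)

-- Reduces an inequality to one already known by an identity between the two differences, which the
-- ring solver can supply.
lin : ∀ {a b c d : ℤ} → a ℤ.≤ b → d ℤ.- c ≡ b ℤ.- a → c ℤ.≤ d
lin h e = ℤ.0≤i-j⇒j≤i (subst (0ℤ ℤ.≤_) (sym e) (ℤ.i≤j⇒0≤j-i h))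

abstract
  sum : ∀ {m} → (Fin m → ℤ) → ℤ
  sum = S.sum

  sum-zero : ∀ (f : Fin 0 → ℤ) → sum f ≡ 0ℤ
  sum-zero f = refl

  sum-suc : ∀ {m} (f : Fin (suc m) → ℤ) → sum f ≡ f zero ℤ.+ sum (f ∘ suc)
  sum-suc f = refl

  sum-cong : ∀ {m} {f g : Fin m → ℤ} → (∀ i → f i ≡ g i) → sum f ≡ sum g
  sum-cong = S.sum-cong-≗

  sum-+ : ∀ {m} (f g : Fin m → ℤ) → sum (λ i → f i ℤ.+ g i) ≡ sum f ℤ.+ sum g
  sum-+ = S.∑-distrib-+

  sum-comm : ∀ {m n} (f : Fin m → Fin n → ℤ) → sum (λ i → sum (f i)) ≡ sum (λ j → sum (λ i → f i j))
  sum-comm = S.∑-comm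

  sum-mono : ∀ {m} {f g : Fin m → ℤ} → (∀ i → f i ℤ.≤ g i) → sum f ℤ.≤ sum g
  sum-mono {zero}  h = ℤ.≤-refl
  sum-mono {suc m} h = ℤ.+-mono-≤ (h zero) (sum-mono (h ∘ suc))

  -- The equality case of `sum-mono`. It turns the global count by Euler's formula into a statement
  -- about each single edge.
  sum-tight : ∀ {m} {f g : Fin m → ℤ} → (∀ i → f i ℤ.≤ g i) → sum g ≡ sum f → ∀ i → f i ≡ g i
  sum-tight {suc m} {f} {g} h e = λ
    { zero    → ℤ.≤-antisym (h zero) g₀≤f₀
    ; (suc i) → sum-tight (h ∘ suc) (ℤ.≤-antisym tail≤ (sum-mono (h ∘ suc))) i }
    where
    rearrange : ∀ a b c d → a ℤ.+ b ≡ c ℤ.+ d → c ℤ.- a ≡ b ℤ.- d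
    rearrange a b c d p = begin
      c ℤ.- a                   ≡⟨ alg₁ a c d ⟩
      (c ℤ.+ d) ℤ.- (a ℤ.+ d)   ≡⟨ cong (ℤ._- (a ℤ.+ d)) (sym p) ⟩
      (a ℤ.+ b) ℤ.- (a ℤ.+ d)   ≡⟨ alg₂ a b d ⟩
      b ℤ.- d                   ∎
      where
      open ≡-Reasoning
      alg₁ : ∀ a c d → c ℤ.- a ≡ (c ℤ.+ d) ℤ.- (a ℤ.+ d)
      alg₁ = solve-∀
      alg₂ : ∀ a b d → (a ℤ.+ b) ℤ.- (a ℤ.+ d) ≡ b ℤ.- d
      alg₂ = solve-∀
    g₀≤f₀ : g zero ℤ.≤ f zero
    g₀≤f₀ = lin (sum-mono (h ∘ suc)) (rearrange (g zero) _ (f zero) _ e)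
    tail≤ : sum (g ∘ suc) ℤ.≤ sum (f ∘ suc)
    tail≤ = lin (h zero) (rearrange (sum (g ∘ suc)) (g zero) (sum (f ∘ suc)) (f zero)
              (trans (ℤ.+-comm (sum (g ∘ suc)) (g zero)) (trans e (ℤ.+-comm (f zero) _))))

  sum-0 : ∀ {m} {f : Fin m → ℤ} → (∀ i → f i ≡ 0ℤ) → sum f ≡ 0ℤ
  sum-0 {zero}  h = refl
  sum-0 {suc m} h = trans (cong₂ ℤ._+_ (h zero) (sum-0 (h ∘ suc))) refl

  sum-only : ∀ {m} (j : Fin m) {f : Fin m → ℤ} → (∀ i → i ≢ j → f i ≡ 0ℤ) → sum f ≡ f j
  sum-only zero    {f} h = trans (cong (λ z → f zero ℤ.+ z) (sum-0 (λ i → h (suc i) λ ()))) (ℤ.+-identityʳ (f zero))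
  sum-only (suc j) {f} h = trans (cong₂ ℤ._+_ (h zero λ ()) (sum-only j (λ i i≢j → h (suc i) (i≢j ∘ F.suc-injective))))
                             (ℤ.+-identityˡ _)

  sum-δ : ∀ {m} (j : Fin m) (f : Fin m → ℤ) → sum (λ i → # (i == j) ℤ.* f i) ≡ f j
  sum-δ j f = trans (sum-only j λ i i≢j → cong (λ b → # b ℤ.* f i) (≢-== i≢j))
                (trans (cong (λ b → # b ℤ.* f j) (≡-== {x = j} refl)) (ℤ.*-identityˡ (f j)))

  sum-*ˡ : ∀ {m} c (f : Fin m → ℤ) → sum (λ i → c ℤ.* f i) ≡ c ℤ.* sum f
  sum-*ˡ {zero}  c f = sym (ℤ.*-zeroʳ c)
  sum-*ˡ {suc m} c f = trans (cong (λ z → c ℤ.* f zero ℤ.+ z) (sum-*ˡ c (f ∘ suc))) (sym (ℤ.*-distribˡ-+ c (f zero) _))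

  sum-- : ∀ {m} (f g : Fin m → ℤ) → sum (λ i → f i ℤ.- g i) ≡ sum f ℤ.- sum g
  sum-- f g = begin
    sum (λ i → f i ℤ.- g i)                    ≡⟨ sum-cong (λ i → cong (λ z → f i ℤ.+ z) (sym (ℤ.-1*i≡-i (g i)))) ⟩
    sum (λ i → f i ℤ.+ ℤ.-1ℤ ℤ.* g i)          ≡⟨ sum-+ f _ ⟩
    sum f ℤ.+ sum (λ i → ℤ.-1ℤ ℤ.* g i)        ≡⟨ cong (λ z → sum f ℤ.+ z) (trans (sum-*ˡ ℤ.-1ℤ g) (ℤ.-1*i≡-i (sum g))) ⟩
    sum f ℤ.- sum g                            ∎
    where open ≡-Reasoning

  sum-reindex : ∀ {m} (f f⁻ : Fin m → Fin m) → (∀ x → f (f⁻ x) ≡ x) → (∀ x → f⁻ (f x) ≡ x) →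
                ∀ g → sum (g ∘ f) ≡ sum g
  sum-reindex f f⁻ r l g = sym (S.sum-permute g (permutation f f⁻ r l))

least : ∀ {m} {P : Fin m → Set} → Decidable P → ∃ P → ∃ λ x → P x × (∀ y → P y → toℕ x ℕ.≤ toℕ y)
least {suc m} {P} P? (w , pw) with P? zero
... | yes p = zero , p , λ _ _ → z≤n
... | no ¬p with w
...   | zero   = contradiction pw ¬p
...   | suc w′ with x , px , min ← least (P? ∘ suc) (w′ , pw) =
  suc x , px , λ { zero p → contradiction p ¬p ; (suc y) p → s≤s (min y p) }

iter-+ : ∀ {X : Set} (f : X → X) a b x → iter f (a ℕ.+ b) x ≡ iter f a (iter f b x)
iter-+ f zero    b x = refl
iter-+ f (suc a) b x = cong f (iter-+ f a b x)

iter-shift : ∀ {X : Set} (f : X → X) a x → iter f a (f x) ≡ f (iter f a x)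
iter-shift f zero    x = refl
iter-shift f (suc a) x = cong f (iter-shift f a x)

module _ {m : ℕ} (q : Fin m → Fin m) (qq : ∀ x → q (q x) ≡ q x) where

  -- An idempotent map stands for a partition: its fixed points are the representatives of the
  -- classes.
  sum-fibres : ∀ (g : Fin m → ℤ) → sum g ≡ sum (λ c → # (q c == c) ℤ.* sum (λ d → # (q d == c) ℤ.* g d))
  sum-fibres g = sym (begin
    sum (λ c → # (q c == c) ℤ.* sum (λ d → # (q d == c) ℤ.* g d))
      ≡⟨ sum-cong (λ c → sym (sum-*ˡ (# (q c == c)) (λ d → # (q d == c) ℤ.* g d))) ⟩
    sum (λ c → sum (λ d → # (q c == c) ℤ.* (# (q d == c) ℤ.* g d)))
      ≡⟨ sum-comm (λ c d → # (q c == c) ℤ.* (# (q d == c) ℤ.* g d)) ⟩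
    sum (λ d → sum (λ c → # (q c == c) ℤ.* (# (q d == c) ℤ.* g d)))
      ≡⟨ sum-cong (λ d → trans (sum-only (q d) (λ c ne →
           trans (cong (λ b → # (q c == c) ℤ.* (# b ℤ.* g d)) (≢-== (ne ∘ sym))) (ℤ.*-zeroʳ (# (q c == c)))))
           (trans (cong₂ (λ a b → # a ℤ.* (# b ℤ.* g d)) (≡-== (qq d)) (≡-== {x = q d} refl))
             (trans (ℤ.*-identityˡ (1ℤ ℤ.* g d)) (ℤ.*-identityˡ (g d))))) ⟩
    sum g ∎)
    where open ≡-Reasoning

-- Orbits of a permutation of Fin m

module Orbits {m : ℕ} (f f⁻ : Fin m → Fin m)
              (r : ∀ x → f (f⁻ x) ≡ x) (l : ∀ x → f⁻ (f x) ≡ x) where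

  f-inj : ∀ {x y} → f x ≡ f y → x ≡ y
  f-inj {x} {y} e = trans (sym (l x)) (trans (cong f⁻ e) (l y))

  iter-inj : ∀ n {x y} → iter f n x ≡ iter f n y → x ≡ y
  iter-inj zero    e = e
  iter-inj (suc n) e = iter-inj n (f-inj e)

  Orb : Fin m → Fin m → Set
  Orb x y = ∃ λ n → iter f n x ≡ y

  period : ∀ x → ∃ λ k → (1 ℕ.≤ k) × (k ℕ.≤ m) × (iter f k x ≡ x)
  period x with i , j , i<j , e ← F.pigeonhole (ℕ.n<1+n m) (λ i → iter f (toℕ i) x) =
    toℕ j ℕ.∸ toℕ i , ℕ.m<n⇒0<n∸m i<j ,
    ℕ.≤-trans (ℕ.m∸n≤m (toℕ j) (toℕ i)) (ℕ.≤-pred (F.toℕ<n j)) ,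
    iter-inj (toℕ i) (begin
      iter f (toℕ i) (iter f (toℕ j ℕ.∸ toℕ i) x) ≡⟨ sym (iter-+ f (toℕ i) _ x) ⟩
      iter f (toℕ i ℕ.+ (toℕ j ℕ.∸ toℕ i)) x      ≡⟨ cong (λ n → iter f n x) (ℕ.m+[n∸m]≡n (ℕ.<⇒≤ i<j)) ⟩
      iter f (toℕ j) x                            ≡⟨ sym e ⟩
      iter f (toℕ i) x                            ∎)
    where open ≡-Reasoning

  private
    below-period : ∀ {x k} → 1 ℕ.≤ k → iter f k x ≡ x → ∀ n → ∃ λ i → (i ℕ.< k) × (iter f i x ≡ iter f n x)
    below-period k≥1 e zero = 0 , k≥1 , refl
    below-period {k = k} k≥1 e (suc n) with i , i<k , e′ ← below-period k≥1 e n with ℕ.m≤n⇒m<n∨m≡n i<k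
    ... | inj₁ lt = suc i , lt , cong f e′
    ... | inj₂ eq = 0 , k≥1 , trans (trans (sym e) (cong (λ z → iter f z _) (sym eq))) (cong f e′)

  -- An orbit is exhausted by fewer than `m` iterates; this is what makes the finite test
  -- `isOrbitMin` decisive.
  bounded : ∀ x n → ∃ λ i → (i ℕ.< m) × (iter f i x ≡ iter f n x)
  bounded x n with k , k≥1 , k≤m , e ← period x with i , i<k , e′ ← below-period k≥1 e n =
    i , ℕ.<-≤-trans i<k k≤m , e′

  orb-refl : ∀ x → Orb x x
  orb-refl x = 0 , refl

  orb-trans : ∀ {x y z} → Orb x y → Orb y z → Orb x z
  orb-trans {x} (a , p) (b , q) = b ℕ.+ a , trans (iter-+ f b a x) (trans (cong (iter f b) p) q)

  orb-back : ∀ x → Orb (f x) x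
  orb-back x with suc k , _ , _ , e ← period x = k , trans (iter-shift f k x) e

  orb-sym : ∀ {x y} → Orb x y → Orb y x
  orb-sym (zero , refl) = 0 , refl
  orb-sym {x} (suc n , refl) = orb-trans (orb-back (iter f n x)) (orb-sym (n , refl))

  orb? : ∀ x → Decidable (Orb x)
  orb? x y = map′ (λ (i , e) → toℕ i , e)
    (λ (n , e) → let i , i<m , e′ = bounded x n in
      fromℕ< i<m , trans (cong (λ z → iter f z x) (F.toℕ-fromℕ< i<m)) (trans e′ e))
    (F.any? (λ i → iter f (toℕ i) x F.≟ y))

  abstract
    rep : Fin m → Fin m
    rep x = proj₁ (least (orb? x) (x , orb-refl x))

    rep-orb : ∀ x → Orb x (rep x)
    rep-orb x = proj₁ (proj₂ (least (orb? x) (x , orb-refl x)))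

    rep-min : ∀ x y → Orb x y → toℕ (rep x) ℕ.≤ toℕ y
    rep-min x = proj₂ (proj₂ (least (orb? x) (x , orb-refl x)))

  orb⇒rep : ∀ {x y} → Orb x y → rep x ≡ rep y
  orb⇒rep {x} {y} o = F.toℕ-injective (ℕ.≤-antisym
    (rep-min x _ (orb-trans o (rep-orb y))) (rep-min y _ (orb-trans (orb-sym o) (rep-orb x))))

  rep⇒orb : ∀ {x y} → rep x ≡ rep y → Orb x y
  rep⇒orb {x} {y} e = orb-trans (rep-orb x) (subst (λ z → Orb z y) (sym e) (orb-sym (rep-orb y)))

  rep-f : ∀ x → rep (f x) ≡ rep x
  rep-f x = sym (orb⇒rep (1 , refl))

  rep-rep : ∀ x → rep (rep x) ≡ rep x
  rep-rep x = sym (orb⇒rep (rep-orb x))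

  all-upTo : ∀ (p : ℕ → Bool) n → (∀ i → i ℕ.< n → p i ≡ true) → all p (upTo n) ≡ true
  all-upTo p n = go n (λ i → i)
    where
    go : ∀ n (h : ℕ → ℕ) → (∀ i → i ℕ.< n → p (h i) ≡ true) → all p (Data.List.Base.applyUpTo h n) ≡ true
    go zero    h q = refl
    go (suc n) h q = cong₂ _∧_ (q 0 (s≤s z≤n)) (go n (h ∘ suc) (λ i i<n → q (suc i) (s≤s i<n)))

  upTo-all : ∀ (p : ℕ → Bool) n → all p (upTo n) ≡ true → ∀ i → i ℕ.< n → p i ≡ true
  upTo-all p n = go n (λ i → i)
    where
    ∧-split : ∀ a b → a ∧ b ≡ true → (a ≡ true) × (b ≡ true)
    ∧-split true true _ = refl , refl
    go : ∀ n (h : ℕ → ℕ) → all p (Data.List.Base.applyUpTo h n) ≡ true → ∀ i → i ℕ.< n → p (h i) ≡ true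
    go (suc n) h q zero    _         = proj₁ (∧-split (p (h 0)) _ q)
    go (suc n) h q (suc i) (s≤s i<n) = go n (h ∘ suc) (proj₂ (∧-split (p (h 0)) _ q)) i i<n

  isOrbitMin≡ : ∀ x → isOrbitMin f x ≡ (rep x == x)
  isOrbitMin≡ x with rep x F.≟ x
  ... | yes e = all-upTo _ m λ i i<m → T⇒≡ (ℕ.≤⇒≤ᵇ (subst (λ z → toℕ z ℕ.≤ _) e (rep-min x _ (i , refl))))
    where
    T⇒≡ : ∀ {b} → Data.Bool.Base.T b → b ≡ true
    T⇒≡ {true} _ = refl
  ... | no ne with isOrbitMin f x in eq
  ...   | false = refl
  ...   | true  = contradiction (F.toℕ-injective (ℕ.≤-antisym (rep-min x x (orb-refl x)) x≤)) ne
    where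
    x≤ : toℕ x ℕ.≤ toℕ (rep x)
    x≤ with n , e ← rep-orb x with i , i<m , e′ ← bounded x n =
      subst (λ z → toℕ x ℕ.≤ toℕ z) (trans e′ e)
        (ℕ.≤ᵇ⇒≤ _ _ (subst Data.Bool.Base.T (sym (upTo-all _ m eq i i<m)) _))

  numOrbits≡ : + numOrbits f ≡ sum (λ x → # (rep x == x))
  numOrbits≡ = trans (go (λ i → i)) (sum-cong λ x → cong # (isOrbitMin≡ x))
    where
    go : ∀ {k} (h : Fin k → Fin m) →
         + ℕL.sum (map (λ d → if isOrbitMin f d then 1 else 0) (tabulate h)) ≡ sum (λ x → # (isOrbitMin f (h x)))
    go {zero}  h = sym (sum-zero _)
    go {suc k} h = trans (head (isOrbitMin f (h zero)) _)
                     (trans (cong (λ z → # (isOrbitMin f (h zero)) ℤ.+ z) (go (h ∘ suc))) (sym (sum-suc (λ x → # (isOrbitMin f (h x))))))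
      where
      head : ∀ b n → + ((if b then 1 else 0) ℕ.+ n) ≡ # b ℤ.+ + n
      head true  n = refl
      head false n = refl

∧-true : ∀ {a b} → a ∧ b ≡ true → (a ≡ true) × (b ≡ true)
∧-true {true} {true} _ = refl , refl

not-true : ∀ {a} → not a ≡ true → a ≡ false
not-true {false} _ = refl

true≢false : ∀ {a} {X : Set} → a ≡ true → a ≡ false → X
true≢false refl ()

sum-strict : ∀ {m} {f g : Fin m → ℤ} → (∀ i → f i ℤ.≤ g i) → ∀ j → f j ≢ g j → sum f ℤ.< sum g
sum-strict h j ne = ℤ.≤∧≢⇒< (sum-mono h) λ e → ne (sum-tight h (sym e) j)

-- Breadth-first search in the graph whose nodes are the values of q and in which every dart d with
-- A d is an arc from the class of α d to the class of d.

module _ {m : ℕ} (q α : Fin m → Fin m) (A : Fin m → Bool) (r : Fin m) where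

  -- A tree edge is stored at its child end: `par c` is the dart at `c` through which `c` was
  -- entered, and `T` marks these darts. Tree edges then correspond to the nodes other than the
  -- root. Of `rk` it matters only that it decreases towards the root.
  record Forest : Set where
    field
      C     : Fin m → Bool
      par   : Fin m → Fin m
      rk    : Fin m → ℕ
      top   : ℕ
      rk≤   : ∀ x → rk x ℕ.≤ top
      root  : C r ≡ true
      par-q : ∀ c → C c ≡ true → c ≢ r → q (par c) ≡ c
      par-A : ∀ c → C c ≡ true → c ≢ r → A (par c) ≡ true
      par-C : ∀ c → C c ≡ true → c ≢ r → C (q (α (par c))) ≡ true
      par-< : ∀ c → C c ≡ true → c ≢ r → rk (q (α (par c))) ℕ.< rk c

    T : Fin m → Bool
    T d = C (q d) ∧ (not (q d == r) ∧ (par (q d) == d))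

  record SearchTree : Set where
    field
      forest : Forest
    open Forest forest public
    field
      closed : ∀ d → C (q (α d)) ≡ true → A d ≡ true → C (q d) ≡ true

    T-C : ∀ {d} → T d ≡ true → C (q d) ≡ true
    T-C {d} e = proj₁ (∧-true {C (q d)} e)

    T-≢r : ∀ {d} → T d ≡ true → q d ≢ r
    T-≢r {d} e = ==-≢ (not-true (proj₁ (∧-true (proj₂ (∧-true {C (q d)} e)))))

    T-par : ∀ {d} → T d ≡ true → par (q d) ≡ d
    T-par {d} e = ==-≡ (proj₂ (∧-true {not (q d == r)} (proj₂ (∧-true {C (q d)} e))))

    T-A : ∀ {d} → T d ≡ true → A d ≡ true
    T-A e = subst (λ z → A z ≡ true) (T-par e) (par-A _ (T-C e) (T-≢r e))

    T-C′ : ∀ {d} → T d ≡ true → C (q (α d)) ≡ true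
    T-C′ e = subst (λ z → C (q (α z)) ≡ true) (T-par e) (par-C _ (T-C e) (T-≢r e))

    T-< : ∀ {d} → T d ≡ true → rk (q (α d)) ℕ.< rk (q d)
    T-< {d} e = subst (λ z → rk (q (α z)) ℕ.< rk (q d)) (T-par e) (par-< _ (T-C e) (T-≢r e))

    par-T : ∀ c → C c ≡ true → c ≢ r → T (par c) ≡ true
    par-T c h ne = cong₂ _∧_ (trans (cong C (par-q c h ne)) h)
      (cong₂ _∧_ (cong not (≢-== (λ e → ne (trans (sym (par-q c h ne)) e))))
                 (≡-== (cong par (par-q c h ne))))

    -- Each node of the tree other than the root is the child end of exactly one marked dart.
    sum-T : (∀ x → q (q x) ≡ q x) → ∀ (f : Fin m → ℤ) →
            sum (λ d → # (T d) ℤ.* f (q d)) ≡ sum (λ c → # (q c == c) ℤ.* (# (C c ∧ not (c == r)) ℤ.* f c))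
    sum-T qq f = trans (sum-fibres q qq _) (sum-cong λ c → fibre c (C c) (c F.≟ r) refl)
      where
      elsewhere : ∀ c d → ¬ ((q d ≡ c) × (T d ≡ true)) → # (q d == c) ℤ.* (# (T d) ℤ.* f (q d)) ≡ 0ℤ
      elsewhere c d no′ with q d F.≟ c | T d
      ... | no  _ | _     = refl
      ... | yes e | true  = contradiction (e , refl) no′
      ... | yes e | false = refl
      Goal : Fin m → Set
      Goal c = # (q c == c) ℤ.* sum (λ d → # (q d == c) ℤ.* (# (T d) ℤ.* f (q d)))
             ≡ # (q c == c) ℤ.* (# (C c ∧ not (c == r)) ℤ.* f c)
      fibre : ∀ c b (x : Dec (c ≡ r)) → C c ≡ b → Goal c
      fibre c false x e = cong (λ z → # (q c == c) ℤ.* z)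
        (trans (sum-0 λ d → elsewhere c d λ (p , t) → true≢false (trans (cong C (sym p)) (T-C t)) e)
               (cong (λ b → # (b ∧ not (c == r)) ℤ.* f c) (sym e)))
      fibre c true (yes p) e = cong (λ z → # (q c == c) ℤ.* z)
        (trans (sum-0 λ d → elsewhere c d λ (p′ , t) → T-≢r t (trans p′ p))
               (sym (cong₂ (λ b b′ → # (b ∧ not b′) ℤ.* f c) e (≡-== p))))
      fibre c true (no p) e = cong (λ z → # (q c == c) ℤ.* z)
        (trans (sum-only (par c) λ d ne → elsewhere c d λ (p′ , t) → ne (trans (sym (T-par t)) (cong par p′)))
        (trans (cong₂ (λ b b′ → # b ℤ.* (# b′ ℤ.* f (q (par c)))) (≡-== (par-q c e p)) (par-T c e p))
        (trans (ℤ.*-identityˡ (1ℤ ℤ.* f (q (par c))))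
        (trans (cong (λ z → 1ℤ ℤ.* f z) (par-q c e p))
               (sym (cong₂ (λ b b′ → # (b ∧ not b′) ℤ.* f c) e (≢-== p)))))))

  rootOnly : Forest
  rootOnly = record
    { C = _== r ; par = λ _ → r ; rk = λ _ → 0 ; top = 0 ; rk≤ = λ _ → z≤n ; root = ≡-== {x = r} refl
    ; par-q = λ c h ne → contradiction (==-≡ h) ne
    ; par-A = λ c h ne → contradiction (==-≡ h) ne
    ; par-C = λ c h ne → contradiction (==-≡ h) ne
    ; par-< = λ c h ne → contradiction (==-≡ h) ne }

  module Grow (f : Forest) (d : Fin m) where
    open Forest f
    module _ (inside : C (q (α d)) ≡ true) (outside : C (q d) ≡ false) (Ad : A d ≡ true) where
      C′ : Fin m → Bool
      C′ x = if x == q d then true else C x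
      par′ : Fin m → Fin m
      par′ x = if x == q d then d else par x
      rk′ : Fin m → ℕ
      -- The rank is the time of discovery, not the depth: `top` bounds all earlier ranks, so the
      -- new node exceeds its parent.
      rk′ x = if x == q d then suc top else rk x
      C⊆ : ∀ x → C x ≡ true → C′ x ≡ true
      C⊆ x h with x == q d
      ... | true  = refl
      ... | false = h
      old-rk : ∀ x → C x ≡ true → rk′ x ≡ rk x
      old-rk x h with x F.≟ q d
      ... | yes e = true≢false h (trans (cong C e) outside)
      ... | no  _ = refl
      grow : Forest
      grow = record
        { C = C′ ; par = par′ ; rk = rk′ ; top = suc top ; rk≤ = bound ; root = C⊆ r root
        ; par-q = pq ; par-A = pA ; par-C = pC ; par-< = p< }
        where
        bound : ∀ x → rk′ x ℕ.≤ suc top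
        bound x with x == q d
        ... | true  = ℕ.≤-refl
        ... | false = ℕ.m≤n⇒m≤1+n (rk≤ x)
        pq : ∀ c → C′ c ≡ true → c ≢ r → q (par′ c) ≡ c
        pq c h ne with c F.≟ q d
        ... | yes e = sym e
        ... | no  _ = par-q c h ne
        pA : ∀ c → C′ c ≡ true → c ≢ r → A (par′ c) ≡ true
        pA c h ne with c F.≟ q d
        ... | yes e = Ad
        ... | no  _ = par-A c h ne
        pC : ∀ c → C′ c ≡ true → c ≢ r → C′ (q (α (par′ c))) ≡ true
        pC c h ne with c F.≟ q d
        ... | yes e = C⊆ _ inside
        ... | no  _ = C⊆ _ (par-C c h ne)
        p< : ∀ c → C′ c ≡ true → c ≢ r → rk′ (q (α (par′ c))) ℕ.< rk′ c
        p< c h ne with c F.≟ q d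
        ... | yes e = s≤s (subst (ℕ._≤ top) (sym (old-rk _ inside)) (rk≤ _))
        ... | no  _ = subst (ℕ._< rk c) (sym (old-rk _ (par-C c h ne))) (par-< c h ne)
      smaller : sum (λ x → # (not (C′ x))) ℤ.< sum (λ x → # (not (C x)))
      smaller = sum-strict le (q d) ne
        where
        le : ∀ x → # (not (C′ x)) ℤ.≤ # (not (C x))
        le x with x == q d
        ... | false = ℤ.≤-refl
        ... | true with C x
        ...   | true  = ℤ.≤-refl
        ...   | false = ℤ.+≤+ z≤n
        ne : # (not (C′ (q d))) ≢ # (not (C (q d)))
        ne e with () ← trans (sym (cong (λ b → # (not b)) (cong (λ b → if b then true else C (q d)) (≡-== {x = q d} refl))))
                             (trans e (cong (λ b → # (not b)) outside))

  search : SearchTree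
  search = go (ℤ.∣ missing rootOnly ∣) rootOnly (ℤ.≤-reflexive (sym (ℤ.0≤i⇒+∣i∣≡i (missing≥0 rootOnly))))
    where
    missing : Forest → ℤ
    missing f = sum (λ x → # (not (Forest.C f x)))
    #≥0 : ∀ b → 0ℤ ℤ.≤ # b
    #≥0 true  = ℤ.+≤+ z≤n
    #≥0 false = ℤ.+≤+ z≤n
    missing≥0 : ∀ f → 0ℤ ℤ.≤ missing f
    missing≥0 f = subst (ℤ._≤ missing f) (sum-0 {m} {λ _ → 0ℤ} λ _ → refl) (sum-mono λ x → #≥0 _)
    go : ∀ n f → missing f ℤ.≤ + n → SearchTree
    go n f le with F.any? (λ d → (Forest.C f (q (α d)) Bool.≟ true) ×-dec
                             ((Forest.C f (q d) Bool.≟ false) ×-dec (A d Bool.≟ true)))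
    ... | no none = record { forest = f ; closed = closed′ }
      where
      closed′ : ∀ d → Forest.C f (q (α d)) ≡ true → A d ≡ true → Forest.C f (q d) ≡ true
      closed′ d i a with Forest.C f (q d) in o
      ... | true  = refl
      ... | false = contradiction (d , i , o , a) none
    go zero f le | yes (d , i , o , a) =
      contradiction (ℤ.<-≤-trans (Grow.smaller f d i o a) le) (ℤ.≤⇒≯ (missing≥0 (Grow.grow f d i o a)))
    go (suc n) f le | yes (d , i , o , a) =
      go n (Grow.grow f d i o a) (ℤ.i<j⇒i≤pred[j] (ℤ.<-≤-trans (Grow.smaller f d i o a) le))

-- The web as a rotation system with cyclically numbered boundary darts

csuc : ∀ {k} → Fin (suc k) → Fin (suc k)
csuc i with view i
... | ‵fromℕ     = zero
... | ‵inject₁ j = suc j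

cpred-csuc : ∀ {k} (i : Fin (suc k)) → cpred (csuc i) ≡ i
cpred-csuc i with view i
... | ‵fromℕ     = refl
... | ‵inject₁ j = refl

csuc-cpred : ∀ {k} (i : Fin (suc k)) → csuc (cpred i) ≡ i
csuc-cpred {k} zero    rewrite view-fromℕ k   = refl
csuc-cpred     (suc i) rewrite view-inject₁ i = refl

csuc-toℕ : ∀ {k} (i : Fin (suc k)) → toℕ i < k → toℕ (csuc i) ≡ suc (toℕ i)
csuc-toℕ {k} i i<k with view i
... | ‵fromℕ     = contradiction (F.toℕ-fromℕ k) (ℕ.<⇒≢ i<k)
... | ‵inject₁ j = cong suc (sym (F.toℕ-inject₁ j))

-- Position `j` is the boundary vertex j, and position 0 is the last vertex; this agrees with the
-- convention that B_0 and B_N are the same face.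
cyclic : ∀ {k} → ℕ → Fin (suc k)
cyclic {k} zero    = fromℕ k
cyclic     (suc j) = csuc (cyclic j)

cyclic-toℕ : ∀ {k} j → j ≤ k → toℕ (cyclic {k} (suc j)) ≡ j
cyclic-toℕ {k} zero    j≤k rewrite view-fromℕ k = refl
cyclic-toℕ {k} (suc j) j≤k = trans (csuc-toℕ (cyclic (suc j)) (subst (_< k) (sym ih) j≤k)) (cong suc ih)
  where
  ih : toℕ (cyclic {k} (suc j)) ≡ j
  ih = cyclic-toℕ j (ℕ.<⇒≤ j≤k)

cyclic-period : ∀ {k} j → cyclic {k} (j + suc k) ≡ cyclic j
cyclic-period {k} zero    = F.toℕ-injective (trans (cyclic-toℕ k ℕ.≤-refl) (sym (F.toℕ-fromℕ k)))
cyclic-period     (suc j) = cong csuc (cyclic-period j)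

module Map {n′ : ℕ} (W : Web (suc n′)) where

  N₀ : ℕ
  N₀ = 3 * suc n′

  D : Set
  D = Dart W

  nd : ℕ
  nd = N₀ + M W

  s a : D → D
  s = σ W
  a = α W

  col : D → Bool
  col = colour W

  aa : ∀ d → a (a d) ≡ d
  aa = α-invol W

  hub-isHub : ∀ k → isHub W (hub W k)
  hub-isHub k = subst (_< N₀) (sym (F.toℕ-↑ˡ k (M W))) (F.toℕ<n k)

  isHub⇒hub : ∀ d → isHub W d → ∃ λ k → d ≡ hub W k
  isHub⇒hub d h with splitAt N₀ d in eq
  ... | inj₁ k = k , sym (F.splitAt⁻¹-↑ˡ eq)
  ... | inj₂ j = contradiction h (ℕ.≤⇒≯ (subst (λ z → N₀ ≤ toℕ z) (F.splitAt⁻¹-↑ʳ eq)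
                   (subst (N₀ ≤_) (sym (F.toℕ-↑ʳ N₀ j)) (ℕ.m≤m+n N₀ _))))

  hub? : ∀ d → Dec (isHub W d)
  hub? d = toℕ d ℕ.<? N₀

  s-hub : ∀ k → s (hub W k) ≡ hub W (cpred k)
  s-hub = σ-hub W

  abstract
    -- hb k is the hub dart of the boundary vertex k, with indices read modulo N.
    hb : ℕ → D
    hb k = hub W (cyclic k)

    hb-N : ∀ k → hb (k + N₀) ≡ hb k
    hb-N k = cong (hub W) (cyclic-period k)

    hub-index : ∀ k → hub W k ≡ hb (suc (toℕ k))
    hub-index k = cong (hub W) (F.toℕ-injective (sym (cyclic-toℕ (toℕ k) (ℕ.≤-pred (F.toℕ<n k)))))

    s-hb : ∀ k → s (hb (suc k)) ≡ hb k
    s-hb k = trans (s-hub _) (cong (hub W) (cpred-csuc (cyclic k)))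

    hb-suc≢0 : ∀ j → suc j < N₀ → hb (suc j) ≢ hb 0
    hb-suc≢0 j j< e = ℕ.<⇒≢ (ℕ.≤-pred j<) (trans (sym (cyclic-toℕ j (ℕ.<⇒≤ (ℕ.≤-pred j<))))
      (trans (cong toℕ (F.↑ˡ-injective (M W) (cyclic (suc j)) (cyclic 0) e)) (F.toℕ-fromℕ _)))

    hb-isHub : ∀ k → isHub W (hb k)
    hb-isHub k = hub-isHub (cyclic k)

  s-isHub : ∀ {d} → isHub W d → isHub W (s d)
  s-isHub {d} h with k , e ← isHub⇒hub d h = subst (isHub W) (sym (trans (cong s e) (s-hub k))) (hub-isHub (cpred k))

  s³ : ∀ {d} → ¬ isHub W d → s (s (s d)) ≡ d
  s³ = σ-deg3 W _

  s-¬hub : ∀ {d} → ¬ isHub W d → ¬ isHub W (s d)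
  s-¬hub h h′ = h (subst (isHub W) (s³ h) (s-isHub (s-isHub h′)))

  s≢ : ∀ {d} → ¬ isHub W d → s d ≢ d
  s≢ = σ-nofix W _

  s²≢ : ∀ {d} → ¬ isHub W d → s (s d) ≢ d
  s²≢ h e = s≢ h (trans (sym (cong s e)) (s³ h))

  col-s : ∀ d → col (s d) ≡ col d
  col-s = colour-σ W

  col-a : ∀ d → col (a d) ≡ not (col d)
  col-a d with col (a d) | col d | colour-α W d
  ... | true  | true  | ne = contradiction refl ne
  ... | true  | false | _  = refl
  ... | false | true  | _  = refl
  ... | false | false | ne = contradiction refl ne

  col-isHub : ∀ {d} → isHub W d → col d ≡ true
  col-isHub {d} h with k , e ← isHub⇒hub d h = trans (cong col e) (colour-hub W k)

  sink-¬hub : ∀ {d} → col d ≡ false → ¬ isHub W d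
  sink-¬hub e h with () ← trans (sym (col-isHub h)) e

  abstract
    s⁻ : D → D
    s⁻ d = [ (λ k → hub W (csuc k)) , (λ _ → s (s d)) ]′ (splitAt N₀ d)

    s⁻-hub : ∀ k → s⁻ (hub W k) ≡ hub W (csuc k)
    s⁻-hub k = cong [ _ , _ ]′ (F.splitAt-↑ˡ N₀ k (M W))

    s⁻-int : ∀ {d} → ¬ isHub W d → s⁻ d ≡ s (s d)
    s⁻-int {d} h with splitAt N₀ d in eq
    ... | inj₁ k = contradiction (subst (isHub W) (F.splitAt⁻¹-↑ˡ eq) (hub-isHub k)) h
    ... | inj₂ _ = refl

    s-s⁻ : ∀ d → s (s⁻ d) ≡ d
    s-s⁻ d with hub? d
    ... | no h = trans (cong s (s⁻-int h)) (s³ h)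
    ... | yes h with k , refl ← isHub⇒hub d h =
      trans (cong s (s⁻-hub k)) (trans (s-hub (csuc k)) (cong (hub W) (cpred-csuc k)))

    s⁻-s : ∀ d → s⁻ (s d) ≡ d
    s⁻-s d with hub? d
    ... | no h = trans (s⁻-int (s-¬hub h)) (s³ h)
    ... | yes h with k , refl ← isHub⇒hub d h =
      trans (cong s⁻ (s-hub k)) (trans (s⁻-hub (cpred k)) (cong (hub W) (csuc-cpred k)))

  f : D → D
  f = φ W

  f⁻ : D → D
  f⁻ d = a (s⁻ d)

  f-f⁻ : ∀ d → f (f⁻ d) ≡ d
  f-f⁻ d = trans (cong s (aa (s⁻ d))) (s-s⁻ d)

  f⁻-f : ∀ d → f⁻ (f d) ≡ d
  f⁻-f d = trans (cong a (s⁻-s (a d))) (aa d)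

  f-a : ∀ d → f (a d) ≡ s d
  f-a d = cong s (aa d)

  col-f : ∀ d → col (f d) ≡ not (col d)
  col-f d = trans (col-s (a d)) (col-a d)

  module V = Orbits s s⁻ s-s⁻ s⁻-s
  module Fc = Orbits f f⁻ f-f⁻ f⁻-f

  vert face : D → D
  vert = V.rep
  face = Fc.rep

  vert-s : ∀ d → vert (s d) ≡ vert d
  vert-s = V.rep-f

  face-f : ∀ d → face (f d) ≡ face d
  face-f = Fc.rep-f

  face-s : ∀ d → face (s d) ≡ face (a d)
  face-s d = trans (cong face (sym (f-a d))) (face-f (a d))

  face-as² : ∀ {d} → ¬ isHub W d → face (a (s (s d))) ≡ face d
  face-as² {d} h = trans (sym (face-s (s (s d)))) (cong face (s³ h))

  face-as : ∀ d → face (a (s d)) ≡ face (s (s d))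
  face-as d = sym (face-s (s d))

  iter-hub : ∀ i {d} → isHub W d → isHub W (iter s i d)
  iter-hub zero    h = h
  iter-hub (suc i) h = s-isHub (iter-hub i h)

  vert-isHub : ∀ {d e} → vert d ≡ vert e → isHub W d → isHub W e
  vert-isHub eq h with i , e ← V.rep⇒orb eq = subst (isHub W) e (iter-hub i h)

  vert-three : ∀ {d e} → ¬ isHub W d → vert e ≡ vert d → (e ≡ d) ⊎ (e ≡ s d) ⊎ (e ≡ s (s d))
  vert-three {d} h eq with i , p ← V.rep⇒orb (sym eq) = go i p
    where
    go : ∀ i {e} → iter s i d ≡ e → (e ≡ d) ⊎ (e ≡ s d) ⊎ (e ≡ s (s d))
    go zero    p = inj₁ (sym p)
    go (suc i) p with go i refl
    ... | inj₁ q        = inj₂ (inj₁ (trans (sym p) (cong s q)))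
    ... | inj₂ (inj₁ q) = inj₂ (inj₂ (trans (sym p) (cong s q)))
    ... | inj₂ (inj₂ q) = inj₁ (trans (sym p) (trans (cong s q) (s³ h)))

  hb-all : (P : D → Set) → (∀ d → P d → P (s d)) → P (hb 0) → ∀ k → k ≤ N₀ → P (hb k)
  hb-all P Ps P₀ k k≤ = subst (λ z → P (hb z)) (ℕ.m∸[m∸n]≡n k≤) (down (N₀ ∸ k) (ℕ.m∸n≤m N₀ k))
    where
    down : ∀ j → j ≤ N₀ → P (hb (N₀ ∸ j))
    down zero    _  = subst P (sym (hb-N 0)) P₀
    down (suc j) j< = subst P (trans (cong (s ∘ hb) (ℕ.+-∸-assoc 1 j<)) (s-hb (N₀ ∸ suc j))) (Ps _ (down j (ℕ.<⇒≤ j<)))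

  connect : (P : D → Set) → (∀ d → P d → P (s d)) → (∀ d → P d → P (a d)) → P (hb 0) → ∀ d → P d
  connect P Ps Pa P₀ d with ws , k , e ← connected W d = subst P e (go ws)
    where
    go : ∀ ws → P (walk s a ws (hub W k))
    go []           = subst P (sym (hub-index k)) (hb-all P Ps P₀ (suc (toℕ k)) (F.toℕ<n k))
    go (true  ∷ ws) = Ps _ (go ws)
    go (false ∷ ws) = Pa _ (go ws)

  hub-vert : ∀ {d} → isHub W d → vert d ≡ vert (hb 0)
  hub-vert {d} h with k , refl ← isHub⇒hub d h =
    trans (cong vert (hub-index k))
      (hb-all (λ d → vert d ≡ vert (hb 0)) (λ d e → trans (vert-s d) e) refl (suc (toℕ k)) (F.toℕ<n k))

-- A tree of vertices and a complementary tree of faces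

bool-≡ : ∀ {x y} → (x ≡ true → y ≡ true) → (y ≡ true → x ≡ true) → x ≡ y
bool-≡ {true}          f g = sym (f refl)
bool-≡ {false} {true}  f g = g refl
bool-≡ {false} {false} f g = refl

¬true : ∀ {b} → b ≢ true → b ≡ false
¬true {true}  h = contradiction refl h
¬true {false} h = refl

module TreeCotree {n′ : ℕ} (W : Web (suc n′)) (A : Map.D W → Bool) (x₀ : Map.D W) where
  open Map W

  hubv : D
  hubv = vert (hb 0)

  opaque
    vtree : SearchTree vert a A hubv
    vtree = search vert a A hubv

  module TV = SearchTree vtree
  open TV using (T; T-≢r; T-par; T-<; T-C; T-C′) public

  T-¬hub : ∀ {d} → T d ≡ true → ¬ isHub W d
  T-¬hub t h = T-≢r t (hub-vert h)

  free : D → Bool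
  free d = not (T d) ∧ not (T (a d))

  opaque
    ftree : SearchTree face a free (face x₀)
    ftree = search face a free (face x₀)

  module TF = SearchTree ftree
  open TF using () renaming (T to T*; T-A to T*-free; T-par to T*-par; T-< to T*-<; T-≢r to T*-≢r) public

  free-a : ∀ {d} → free d ≡ true → free (a d) ≡ true
  free-a {d} e with p , q ← ∧-true {not (T d)} e = cong₂ _∧_ q (trans (cong (not ∘ T) (aa d)) p)

  free-cases : ∀ d → (free d ≡ true) ⊎ (T d ≡ true) ⊎ (T (a d) ≡ true)
  free-cases d with T d | T (a d)
  ... | true  | _     = inj₂ (inj₁ refl)
  ... | false | true  = inj₂ (inj₂ refl)
  ... | false | false = inj₁ refl

  private
    S : D → Bool
    S d = TF.C (face d)

    S-face : ∀ {d e} → face d ≡ face e → S d ≡ S e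
    S-face = cong TF.C

    free-S : ∀ {d} → free d ≡ true → S d ≡ S (a d)
    free-S {d} e = bool-≡
      (λ h → TF.closed (a d) (trans (cong S (aa d)) h) (free-a e))
      (λ h → TF.closed d h e)

    -- Leaves first: around a vertex all edges but the one to the parent are already known to be
    -- crossed without change of S, hence so is the last one.
    peel : ∀ n d → TV.top ℕ.< TV.rk (vert d) ℕ.+ n → T d ≡ true → S d ≡ S (a d)
    peel zero    d b t = contradiction (TV.rk≤ (vert d)) (ℕ.<⇒≱ (subst (TV.top ℕ.<_) (ℕ.+-identityʳ _) b))
    peel (suc n) d b t = begin
      S d             ≡⟨ cong S (sym (s³ h)) ⟩
      S (s (s (s d))) ≡⟨ S-face (face-s (s (s d))) ⟩
      S (a (s (s d))) ≡⟨ sym (other (s (s d)) (trans (vert-s _) (vert-s d)) (s²≢ h)) ⟩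
      S (s (s d))     ≡⟨ S-face (face-s (s d)) ⟩
      S (a (s d))     ≡⟨ sym (other (s d) (vert-s d) (s≢ h)) ⟩
      S (s d)         ≡⟨ S-face (face-s d) ⟩
      S (a d)         ∎
      where
      open ≡-Reasoning
      h = T-¬hub t
      other : ∀ x → vert x ≡ vert d → x ≢ d → S x ≡ S (a x)
      other x v ne with free-cases x
      ... | inj₁ e        = free-S e
      ... | inj₂ (inj₁ e) = contradiction (trans (sym (T-par e)) (trans (cong TV.par v) (T-par t))) ne
      ... | inj₂ (inj₂ e) = trans (sym (cong S (aa x))) (sym (peel n (a x) bound e))
        where
        bound : TV.top ℕ.< TV.rk (vert (a x)) ℕ.+ n
        bound = ℕ.<-≤-trans b (subst (ℕ._≤ TV.rk (vert (a x)) ℕ.+ n) (sym (ℕ.+-suc _ n))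
          (ℕ.+-monoˡ-≤ n (subst (λ z → suc (TV.rk z) ℕ.≤ TV.rk (vert (a x))) (trans (cong vert (aa x)) v) (T-< e))))

    peel-all : ∀ d → S d ≡ S (a d)
    peel-all d with free-cases d
    ... | inj₁ e        = free-S e
    ... | inj₂ (inj₁ e) = peel (suc TV.top) d (ℕ.m≤n+m _ _) e
    ... | inj₂ (inj₂ e) = trans (sym (cong S (aa d))) (sym (peel (suc TV.top) (a d) (ℕ.m≤n+m _ _) e))

    S-const : ∀ d → S d ≡ S (hb 0)
    S-const = connect (λ d → S d ≡ S (hb 0))
      (λ d e → trans (S-face (face-s d)) (trans (sym (peel-all d)) e))
      (λ d e → trans (sym (peel-all d)) e) refl

  -- A tree does not separate the sphere, whether it spans or not: by `peel`, membership in the dual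
  -- tree is unchanged across the edges of the first tree as well, so it is constant by
  -- connectedness.
  faces-reached : ∀ d → TF.C (face d) ≡ true
  faces-reached d = trans (S-const d) (trans (sym (S-const x₀)) TF.root)

  -- An edge belongs to at most one of the two trees, and has at most one child end.
  exclusive : ∀ d → # (T d) ℤ.+ # (T (a d)) ℤ.+ (# (T* d) ℤ.+ # (T* (a d))) ℤ.≤ 1ℤ
  exclusive d with T d in t | T (a d) in t′ | T* d in u | T* (a d) in u′
  ... | true  | true  | _     | _     = contradiction (subst (λ z → TV.rk (vert z) ℕ.< TV.rk (vert (a d))) (aa d) (T-< t′)) (ℕ.<-asym (T-< t))
  ... | _     | _     | true  | true  = contradiction (subst (λ z → TF.rk (face z) ℕ.< TF.rk (face (a d))) (aa d) (T*-< u′)) (ℕ.<-asym (T*-< u))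
  ... | true  | false | true  | false = true≢false t (not-true (proj₁ (∧-true {not (T d)} (T*-free u))))
  ... | false | true  | true  | false = true≢false t′ (not-true (proj₂ (∧-true {not (T d)} (T*-free u))))
  ... | true  | false | false | true  = true≢false t (trans (sym (cong T (aa d))) (not-true (proj₂ (∧-true {not (T (a d))} (T*-free u′)))))
  ... | false | true  | false | true  = true≢false t′ (not-true (proj₁ (∧-true {not (T (a d))} (T*-free u′))))
  ... | true  | false | false | false = ℤ.≤-refl
  ... | false | true  | false | false = ℤ.≤-refl
  ... | false | false | true  | false = ℤ.≤-refl
  ... | false | false | false | true  = ℤ.≤-refl
  ... | false | false | false | false = ℤ.+≤+ z≤n

-- Counting darts by edges and by vertices; Euler's formula

module Count {n′ : ℕ} (W : Web (suc n′)) where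
  open Map W
  open ≡-Reasoning

  sum-s : ∀ (g : D → ℤ) → sum (g ∘ s) ≡ sum g
  sum-s = sum-reindex s s⁻ s-s⁻ s⁻-s

  sum-f : ∀ (g : D → ℤ) → sum (g ∘ f) ≡ sum g
  sum-f = sum-reindex f f⁻ f-f⁻ f⁻-f

  sum-a : ∀ (g : D → ℤ) → sum (g ∘ a) ≡ sum g
  sum-a = sum-reindex a a aa aa

  -- Every edge has exactly one source end.
  sum-edges : ∀ (g : D → ℤ) → sum g ≡ sum (λ d → # (col d) ℤ.* (g d ℤ.+ g (a d)))
  sum-edges g = begin
    sum g
      ≡⟨ sum-cong (λ d → split (col d) (g d)) ⟩
    sum (λ d → # (col d) ℤ.* g d ℤ.+ # (not (col d)) ℤ.* g d)
      ≡⟨ sum-+ (λ d → # (col d) ℤ.* g d) (λ d → # (not (col d)) ℤ.* g d) ⟩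
    sum (λ d → # (col d) ℤ.* g d) ℤ.+ sum (λ d → # (not (col d)) ℤ.* g d)
      ≡⟨ cong (λ z → sum (λ d → # (col d) ℤ.* g d) ℤ.+ z) (trans
           (sym (sum-a (λ d → # (not (col d)) ℤ.* g d)))
           (sum-cong λ d → cong (λ b → # b ℤ.* g (a d)) (trans (cong not (col-a d)) (not² (col d))))) ⟩
    sum (λ d → # (col d) ℤ.* g d) ℤ.+ sum (λ d → # (col d) ℤ.* g (a d))
      ≡⟨ sym (sum-+ (λ d → # (col d) ℤ.* g d) (λ d → # (col d) ℤ.* g (a d))) ⟩
    sum (λ d → # (col d) ℤ.* g d ℤ.+ # (col d) ℤ.* g (a d))
      ≡⟨ sum-cong (λ d → sym (ℤ.*-distribˡ-+ (# (col d)) (g d) (g (a d)))) ⟩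
    sum (λ d → # (col d) ℤ.* (g d ℤ.+ g (a d))) ∎
    where
    not² : ∀ b → not (not b) ≡ b
    not² true  = refl
    not² false = refl
    split : ∀ b z → z ≡ # b ℤ.* z ℤ.+ # (not b) ℤ.* z
    split true  = solve-∀
    split false = solve-∀

  minV minF : D → Bool
  minV d = vert d == d
  minF d = face d == d

  minV-three : ∀ {d} → ¬ isHub W d → # (minV d) ℤ.+ # (minV (s d)) ℤ.+ # (minV (s (s d))) ≡ 1ℤ
  minV-three {d} h with vert-three h (V.rep-rep d)
  ... | inj₁ e = cong₂ ℤ._+_ (cong₂ ℤ._+_
          (cong # (≡-== e))
          (cong # (≢-== λ p → s≢ h (trans (sym p) (trans (vert-s d) e)))))
          (cong # (≢-== λ p → s²≢ h (trans (sym p) (trans (vert-s _) (trans (vert-s d) e)))))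
  ... | inj₂ (inj₁ e) = cong₂ ℤ._+_ (cong₂ ℤ._+_
          (cong # (≢-== λ p → s≢ h (trans (sym e) p)))
          (cong # (≡-== (trans (vert-s d) e))))
          (cong # (≢-== λ p → s≢ (s-¬hub h) (trans (sym p) (trans (vert-s _) (trans (vert-s d) e)))))
  ... | inj₂ (inj₂ e) = cong₂ ℤ._+_ (cong₂ ℤ._+_
          (cong # (≢-== λ p → s²≢ h (trans (sym e) p)))
          (cong # (≢-== λ p → s≢ (s-¬hub h) (trans (sym e) (trans (sym (vert-s d)) p)))))
          (cong # (≡-== (trans (vert-s _) (trans (vert-s d) e))))

  -- Every vertex other than the hub has three darts; the hub, whose degree is N, is removed by the
  -- vanishing of `g`.
  sum-vertices : ∀ (g : D → ℤ) → (∀ d → g (s d) ≡ g d) → (∀ d → isHub W d → g d ≡ 0ℤ) →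
                 sum g ≡ + 3 ℤ.* sum (λ d → # (minV d) ℤ.* g d)
  sum-vertices g gs g0 = begin
    sum g
      ≡⟨ sum-cong pointwise ⟩
    sum (λ d → k d ℤ.+ k (s d) ℤ.+ k (s (s d)))
      ≡⟨ sum-+ (λ d → k d ℤ.+ k (s d)) (k ∘ s ∘ s) ⟩
    sum (λ d → k d ℤ.+ k (s d)) ℤ.+ sum (k ∘ s ∘ s)
      ≡⟨ cong₂ ℤ._+_ (trans (sum-+ k (k ∘ s)) (cong (λ z → sum k ℤ.+ z) (sum-s k)))
           (trans (sum-s (k ∘ s)) (sum-s k)) ⟩
    sum k ℤ.+ sum k ℤ.+ sum k
      ≡⟨ triple (sum k) ⟩
    + 3 ℤ.* sum k ∎
    where
    k : D → ℤ
    k d = # (minV d) ℤ.* g d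
    triple : ∀ z → z ℤ.+ z ℤ.+ z ≡ + 3 ℤ.* z
    triple = solve-∀
    factor : ∀ x y z w → x ℤ.* w ℤ.+ y ℤ.* w ℤ.+ z ℤ.* w ≡ (x ℤ.+ y ℤ.+ z) ℤ.* w
    factor = solve-∀
    pointwise : ∀ d → g d ≡ k d ℤ.+ k (s d) ℤ.+ k (s (s d))
    pointwise d with hub? d
    ... | yes h = trans (g0 d h) (sym (cong₂ ℤ._+_ (cong₂ ℤ._+_ (zero′ d h) (zero′ (s d) (s-isHub h)))
                    (zero′ (s (s d)) (s-isHub (s-isHub h)))))
      where
      zero′ : ∀ d → isHub W d → k d ≡ 0ℤ
      zero′ d h = trans (cong (λ z → # (minV d) ℤ.* z) (g0 d h)) (ℤ.*-zeroʳ (# (minV d)))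
    ... | no h = sym (begin
      k d ℤ.+ k (s d) ℤ.+ k (s (s d))
        ≡⟨ cong₂ (λ x y → k d ℤ.+ # (minV (s d)) ℤ.* x ℤ.+ # (minV (s (s d))) ℤ.* y) (gs d) (trans (gs (s d)) (gs d)) ⟩
      k d ℤ.+ # (minV (s d)) ℤ.* g d ℤ.+ # (minV (s (s d))) ℤ.* g d
        ≡⟨ factor (# (minV d)) (# (minV (s d))) (# (minV (s (s d)))) (g d) ⟩
      (# (minV d) ℤ.+ # (minV (s d)) ℤ.+ # (minV (s (s d)))) ℤ.* g d
        ≡⟨ cong (ℤ._* g d) (minV-three h) ⟩
      1ℤ ℤ.* g d
        ≡⟨ ℤ.*-identityˡ (g d) ⟩
      g d ∎)

  hubv : D
  hubv = vert (hb 0)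

  inner : D → Bool
  inner c = not (c == hubv)

  -- The hub is left out of `nV`; hence `euler` has the constant 1 instead of 2.
  nV nF nE : ℤ
  nV = sum (λ c → # (minV c) ℤ.* # (inner c))
  nF = sum (λ c → # (minF c))
  nE = sum (λ d → # (col d))

  numOrbits-σ : + numOrbits s ≡ 1ℤ ℤ.+ nV
  numOrbits-σ = begin
    + numOrbits s
      ≡⟨ V.numOrbits≡ ⟩
    sum (λ d → # (minV d))
      ≡⟨ sum-cong (λ d → split (d == hubv) (# (minV d))) ⟩
    sum (λ d → # (d == hubv) ℤ.* # (minV d) ℤ.+ # (minV d) ℤ.* # (inner d))
      ≡⟨ sum-+ (λ d → # (d == hubv) ℤ.* # (minV d)) (λ d → # (minV d) ℤ.* # (inner d)) ⟩
    sum (λ d → # (d == hubv) ℤ.* # (minV d)) ℤ.+ nV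
      ≡⟨ cong (ℤ._+ nV) (trans (sum-δ hubv (λ d → # (minV d))) (cong # (≡-== (V.rep-rep (hb 0))))) ⟩
    1ℤ ℤ.+ nV ∎
    where
    split : ∀ b z → z ≡ # b ℤ.* z ℤ.+ z ℤ.* # (not b)
    split true  = solve-∀
    split false = solve-∀

  numOrbits-α : + numOrbits a ≡ nE
  numOrbits-α = ℤ.*-cancelˡ-≡ (+ 2) _ _ (begin
    + 2 ℤ.* + numOrbits a
      ≡⟨ cong (λ z → + 2 ℤ.* z) E.numOrbits≡ ⟩
    + 2 ℤ.* sum min
      ≡⟨ double (sum min) ⟩
    sum min ℤ.+ sum min
      ≡⟨ cong (λ z → sum min ℤ.+ z) (sym (sum-a min)) ⟩
    sum min ℤ.+ sum (min ∘ a)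
      ≡⟨ sym (sum-+ min (min ∘ a)) ⟩
    sum (λ d → min d ℤ.+ min (a d))
      ≡⟨ sum-cong one ⟩
    sum {nd} (λ _ → 1ℤ)
      ≡⟨ sum-edges (λ _ → 1ℤ) ⟩
    sum (λ d → # (col d) ℤ.* (+ 2))
      ≡⟨ trans (sum-cong λ d → ℤ.*-comm (# (col d)) (+ 2)) (sum-*ˡ (+ 2) (λ d → # (col d))) ⟩
    + 2 ℤ.* nE ∎)
    where
    module E = Orbits a a aa aa
    min : D → ℤ
    min d = # (E.rep d == d)
    double : ∀ z → + 2 ℤ.* z ≡ z ℤ.+ z
    double = solve-∀
    orb : ∀ {d e} → E.Orb d e → (e ≡ d) ⊎ (e ≡ a d)
    orb (zero , p) = inj₁ (sym p)
    orb (suc i , p) with orb (i , refl)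
    ... | inj₁ q = inj₂ (trans (sym p) (cong a q))
    ... | inj₂ q = inj₁ (trans (sym p) (trans (cong a q) (aa _)))
    one : ∀ d → min d ℤ.+ min (a d) ≡ 1ℤ
    one d with orb (E.rep-orb d)
    ... | inj₁ e = cong₂ ℤ._+_ (cong # (≡-== e)) (cong # (≢-== λ p → α-nofix W d (trans (sym p) (trans (E.rep-f d) e))))
    ... | inj₂ e = cong₂ ℤ._+_ (cong # (≢-== λ p → α-nofix W d (trans (sym e) p))) (cong # (≡-== (trans (E.rep-f d) e)))

  euler : nV ℤ.+ nF ≡ 1ℤ ℤ.+ nE
  euler with planar W
  ... | inj₂ p = begin
    nV ℤ.+ nF
      ≡⟨ shift nV nF ⟩
    (1ℤ ℤ.+ nV) ℤ.+ nF ℤ.- 1ℤ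
      ≡⟨ cong (ℤ._- 1ℤ) (trans (cong₂ ℤ._+_ (sym numOrbits-σ) (sym Fc.numOrbits≡))
           (trans (sym (ℤ.pos-+ (numOrbits s) (numOrbits f))) (trans (cong +_ p) (ℤ.pos-+ 2 (numOrbits a))))) ⟩
    + 2 ℤ.+ + numOrbits a ℤ.- 1ℤ
      ≡⟨ cong (λ z → + 2 ℤ.+ z ℤ.- 1ℤ) numOrbits-α ⟩
    + 2 ℤ.+ nE ℤ.- 1ℤ
      ≡⟨ shift′ nE ⟩
    1ℤ ℤ.+ nE ∎
    where
    shift : ∀ x y → x ℤ.+ y ≡ (1ℤ ℤ.+ x) ℤ.+ y ℤ.- 1ℤ
    shift = solve-∀
    shift′ : ∀ x → + 2 ℤ.+ x ℤ.- 1ℤ ≡ 1ℤ ℤ.+ x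
    shift′ = solve-∀

#-≤1 : ∀ b {z} → z ℤ.≤ 1ℤ → # b ℤ.* z ℤ.≤ # b
#-≤1 true  h = subst (ℤ._≤ 1ℤ) (sym (ℤ.*-identityˡ _)) h
#-≤1 false h = ℤ.≤-refl

some-true : ∀ w x y z → 1ℤ ℤ.* (# w ℤ.+ # x ℤ.+ (# y ℤ.+ # z)) ≡ 1ℤ →
            (w ≡ true) ⊎ (x ≡ true) ⊎ (y ≡ true) ⊎ (z ≡ true)
some-true true  _     _     _    _ = inj₁ refl
some-true false true  _     _    _ = inj₂ (inj₁ refl)
some-true false false true  _    _ = inj₂ (inj₂ (inj₁ refl))
some-true false false false true _ = inj₂ (inj₂ (inj₂ refl))

-- Exactness: flows without divergence have a potential

module Homology {n′ : ℕ} (W : Web (suc n′)) where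
  open Map W
  open Count W

  -- For the flow of a closed walk in the dual, `w` is its winding number around the vertices of the
  -- web, that is, around the triangles.
  record Potential (g : D → ℤ) : Set where
    field
      w     : D → ℤ
      w-s   : ∀ d → w (s d) ≡ w d
      w-hub : ∀ d → isHub W d → w d ≡ 0ℤ
      w-d   : ∀ d → g d ≡ w d ℤ.- w (a d)

  module Build (g : D → ℤ) (anti : ∀ d → g (a d) ≡ ℤ.- g d)
               (circ : ∀ c → sum (λ d → # (face d == c) ℤ.* g d) ≡ 0ℤ) where
    open TreeCotree W (λ _ → true) (hb 0) hiding (hubv)

    reached : ∀ d → TV.C (vert d) ≡ true
    reached = connect (λ d → TV.C (vert d) ≡ true)
      (λ d h → trans (cong TV.C (vert-s d)) h)
      (λ d h → TV.closed (a d) (trans (cong (TV.C ∘ vert) (aa d)) h) refl)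
      TV.root

    -- The sum of `g` along the tree path from the hub. The first argument is fuel: it has to exceed
    -- the rank of the node, and by `stable` any such fuel gives the same value.
    value : ℕ → D → ℤ
    value zero    c = 0ℤ
    value (suc k) c = if c == hubv then 0ℤ else value k (vert (a (TV.par c))) ℤ.+ g (TV.par c)

    stable : ∀ k k′ c → TV.C c ≡ true → TV.rk c ℕ.< k → TV.rk c ℕ.< k′ → value k c ≡ value k′ c
    stable (suc k) (suc k′) c i (s≤s p) (s≤s p′) with c F.≟ hubv
    ... | yes _ = refl
    ... | no ne = cong (ℤ._+ g (TV.par c)) (stable k k′ _ (TV.par-C c i ne)
                    (ℕ.<-≤-trans (TV.par-< c i ne) p) (ℕ.<-≤-trans (TV.par-< c i ne) p′))

    w : D → ℤ
    w d = value (suc (TV.rk (vert d))) (vert d)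

    w-s : ∀ d → w (s d) ≡ w d
    w-s d = cong (λ c → value (suc (TV.rk c)) c) (vert-s d)

    w-hub : ∀ d → isHub W d → w d ≡ 0ℤ
    w-hub d h = cong (λ b → if b then 0ℤ else value (TV.rk (vert d)) (vert (a (TV.par (vert d)))) ℤ.+ g (TV.par (vert d)))
                  (≡-== (hub-vert h))

    w-T : ∀ {d} → T d ≡ true → w d ≡ w (a d) ℤ.+ g d
    w-T {d} t = begin
      w d ≡⟨ cong (λ b → if b then 0ℤ else value (TV.rk (vert d)) (vert (a (TV.par (vert d)))) ℤ.+ g (TV.par (vert d)))
               (≢-== (T-≢r t)) ⟩
      value (TV.rk (vert d)) (vert (a (TV.par (vert d)))) ℤ.+ g (TV.par (vert d))
          ≡⟨ cong (λ z → value (TV.rk (vert d)) (vert (a z)) ℤ.+ g z) (T-par t) ⟩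
      value (TV.rk (vert d)) (vert (a d)) ℤ.+ g d
          ≡⟨ cong (ℤ._+ g d) (stable _ _ (vert (a d)) (reached (a d)) (T-< t) ℕ.≤-refl) ⟩
      w (a d) ℤ.+ g d ∎
      where open ≡-Reasoning

    h : D → ℤ
    h d = g d ℤ.- (w d ℤ.- w (a d))

    h-anti : ∀ d → h (a d) ≡ ℤ.- h d
    h-anti d = trans (cong₂ (λ x y → x ℤ.- (w (a d) ℤ.- y)) (anti d) (cong w (aa d))) (alg (g d) (w d) (w (a d)))
      where
      alg : ∀ x y z → ℤ.- x ℤ.- (z ℤ.- y) ≡ ℤ.- (x ℤ.- (y ℤ.- z))
      alg = solve-∀

    h-circ : ∀ c → sum (λ d → # (face d == c) ℤ.* h d) ≡ 0ℤ
    h-circ c = begin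
      sum (λ d → # (face d == c) ℤ.* h d)
        ≡⟨ sum-cong (λ d → alg (# (face d == c)) (g d) (w d) (w (a d))) ⟩
      sum (λ d → G d ℤ.- (K d ℤ.- K′ d))
        ≡⟨ trans (sum-- G (λ d → K d ℤ.- K′ d)) (cong (λ z → sum G ℤ.- z) (sum-- K K′)) ⟩
      sum G ℤ.- (sum K ℤ.- sum K′)
        ≡⟨ cong₂ (λ x y → x ℤ.- (sum K ℤ.- y)) (circ c) K≡K′ ⟩
      0ℤ ℤ.- (sum K ℤ.- sum K)
        ≡⟨ alg′ (sum K) ⟩
      0ℤ ∎
      where
      open ≡-Reasoning
      G K K′ : D → ℤ
      G d = # (face d == c) ℤ.* g d
      K d = # (face d == c) ℤ.* w d
      K′ d = # (face d == c) ℤ.* w (a d)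
      K≡K′ : sum K′ ≡ sum K
      K≡K′ = trans (sum-cong λ d → cong₂ (λ x y → # (x == c) ℤ.* y) (sym (face-f d)) (sym (w-s (a d)))) (sum-f K)
      alg : ∀ b x y z → b ℤ.* (x ℤ.- (y ℤ.- z)) ≡ b ℤ.* x ℤ.- (b ℤ.* y ℤ.- b ℤ.* z)
      alg = solve-∀
      alg′ : ∀ x → 0ℤ ℤ.- (x ℤ.- x) ≡ 0ℤ
      alg′ = solve-∀

    h-T : ∀ {d} → T d ≡ true → h d ≡ 0ℤ
    h-T {d} t = trans (cong (λ z → g d ℤ.- (z ℤ.- w (a d))) (w-T t)) (alg (g d) (w (a d)))
      where
      alg : ∀ x y → x ℤ.- (y ℤ.+ x ℤ.- y) ≡ 0ℤ
      alg = solve-∀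

    h-a : ∀ {d} → h (a d) ≡ 0ℤ → h d ≡ 0ℤ
    h-a {d} e = trans (alg (h d)) (cong ℤ.-_ (trans (sym (h-anti d)) e))
      where
      alg : ∀ x → x ≡ ℤ.- (ℤ.- x)
      alg = solve-∀

    sum-#T : sum (λ d → # (T d)) ≡ nV
    sum-#T = begin
      sum (λ d → # (T d))
        ≡⟨ sum-cong (λ d → sym (ℤ.*-identityʳ (# (T d)))) ⟩
      sum (λ d → # (T d) ℤ.* 1ℤ)
        ≡⟨ TV.sum-T V.rep-rep (λ _ → 1ℤ) ⟩
      sum (λ c → # (minV c) ℤ.* (# (TV.C c ∧ inner c) ℤ.* 1ℤ))
        ≡⟨ sum-cong pw ⟩
      nV ∎
      where
      open ≡-Reasoning
      pw : ∀ c → # (minV c) ℤ.* (# (TV.C c ∧ inner c) ℤ.* 1ℤ) ≡ # (minV c) ℤ.* # (inner c)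
      pw c with vert c F.≟ c
      ... | no _  = refl
      ... | yes e = cong (λ z → 1ℤ ℤ.* z) (trans (ℤ.*-identityʳ _)
                      (cong (λ b → # (b ∧ inner c)) (trans (cong TV.C (sym e)) (reached c))))

    root-face : D
    root-face = face (hb 0)

    sum-#T* : 1ℤ ℤ.+ sum (λ d → # (T* d)) ≡ nF
    sum-#T* = begin
      1ℤ ℤ.+ sum (λ d → # (T* d))
        ≡⟨ cong₂ ℤ._+_ (sym (trans (sum-δ root-face (λ d → # (minF d))) (cong # (≡-== (Fc.rep-rep (hb 0))))))
             (trans (sum-cong (λ d → sym (ℤ.*-identityʳ (# (T* d))))) (TF.sum-T Fc.rep-rep (λ _ → 1ℤ))) ⟩
      sum (λ d → # (d == root-face) ℤ.* # (minF d)) ℤ.+ sum (λ c → # (minF c) ℤ.* (# (TF.C c ∧ not (c == root-face)) ℤ.* 1ℤ))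
        ≡⟨ sym (sum-+ (λ d → # (d == root-face) ℤ.* # (minF d)) _) ⟩
      sum (λ c → # (c == root-face) ℤ.* # (minF c) ℤ.+ # (minF c) ℤ.* (# (TF.C c ∧ not (c == root-face)) ℤ.* 1ℤ))
        ≡⟨ sum-cong pw ⟩
      nF ∎
      where
      open ≡-Reasoning
      pw : ∀ c → # (c == root-face) ℤ.* # (minF c) ℤ.+ # (minF c) ℤ.* (# (TF.C c ∧ not (c == root-face)) ℤ.* 1ℤ) ≡ # (minF c)
      pw c with face c F.≟ c
      ... | no _  = trans (ℤ.+-identityʳ _) (ℤ.*-zeroʳ (# (c == root-face)))
      ... | yes e with c == root-face | TF.C c in r
      ...   | true  | true  = refl
      ...   | true  | false = refl
      ...   | false | true  = refl
      ...   | false | false = true≢false (trans (cong TF.C (sym e)) (faces-reached c)) r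

    total : D → ℤ
    total d = # (T d) ℤ.+ # (T (a d)) ℤ.+ (# (T* d) ℤ.+ # (T* (a d)))

    -- By Euler's formula the two trees together have as many edges as the web.
    tight : ∀ d → # (col d) ℤ.* total d ≡ # (col d)
    tight = sum-tight (λ d → #-≤1 (col d) (exclusive d)) (sym (begin
      sum (λ d → # (col d) ℤ.* total d)
        ≡⟨ sum-cong (λ d → cong (λ z → # (col d) ℤ.* z) (swap (# (T d)) (# (T (a d))) (# (T* d)) (# (T* (a d))))) ⟩
      sum (λ d → # (col d) ℤ.* (# (T d) ℤ.+ # (T* d) ℤ.+ (# (T (a d)) ℤ.+ # (T* (a d)))))
        ≡⟨ sym (sum-edges (λ d → # (T d) ℤ.+ # (T* d))) ⟩
      sum (λ d → # (T d) ℤ.+ # (T* d))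
        ≡⟨ sum-+ (λ d → # (T d)) (λ d → # (T* d)) ⟩
      sum (λ d → # (T d)) ℤ.+ sum (λ d → # (T* d))
        ≡⟨ cong₂ ℤ._+_ sum-#T (move (sum (λ d → # (T* d)))) ⟩
      nV ℤ.+ (1ℤ ℤ.+ sum (λ d → # (T* d)) ℤ.- 1ℤ)
        ≡⟨ cong (λ z → nV ℤ.+ (z ℤ.- 1ℤ)) sum-#T* ⟩
      nV ℤ.+ (nF ℤ.- 1ℤ)
        ≡⟨ sym (ℤ.+-assoc nV nF (ℤ.- 1ℤ)) ⟩
      nV ℤ.+ nF ℤ.- 1ℤ
        ≡⟨ cong (ℤ._- 1ℤ) euler ⟩
      1ℤ ℤ.+ nE ℤ.- 1ℤ
        ≡⟨ sym (move nE) ⟩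
      nE ∎))
      where
      open ≡-Reasoning
      swap : ∀ x y z u → x ℤ.+ y ℤ.+ (z ℤ.+ u) ≡ x ℤ.+ z ℤ.+ (y ℤ.+ u)
      swap = solve-∀
      move : ∀ x → x ≡ 1ℤ ℤ.+ x ℤ.- 1ℤ
      move = solve-∀

    Covered : D → Set
    Covered d = (T d ≡ true) ⊎ (T (a d) ≡ true) ⊎ (T* d ≡ true) ⊎ (T* (a d) ≡ true)

    at-source : ∀ d → col d ≡ true → Covered d
    at-source d cd = some-true _ _ _ _ (subst (λ b → # b ℤ.* total d ≡ # b) cd (tight d))

    covered-a : ∀ d → Covered (a d) → Covered d
    covered-a d (inj₁ x)               = inj₂ (inj₁ x)
    covered-a d (inj₂ (inj₁ x))        = inj₁ (trans (sym (cong T (aa d))) x)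
    covered-a d (inj₂ (inj₂ (inj₁ x))) = inj₂ (inj₂ (inj₂ x))
    covered-a d (inj₂ (inj₂ (inj₂ x))) = inj₂ (inj₂ (inj₁ (trans (sym (cong T* (aa d))) x)))

    covered : ∀ d → Covered d
    covered d = go (col d) refl
      where
      go : ∀ b → col d ≡ b → Covered d
      go true  e = at-source d e
      go false e = covered-a d (at-source (a d) (trans (col-a d) (cong not e)))

    -- Leaves of the dual tree first: on all other edges of the child face `h` is already known to
    -- vanish, so the circulation around this face consists of the single term `h d`.
    h-T* : ∀ k d → TF.top ℕ.< TF.rk (face d) ℕ.+ k → T* d ≡ true → h d ≡ 0ℤ
    h-T* zero    d b t = contradiction (TF.rk≤ (face d)) (ℕ.<⇒≱ (subst (TF.top ℕ.<_) (ℕ.+-identityʳ _) b))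
    h-T* (suc k) d b t = begin
      h d                                            ≡⟨ sym (ℤ.*-identityˡ (h d)) ⟩
      1ℤ ℤ.* h d                                     ≡⟨ cong (λ z → # z ℤ.* h d) (sym (≡-== {x = face d} refl)) ⟩
      # (face d == face d) ℤ.* h d                   ≡⟨ sym (sum-only d other) ⟩
      sum (λ x → # (face x == face d) ℤ.* h x)       ≡⟨ h-circ (face d) ⟩
      0ℤ                                             ∎
      where
      open ≡-Reasoning
      other : ∀ x → x ≢ d → # (face x == face d) ℤ.* h x ≡ 0ℤ
      other x ne with face x F.≟ face d
      ... | no _  = refl
      ... | yes e = trans (ℤ.*-identityˡ (h x)) (zeroes (covered x))
        where
        bound : T* (a x) ≡ true → TF.top ℕ.< TF.rk (face (a x)) ℕ.+ k
        bound u = ℕ.<-≤-trans b (subst (ℕ._≤ TF.rk (face (a x)) ℕ.+ k) (sym (ℕ.+-suc _ k))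
          (ℕ.+-monoˡ-≤ k (subst (λ z → suc (TF.rk z) ℕ.≤ TF.rk (face (a x))) (trans (cong face (aa x)) e) (T*-< u))))
        zeroes : Covered x → h x ≡ 0ℤ
        zeroes (inj₁ t′)               = h-T t′
        zeroes (inj₂ (inj₁ t′))        = h-a (h-T t′)
        zeroes (inj₂ (inj₂ (inj₁ u)))  = contradiction (trans (sym (T*-par u)) (trans (cong TF.par e) (T*-par t))) ne
        zeroes (inj₂ (inj₂ (inj₂ u)))  = h-a (h-T* k (a x) (bound u) u)

    h-0 : ∀ d → h d ≡ 0ℤ
    h-0 d with covered d
    ... | inj₁ t               = h-T t
    ... | inj₂ (inj₁ t)        = h-a (h-T t)
    ... | inj₂ (inj₂ (inj₁ t)) = h-T* (suc TF.top) d (ℕ.m≤n+m _ _) t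
    ... | inj₂ (inj₂ (inj₂ t)) = h-a (h-T* (suc TF.top) (a d) (ℕ.m≤n+m _ _) t)

  -- The sphere has no homology in degree one: after subtraction of the potential built along the
  -- spanning tree the flow is supported on the dual tree, and a flow without divergence on a tree
  -- is zero.
  potential : ∀ g → (∀ d → g (a d) ≡ ℤ.- g d) → (∀ c → sum (λ d → # (face d == c) ℤ.* g d) ≡ 0ℤ) → Potential g
  potential g anti circ = record { w = w ; w-s = w-s ; w-hub = w-hub ; w-d = λ d → trans (alg (g d) (w d ℤ.- w (a d)))
      (trans (cong (λ z → z ℤ.+ (w d ℤ.- w (a d))) (h-0 d)) (ℤ.+-identityˡ (w d ℤ.- w (a d)))) }
    where
    open Build g anti circ
    alg : ∀ x y → x ≡ x ℤ.- y ℤ.+ y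
    alg = solve-∀

-- Combinatorial curvature of the faces that meet a region

#≥0 : ∀ b → 0ℤ ℤ.≤ # b
#≥0 true  = ℤ.+≤+ z≤n
#≥0 false = ℤ.+≤+ z≤n

*≥0 : ∀ {x y} → 0ℤ ℤ.≤ x → 0ℤ ℤ.≤ y → 0ℤ ℤ.≤ x ℤ.* y
*≥0 {+ m} {+ k} _ _ = subst (0ℤ ℤ.≤_) (ℤ.pos-* m k) (ℤ.+≤+ z≤n)

sum-inj : ∀ {m k} (g : Fin m → ℤ) → (∀ i → 0ℤ ℤ.≤ g i) →
          (h : Fin k → Fin m) → (∀ {i j} → h i ≡ h j → i ≡ j) → sum (g ∘ h) ℤ.≤ sum g
sum-inj {m} {k} g g≥0 h inj = subst (ℤ._≤ sum g) (sym step) (sum-mono bound)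
  where
  hits : Fin m → ℤ
  hits d = sum (λ i → # (d == h i))
  step : sum (g ∘ h) ≡ sum (λ d → hits d ℤ.* g d)
  step = begin
    sum (g ∘ h)                                        ≡⟨ sum-cong (λ i → sym (sum-δ (h i) g)) ⟩
    sum (λ i → sum (λ d → # (d == h i) ℤ.* g d))       ≡⟨ sum-comm (λ i d → # (d == h i) ℤ.* g d) ⟩
    sum (λ d → sum (λ i → # (d == h i) ℤ.* g d))       ≡⟨ sum-cong (λ d → sum-cong λ i → ℤ.*-comm (# (d == h i)) (g d)) ⟩
    sum (λ d → sum (λ i → g d ℤ.* # (d == h i)))       ≡⟨ sum-cong (λ d → trans (sum-*ˡ (g d) (λ i → # (d == h i))) (ℤ.*-comm (g d) (hits d))) ⟩
    sum (λ d → hits d ℤ.* g d)                         ∎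
    where open ≡-Reasoning
  bound : ∀ d → hits d ℤ.* g d ℤ.≤ g d
  bound d with F.any? (λ i → d F.≟ h i)
  ... | yes (i , e) = ℤ.≤-reflexive (trans (cong (ℤ._* g d)
          (trans (sum-only i (λ j ne → cong # (≢-== λ e′ → ne (inj (trans (sym e′) e))))) (cong # (≡-== e)))) (ℤ.*-identityˡ (g d)))
  ... | no none     = subst (ℤ._≤ g d) (sym (cong (ℤ._* g d) (sum-0 λ i → cong # (≢-== λ e → none (i , e))))) (g≥0 d)

sum-ones : ∀ m → sum {m} (λ _ → 1ℤ) ≡ + m
sum-ones zero    = sum-zero _
sum-ones (suc m) = trans (sum-suc (λ _ → 1ℤ)) (cong (λ z → 1ℤ ℤ.+ z) (sum-ones m))

module FaceBound {n′ : ℕ} (W : Web (suc n′)) (R : Map.D W → Bool)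
                 (R-s : ∀ d → R (Map.s W d) ≡ R d) (R-hub : ∀ {d} → isHub W d → R d ≡ false)
                 (κ : Bool) (mono : ∀ d → R d ≡ true → R (Map.a W d) ≡ false → Map.col W d ≡ κ) where
  open Map W

  -- For `d` off the hub, `a (s (s d))` precedes `d` in its face, and the successor `f d` lies in
  -- `R` exactly if `a d` does. So this corner is an arc of `R` by itself.
  Lonely : D → Set
  Lonely d = (R d ≡ true) × (R (a d) ≡ false) × (R (a (s (s d))) ≡ false)

  R-¬hub : ∀ {d} → R d ≡ true → ¬ isHub W d
  R-¬hub e h = true≢false e (R-hub h)

  R-f : ∀ d → R (f d) ≡ R (a d)
  R-f d = R-s (a d)

  exits : D → Bool
  exits d = R d ∧ not (R (a d))

  -- The sum over a face is t + 3o, because each arc of corners in `R` has exactly one corner with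
  -- an exit.
  weight : D → ℤ
  weight d = # (R d) ℤ.+ + 3 ℤ.* # (exits d)

  weight≥0 : ∀ d → 0ℤ ℤ.≤ weight d
  weight≥0 d = ℤ.+-mono-≤ (#≥0 (R d)) (*≥0 {+ 3} (ℤ.+≤+ z≤n) (#≥0 (exits d)))

  weight≥1 : ∀ d → R d ≡ true → 1ℤ ℤ.≤ weight d
  weight≥1 d e = ℤ.+-mono-≤ (ℤ.≤-reflexive (cong # (sym e))) (*≥0 {+ 3} (ℤ.+≤+ z≤n) (#≥0 (exits d)))

  weight-exit : ∀ d → R d ≡ true → R (a d) ≡ false → weight d ≡ + 4
  weight-exit d e e′ = cong₂ (λ x y → # x ℤ.+ + 3 ℤ.* # (x ∧ not y)) e e′

  fibre : D → D → ℤ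
  fibre c d = # (face d == c) ℤ.* weight d

  fibre≥0 : ∀ c d → 0ℤ ℤ.≤ fibre c d
  fibre≥0 c d = *≥0 (#≥0 (face d == c)) (weight≥0 d)

  fibre-in : ∀ {c d} → face d ≡ c → fibre c d ≡ weight d
  fibre-in e = trans (cong (λ b → # b ℤ.* weight _) (≡-== e)) (ℤ.*-identityˡ _)

  -- Without an exit the whole orbit of `f` stays in `R`; it avoids the hub, so the face is internal
  -- and has at least six corners.
  full-face : ∀ {d} → (∀ e → face e ≡ face d → R e ≡ true → R (a e) ≡ true) → R d ≡ true → + 6 ℤ.≤ sum (fibre (face d))
  full-face {d} keep Rd = ℤ.≤-trans (subst (ℤ._≤ sum (fibre (face d) ∘ h)) six (sum-mono low)) (sum-inj (fibre (face d)) (fibre≥0 (face d)) h h-inj)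
    where
    R-iter : ∀ i → (R (iter f i d) ≡ true) × (face (iter f i d) ≡ face d)
    R-iter zero    = Rd , refl
    R-iter (suc i) with e , e′ ← R-iter i = trans (R-f _) (keep _ e′ e) , trans (face-f _) e′
    h : Fin 6 → D
    h i = iter f (toℕ i) d
    apart : ∀ i j → i ℕ.< j → j ℕ.< 6 → iter f i d ≢ iter f j d
    apart i j i<j j<6 e = internal-face-≥6 W d (λ k → R-¬hub (proj₁ (R-iter k))) (j ℕ.∸ i) (ℕ.m<n⇒0<n∸m i<j)
      (ℕ.≤-<-trans (ℕ.m∸n≤m j i) j<6)
      (Fc.iter-inj i (trans (sym (iter-+ f i (j ℕ.∸ i) d))
        (trans (cong (λ z → iter f z d) (ℕ.m+[n∸m]≡n (ℕ.<⇒≤ i<j))) (sym e))))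
    h-inj : ∀ {i j} → h i ≡ h j → i ≡ j
    h-inj {i} {j} e with ℕ.<-cmp (toℕ i) (toℕ j)
    ... | tri< lt _ _ = contradiction e (apart _ _ lt (F.toℕ<n j))
    ... | tri≈ _ eq _ = F.toℕ-injective eq
    ... | tri> _ _ gt = contradiction (sym e) (apart _ _ gt (F.toℕ<n i))
    low : ∀ i → 1ℤ ℤ.≤ fibre (face d) (h i)
    low i with e , e′ ← R-iter (toℕ i) = subst (1ℤ ℤ.≤_) (sym (fibre-in e′)) (weight≥1 _ e)
    six : sum {6} (λ _ → 1ℤ) ≡ + 6
    six = sum-ones 6

  -- Colours alternate along a face, and exits have colour `κ`. An arc ends at colour `κ`; it cannot
  -- begin one corner earlier, since the edge before that corner would then be an exit of the other
  -- colour. So an arc of more than one corner has at least three, and 3 + 3 = 6.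
  exit-face : ∀ {d} → R d ≡ true → R (a d) ≡ false → Lonely d ⊎ (+ 6 ℤ.≤ sum (fibre (face d)))
  exit-face {d} Rd Rad = go _ refl
    where
    d₁ d₂ : D
    d₁ = a (s (s d))
    d₂ = a (s (s d₁))
    go : ∀ b → R d₁ ≡ b → Lonely d ⊎ (+ 6 ℤ.≤ sum (fibre (face d)))
    go false e = inj₁ (Rd , Rad , e)
    go true  e = inj₂ (ℤ.≤-trans low (sum-inj (fibre (face d)) (fibre≥0 (face d)) h h-inj))
      where
      col₁ : col d₁ ≡ not κ
      col₁ = trans (col-a _) (cong not (trans (col-s _) (trans (col-s d) (mono d Rd Rad))))
      col₂ : col d₂ ≡ κ
      col₂ = trans (col-a _) (trans (cong not (trans (col-s _) (trans (col-s d₁) col₁))) (Bool.not-involutive κ))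
      R₂ : R d₂ ≡ true
      R₂ = case _ refl
        where
        case : ∀ b → R d₂ ≡ b → R d₂ ≡ true
        case true  e′ = e′
        case false e′ = contradiction (trans (sym (trans (col-s _) (trans (col-s d₁) col₁)))
          (mono (s (s d₁)) (trans (R-s _) (trans (R-s d₁) e)) e′)) (λ p → Bool.not-¬ {κ} refl (sym p))
      face₁ : face d₁ ≡ face d
      face₁ = face-as² (R-¬hub Rd)
      face₂ : face d₂ ≡ face d
      face₂ = trans (face-as² (R-¬hub e)) face₁
      differ : ∀ {x y} → col x ≡ κ → col y ≡ not κ → x ≢ y
      differ p q refl = Bool.not-¬ p q
      col₀ : col d ≡ κ
      col₀ = mono d Rd Rad
      d≢d₂ : d ≢ d₂
      d≢d₂ p = true≢false e (trans (cong R (sym (trans (cong f p) (trans (f-a _) (s³ (R-¬hub e)))))) (trans (R-f d) Rad))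
      h : Fin 3 → D
      h 0F = d
      h 1F = d₁
      h 2F = d₂
      h-inj : ∀ {i j} → h i ≡ h j → i ≡ j
      h-inj {0F} {0F} _ = refl
      h-inj {0F} {1F} p = contradiction p (differ col₀ col₁)
      h-inj {0F} {2F} p = contradiction p d≢d₂
      h-inj {1F} {0F} p = contradiction (sym p) (differ col₀ col₁)
      h-inj {1F} {1F} _ = refl
      h-inj {1F} {2F} p = contradiction (sym p) (differ col₂ col₁)
      h-inj {2F} {0F} p = contradiction (sym p) d≢d₂
      h-inj {2F} {1F} p = contradiction p (differ col₂ col₁)
      h-inj {2F} {2F} _ = refl
      expand : sum (fibre (face d) ∘ h) ≡ fibre (face d) d ℤ.+ (fibre (face d) d₁ ℤ.+ (fibre (face d) d₂ ℤ.+ 0ℤ))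
      expand = trans (sum-suc _) (cong (λ z → fibre (face d) d ℤ.+ z)
        (trans (sum-suc {1} _) (cong (λ z → fibre (face d) d₁ ℤ.+ z)
          (trans (sum-suc {0} _) (cong (λ z → fibre (face d) d₂ ℤ.+ z) (sum-zero _))))))
      low : + 6 ℤ.≤ sum (fibre (face d) ∘ h)
      low = subst (+ 6 ℤ.≤_) (sym expand) (ℤ.+-mono-≤
        (ℤ.≤-reflexive (sym (trans (fibre-in refl) (weight-exit d Rd Rad))))
        (ℤ.+-mono-≤ (subst (1ℤ ℤ.≤_) (sym (fibre-in face₁)) (weight≥1 d₁ e))
          (ℤ.+-mono-≤ {1ℤ} (subst (1ℤ ℤ.≤_) (sym (fibre-in face₂)) (weight≥1 d₂ R₂)) (ℤ.≤-refl {0ℤ}))))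

  Touched : D → Set
  Touched c = ∃ λ d → (face d ≡ c) × (R d ≡ true)

  abstract
    touched? : ∀ c → Dec (Touched c)
    touched? c = F.any? (λ d → (face d F.≟ c) ×-dec (R d Bool.≟ true))

  private
    exit? : ∀ c → Dec (∃ λ d → (face d ≡ c) × (R d ≡ true) × (R (a d) ≡ false))
    exit? c = F.any? (λ d → (face d F.≟ c) ×-dec ((R d Bool.≟ true) ×-dec (R (a d) Bool.≟ false)))

  -- A face that meets R contributes 6 − t − 3o, where t counts its corners in R and o the arcs they form;
  -- as R is bounded by edges of one kind only, this is positive only if a single corner lies in R.
  face-bound : (X Y : D) → (∀ d → Lonely d → (face d ≡ X) ⊎ (face d ≡ Y)) → ∀ c →
    + 6 ℤ.* # (does (touched? c)) ℤ.≤ sum (fibre c) ℤ.+ (+ 2 ℤ.* # (c == X) ℤ.+ + 2 ℤ.* # (c == Y))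
  face-bound X Y lonely c = go (touched? c)
    where
    extra≥0 : 0ℤ ℤ.≤ + 2 ℤ.* # (c == X) ℤ.+ + 2 ℤ.* # (c == Y)
    extra≥0 = ℤ.+-mono-≤ (*≥0 {+ 2} (ℤ.+≤+ z≤n) (#≥0 (c == X))) (*≥0 {+ 2} (ℤ.+≤+ z≤n) (#≥0 (c == Y)))
    fibres≥0 : 0ℤ ℤ.≤ sum (fibre c)
    fibres≥0 = subst (ℤ._≤ sum (fibre c)) (sum-0 {f = λ _ → 0ℤ} λ _ → refl) (sum-mono (fibre≥0 c))
    Goal : Bool → Set
    Goal b = + 6 ℤ.* # b ℤ.≤ sum (fibre c) ℤ.+ (+ 2 ℤ.* # (c == X) ℤ.+ + 2 ℤ.* # (c == Y))
    enough : + 6 ℤ.≤ sum (fibre c) → Goal true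
    enough h = ℤ.+-mono-≤ h extra≥0
    at-end : + 2 ℤ.≤ + 2 ℤ.* # (c == X) ℤ.+ + 2 ℤ.* # (c == Y) → + 4 ℤ.≤ sum (fibre c) → Goal true
    at-end h h′ = ℤ.+-mono-≤ h′ h
    go : (t : Dec (Touched c)) → Goal (does t)
    go (no  _) = ℤ.+-mono-≤ fibres≥0 extra≥0
    go (yes (d , refl , Rd)) with exit? c
    ... | no none = enough (full-face (λ e p q → case (R (a e)) refl (λ q′ → none (e , p , q , q′))) Rd)
      where
      case : ∀ {x} b → x ≡ b → (x ≢ false) → x ≡ true
      case true  e n = e
      case false e n = contradiction e n
    ... | yes (e , p , Re , Rae) with exit-face Re Rae
    ...   | inj₂ h = enough (subst (λ z → + 6 ℤ.≤ sum (fibre z)) p h)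
    ...   | inj₁ l = at-end (two (lonely e l)) (ℤ.≤-trans (subst (+ 4 ℤ.≤_) (sym one) ℤ.≤-refl)
                       (sum-inj {k = 1} (fibre c) (fibre≥0 c) (λ _ → e) λ { {0F} {0F} _ → refl }))
      where
      one : sum {1} (λ _ → fibre c e) ≡ + 4
      one = trans (sum-suc {0} _) (trans (cong (λ z → fibre c e ℤ.+ z) (sum-zero _)) (trans (ℤ.+-identityʳ _)
              (trans (fibre-in p) (weight-exit e Re Rae))))
      two : (face e ≡ X) ⊎ (face e ≡ Y) → + 2 ℤ.≤ + 2 ℤ.* # (c == X) ℤ.+ + 2 ℤ.* # (c == Y)
      two (inj₁ q) = ℤ.+-mono-≤ (ℤ.≤-reflexive (sym (cong (λ b → + 2 ℤ.* # b) (≡-== (trans (sym p) q))))) (*≥0 {+ 2} (ℤ.+≤+ z≤n) (#≥0 (c == Y)))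
      two (inj₂ q) = ℤ.+-mono-≤ (*≥0 {+ 2} (ℤ.+≤+ z≤n) (#≥0 (c == X))) (ℤ.≤-reflexive (sym (cong (λ b → + 2 ℤ.* # b) (≡-== (trans (sym p) q)))))

-- Gauss-Bonnet for a region with connected complement

counting : ∀ VT VR UT Ft EC nE b →
  (VT ℤ.+ VR) ℤ.+ (UT ℤ.+ Ft) ≡ 1ℤ ℤ.+ nE → + 2 ℤ.* nE ≡ + 2 ℤ.* EC ℤ.+ (+ 3 ℤ.* VR ℤ.+ b) →
  VT ℤ.+ UT ℤ.≤ EC → + 6 ℤ.* Ft ℤ.≤ + 3 ℤ.* VR ℤ.+ + 3 ℤ.* b ℤ.+ + 4 → ⊥
counting VT VR UT Ft EC nE b e₁ e₂ h₁ h₂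
  = absurd (subst (0ℤ ℤ.≤_) deficit (ℤ.i≤j⇒0≤j-i (ℤ.+-mono-≤ (ℤ.*-monoˡ-≤-nonNeg (+ 6) h₁) h₂)))
  where
  absurd : 0ℤ ℤ.≤ ℤ.-[1+ 1 ] → ⊥
  absurd ()
  alg : ∀ VT VR UT Ft EC nE b →
    (+ 6 ℤ.* EC ℤ.+ (+ 3 ℤ.* VR ℤ.+ + 3 ℤ.* b ℤ.+ + 4)) ℤ.- (+ 6 ℤ.* (VT ℤ.+ UT) ℤ.+ + 6 ℤ.* Ft) ≡
    ℤ.-[1+ 1 ] ℤ.+ (+ 3 ℤ.* ((+ 2 ℤ.* EC ℤ.+ (+ 3 ℤ.* VR ℤ.+ b)) ℤ.- + 2 ℤ.* nE) ℤ.+ + 6 ℤ.* ((1ℤ ℤ.+ nE) ℤ.- ((VT ℤ.+ VR) ℤ.+ (UT ℤ.+ Ft))))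
  alg = solve-∀
  -- The constant -2 is 4 - 6: the 6 comes from the 1 in Euler's formula, the 4 from two faces with
  -- an excess of 2 each.
  deficit : _ ≡ ℤ.-[1+ 1 ]
  deficit = trans (alg VT VR UT Ft EC nE b)
    (cong (λ z → ℤ.-[1+ 1 ] ℤ.+ z) (cong₂ (λ x y → + 3 ℤ.* x ℤ.+ + 6 ℤ.* y) (ℤ.i≡j⇒i-j≡0 (sym e₂)) (ℤ.i≡j⇒i-j≡0 (sym e₁))))

module GaussBonnet {n′ : ℕ} (W : Web (suc n′)) (A : Map.D W → Bool)
                   (A-s : ∀ d → A (Map.s W d) ≡ A d) (A-hub : ∀ {d} → isHub W d → A d ≡ true)
                   (κ : Bool) (mono : ∀ d → A d ≡ false → A (Map.a W d) ≡ true → Map.col W d ≡ κ)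
                   (d₀ : Map.D W) (A-d₀ : A d₀ ≡ false) where
  open Map W
  open Count W
  -- Since the root of the dual tree is a face that meets `R`, every face that does not meet `R` is
  -- the child of a dual tree edge.
  open TreeCotree W A d₀ hiding (hubv)
  open ≡-Reasoning

  vert-A : ∀ {x y} → vert x ≡ vert y → A x ≡ A y
  vert-A {x} e with i , refl ← V.rep⇒orb e = go i
    where
    go : ∀ i → A x ≡ A (iter s i x)
    go zero    = refl
    go (suc i) = trans (go i) (sym (A-s _))

  abstract
    -- The component of the hub in `A` is taken instead of `A` itself: its complement `R` has its
    -- holes filled, so that the vertices outside `R` are spanned by a single tree.
    In : D → Bool
    In d = TV.C (vert d)

    In-s : ∀ d → In (s d) ≡ In d
    In-s d = cong TV.C (vert-s d)

    In-hub : ∀ {d} → isHub W d → In d ≡ true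
    In-hub h = trans (cong TV.C (hub-vert h)) TV.root

    In-A : ∀ {d} → In d ≡ true → A d ≡ true
    In-A {d} e with vert d F.≟ hubv
    ... | yes p = A-hub (vert-isHub (sym p) (hb-isHub 0))
    ... | no ne = trans (vert-A (sym (TV.par-q _ e ne))) (TV.par-A _ e ne)

    In-grow : ∀ {d} → In (a d) ≡ true → A d ≡ true → In d ≡ true
    In-grow {d} = TV.closed d

    In-C : ∀ {c} → vert c ≡ c → TV.C c ≡ In c
    In-C e = cong TV.C (sym e)

    T-In : ∀ {d} → T d ≡ true → In d ≡ true
    T-In = T-C

    T-In′ : ∀ {d} → T d ≡ true → In (a d) ≡ true
    T-In′ = T-C′

  R : D → Bool
  R d = not (In d)

  R-out : ∀ {d} → R d ≡ false → In d ≡ true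
  R-out {d} e = trans (sym (Bool.not-involutive (In d))) (cong not e)

  R-A : ∀ {d} → R d ≡ true → R (a d) ≡ false → (A d ≡ false) × (A (a d) ≡ true)
  R-A {d} e e′ = ¬true (λ Ad → true≢false (In-grow (R-out e′) Ad) (not-true e)) , In-A (R-out e′)

  R-d₀ : R d₀ ≡ true
  R-d₀ = cong not (¬true λ e → true≢false (In-A e) A-d₀)

  open FaceBound W R (λ d → cong not (In-s d)) (λ h → cong not (In-hub h)) κ
    (λ d e e′ → mono d (proj₁ (R-A e e′)) (proj₂ (R-A e e′)))

  rR bR : D → ℤ
  rR d = # (R d)
  bR d = # (exits d)

  VT VR UT Ft EC : ℤ
  VT = sum (λ d → # (T d))
  VR = sum (λ c → # (minV c) ℤ.* # (R c))
  UT = sum (λ c → # (minF c) ℤ.* # (not (does (touched? c))))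
  Ft = sum (λ c → # (minF c) ℤ.* # (does (touched? c)))
  EC = sum (λ d → # (col d) ℤ.* # (In d ∧ In (a d)))

  vertices : VT ℤ.+ VR ≡ nV
  vertices = begin
    VT ℤ.+ VR
      ≡⟨ cong (ℤ._+ VR) (trans (sum-cong (λ d → sym (ℤ.*-identityʳ (# (T d))))) (TV.sum-T V.rep-rep (λ _ → 1ℤ))) ⟩
    sum (λ c → # (minV c) ℤ.* (# (TV.C c ∧ inner c) ℤ.* 1ℤ)) ℤ.+ VR
      ≡⟨ sym (sum-+ (λ c → # (minV c) ℤ.* (# (TV.C c ∧ inner c) ℤ.* 1ℤ)) (λ c → # (minV c) ℤ.* # (R c))) ⟩
    sum (λ c → # (minV c) ℤ.* (# (TV.C c ∧ inner c) ℤ.* 1ℤ) ℤ.+ # (minV c) ℤ.* # (R c))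
      ≡⟨ sum-cong pw ⟩
    nV ∎
    where
    table : ∀ x y → (y ≡ false → x ≡ true) → 1ℤ ℤ.* (# (x ∧ y) ℤ.* 1ℤ) ℤ.+ 1ℤ ℤ.* # (not x) ≡ 1ℤ ℤ.* # y
    table true  true  _ = refl
    table true  false _ = refl
    table false true  _ = refl
    table false false h with () ← h refl
    pw : ∀ c → # (minV c) ℤ.* (# (TV.C c ∧ inner c) ℤ.* 1ℤ) ℤ.+ # (minV c) ℤ.* # (R c) ≡ # (minV c) ℤ.* # (inner c)
    pw c with vert c F.≟ c
    ... | no _  = refl
    ... | yes e = trans (cong (λ b → 1ℤ ℤ.* (# (TV.C c ∧ inner c) ℤ.* 1ℤ) ℤ.+ 1ℤ ℤ.* # (not b)) (sym (In-C e)))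
                    (table (TV.C c) (inner c) (λ h → trans (cong TV.C (==-≡ (root-of h))) TV.root))
      where
      root-of : inner c ≡ false → (c == hubv) ≡ true
      root-of h = trans (sym (Bool.not-involutive (c == hubv))) (cong not h)

  three-VR : sum rR ≡ + 3 ℤ.* VR
  three-VR = sum-vertices rR (λ d → cong (# ∘ not) (In-s d)) (λ d h → cong (# ∘ not) (In-hub h))

  untouched : sum (λ d → # (T* d) ℤ.* # (not (does (touched? (face d))))) ≡ UT
  untouched = trans (TF.sum-T Fc.rep-rep (λ c → # (not (does (touched? c))))) (sum-cong pw)
    where
    u : D → Bool
    u c = not (does (touched? c))
    root-touched : u (face d₀) ≡ false
    root-touched with touched? (face d₀)
    ... | yes _ = refl
    ... | no nt = contradiction (d₀ , refl , R-d₀) nt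
    table : ∀ x y z → x ≡ true → (y ≡ true → z ≡ false) → # (x ∧ not y) ℤ.* # z ≡ # z
    table true true  z    _ h = trans (cong (λ b → 0ℤ ℤ.* # b) (h refl)) (cong # (sym (h refl)))
    table true false true  _ h = refl
    table true false false _ h = refl
    pw : ∀ c → # (minF c) ℤ.* (# (TF.C c ∧ not (c == face d₀)) ℤ.* # (u c)) ≡ # (minF c) ℤ.* # (u c)
    pw c with face c F.≟ c
    ... | no _  = refl
    ... | yes e = cong (λ z → 1ℤ ℤ.* z) (table (TF.C c) (c == face d₀) (u c)
                    (trans (cong TF.C (sym e)) (faces-reached c)) (λ h → trans (cong u (==-≡ h)) root-touched))

  faces : UT ℤ.+ Ft ≡ nF
  faces = trans (sym (sum-+ (λ c → # (minF c) ℤ.* # (not (does (touched? c)))) (λ c → # (minF c) ℤ.* # (does (touched? c)))))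
                (sum-cong λ c → alg (# (minF c)) (does (touched? c)))
    where
    alg : ∀ x b → x ℤ.* # (not b) ℤ.+ x ℤ.* # b ≡ x
    alg x true  = trans (cong₂ ℤ._+_ (ℤ.*-zeroʳ x) (ℤ.*-identityʳ x)) (ℤ.+-identityˡ x)
    alg x false = trans (cong₂ ℤ._+_ (ℤ.*-identityʳ x) (ℤ.*-zeroʳ x)) (ℤ.+-identityʳ x)

  edges : + 2 ℤ.* nE ≡ + 2 ℤ.* EC ℤ.+ (+ 3 ℤ.* VR ℤ.+ sum bR)
  edges = sym (begin
    + 2 ℤ.* EC ℤ.+ (+ 3 ℤ.* VR ℤ.+ sum bR)
      ≡⟨ cong₂ ℤ._+_ (sym (sum-*ˡ (+ 2) (λ d → # (col d) ℤ.* # (In d ∧ In (a d)))))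
           (trans (cong (ℤ._+ sum bR) (sym three-VR)) (trans (sym (sum-+ rR bR)) (sum-edges (λ d → rR d ℤ.+ bR d)))) ⟩
    sum (λ d → + 2 ℤ.* (# (col d) ℤ.* # (In d ∧ In (a d)))) ℤ.+ sum (λ d → # (col d) ℤ.* (rR d ℤ.+ bR d ℤ.+ (rR (a d) ℤ.+ bR (a d))))
      ≡⟨ sym (sum-+ (λ d → + 2 ℤ.* (# (col d) ℤ.* # (In d ∧ In (a d)))) _) ⟩
    sum (λ d → + 2 ℤ.* (# (col d) ℤ.* # (In d ∧ In (a d))) ℤ.+ # (col d) ℤ.* (rR d ℤ.+ bR d ℤ.+ (rR (a d) ℤ.+ bR (a d))))
      ≡⟨ sum-cong (λ d → trans (cong (λ b → + 2 ℤ.* (# (col d) ℤ.* # (In d ∧ In (a d))) ℤ.+ # (col d) ℤ.* (rR d ℤ.+ bR d ℤ.+ (rR (a d) ℤ.+ # (R (a d) ∧ not (not (In b)))))) (aa d))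
                                (table (col d) (In d) (In (a d)))) ⟩
    sum (λ d → + 2 ℤ.* # (col d))
      ≡⟨ sum-*ˡ (+ 2) (λ d → # (col d)) ⟩
    + 2 ℤ.* nE ∎)
    where
    table : ∀ k x y → + 2 ℤ.* (# k ℤ.* # (x ∧ y)) ℤ.+
      # k ℤ.* (# (not x) ℤ.+ # (not x ∧ not (not y)) ℤ.+ (# (not y) ℤ.+ # (not y ∧ not (not x)))) ≡ + 2 ℤ.* # k
    table true  true  true  = refl
    table true  true  false = refl
    table true  false true  = refl
    table true  false false = refl
    table false x     y     = refl

  untouched-In : ∀ d → not (does (touched? (face d))) ≡ true → (In d ≡ true) × (In (a d) ≡ true)
  untouched-In d h = R-out (¬true λ e → no-touch (d , refl , e)) ,
                     R-out (¬true λ e → no-touch (f d , face-f d , trans (cong not (In-s (a d))) e))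
    where
    no-touch : ¬ Touched (face d)
    no-touch t = true≢false (dec-true (touched? (face d)) t) (not-true h)

  -- By `exclusive` no edge is counted twice, and each counted edge has both ends in `In`: a dual
  -- tree edge whose child face does not meet `R` cannot have an end in `R`. This replaces the
  -- computation of the Euler characteristic of the complement.
  tree-edges : VT ℤ.+ UT ℤ.≤ EC
  tree-edges = subst (ℤ._≤ EC) (sym total) (sum-mono pw)
    where
    k : D → ℤ
    k d = # (T d) ℤ.+ # (T* d) ℤ.* # (not (does (touched? (face d))))
    total : VT ℤ.+ UT ≡ sum (λ d → # (col d) ℤ.* (k d ℤ.+ k (a d)))
    total = trans (trans (cong (λ z → VT ℤ.+ z) (sym untouched))
      (sym (sum-+ (λ d → # (T d)) (λ d → # (T* d) ℤ.* # (not (does (touched? (face d)))))))) (sum-edges k)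
    scale : ∀ b {x y} → x ℤ.≤ y → # b ℤ.* x ℤ.≤ # b ℤ.* y
    scale true  h = subst₂ ℤ._≤_ (sym (ℤ.*-identityˡ _)) (sym (ℤ.*-identityˡ _)) h
    scale false h = ℤ.≤-refl
    Both : Bool → Bool → Set
    Both i i′ = (i ≡ true) × (i′ ≡ true)
    bound : ∀ c t t′ x x′ u u′ → # t ℤ.+ # t′ ℤ.+ (# x ℤ.+ # x′) ℤ.≤ 1ℤ →
      (t ≡ true → c ≡ true) → (t′ ≡ true → c ≡ true) → (u ≡ true → c ≡ true) → (u′ ≡ true → c ≡ true) →
      # t ℤ.+ # x ℤ.* # u ℤ.+ (# t′ ℤ.+ # x′ ℤ.* # u′) ℤ.≤ # c
    bound true t t′ x x′ u u′ h _ _ _ _ = ℤ.≤-trans (subst₂ ℤ._≤_ refl (swap (# t) (# t′) (# x) (# x′))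
        (ℤ.+-mono-≤ (ℤ.+-monoʳ-≤ (# t) (cut x u)) (ℤ.+-monoʳ-≤ (# t′) (cut x′ u′)))) h
      where
      swap : ∀ p q r v → p ℤ.+ r ℤ.+ (q ℤ.+ v) ≡ p ℤ.+ q ℤ.+ (r ℤ.+ v)
      swap = solve-∀
      cut : ∀ x u → # x ℤ.* # u ℤ.≤ # x
      cut x true  = ℤ.≤-reflexive (ℤ.*-identityʳ (# x))
      cut x false = subst (ℤ._≤ # x) (sym (ℤ.*-zeroʳ (# x))) (#≥0 x)
    bound false t t′ x x′ u u′ h p p′ q q′
      rewrite ¬true {t} (λ e → true≢false (p e) refl) | ¬true {t′} (λ e → true≢false (p′ e) refl)
            | ¬true {u} (λ e → true≢false (q e) refl) | ¬true {u′} (λ e → true≢false (q′ e) refl)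
            | ℤ.*-zeroʳ (# x) | ℤ.*-zeroʳ (# x′) = ℤ.≤-refl
    both : ∀ {i i′} → Both i i′ → i ∧ i′ ≡ true
    both (refl , refl) = refl
    pw : ∀ d → # (col d) ℤ.* (k d ℤ.+ k (a d)) ℤ.≤ # (col d) ℤ.* # (In d ∧ In (a d))
    pw d = scale (col d) (bound (In d ∧ In (a d)) (T d) (T (a d)) (T* d) (T* (a d)) _ _ (exclusive d)
      (λ t → both (T-In t , T-In′ t)) (λ t → both (flip d (T-In t , T-In′ t)))
      (λ u → both (untouched-In d u)) (λ u → both (flip d (untouched-In (a d) u))))
      where
      flip : ∀ d → (In (a d) ≡ true) × (In (a (a d)) ≡ true) → (In d ≡ true) × (In (a d) ≡ true)
      flip d (p , q) = trans (cong In (sym (aa d))) q , p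

  -- A face with a lonely corner gains at most 2, so two such faces cannot account for the 6 that
  -- Euler's formula demands. `X` and `Y` will be the ends of a digon, where a turn is of no use.
  lonely-exists : ∀ X Y → ∃ λ d → (A d ≡ false) × (A (a d) ≡ true) × (A (a (s (s d))) ≡ true) × (face d ≢ X) × (face d ≢ Y)
  lonely-exists X Y with F.any? (λ d → ((R d Bool.≟ true) ×-dec ((R (a d) Bool.≟ false) ×-dec (R (a (s (s d))) Bool.≟ false)))
                                   ×-dec (¬? (face d F.≟ X) ×-dec ¬? (face d F.≟ Y)))
  ... | yes (d , (p , q , r) , x , y) = d , proj₁ (R-A p q) , proj₂ (R-A p q) , In-A (R-out r) , x , y
  ... | no none = contradiction face-total (counting VT VR UT Ft EC nE (sum bR)
                    (trans (cong₂ ℤ._+_ vertices faces) euler) edges tree-edges)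
    where
    ends : ∀ d → Lonely d → (face d ≡ X) ⊎ (face d ≡ Y)
    ends d l with face d F.≟ X | face d F.≟ Y
    ... | yes p | _     = inj₁ p
    ... | no _  | yes p = inj₂ p
    ... | no p  | no q  = contradiction (d , l , p , q) none
    marks : D → ℤ
    marks c = + 2 ℤ.* # (c == X) ℤ.+ + 2 ℤ.* # (c == Y)
    marks≥0 : ∀ c → 0ℤ ℤ.≤ marks c
    marks≥0 c = ℤ.+-mono-≤ (*≥0 {+ 2} (ℤ.+≤+ z≤n) (#≥0 (c == X))) (*≥0 {+ 2} (ℤ.+≤+ z≤n) (#≥0 (c == Y)))
    one-mark : ∀ Z → sum (λ c → + 2 ℤ.* # (c == Z)) ≡ + 2
    one-mark Z = trans (sum-*ˡ (+ 2) (λ c → # (c == Z)))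
      (cong (λ z → + 2 ℤ.* z) (trans (sum-cong λ c → sym (ℤ.*-identityʳ (# (c == Z)))) (sum-δ Z (λ _ → 1ℤ))))
    total : sum (λ c → # (minF c) ℤ.* sum (fibre c) ℤ.+ marks c) ≡ + 3 ℤ.* VR ℤ.+ + 3 ℤ.* sum bR ℤ.+ + 4
    total = begin
      sum (λ c → # (minF c) ℤ.* sum (fibre c) ℤ.+ marks c)
        ≡⟨ sum-+ (λ c → # (minF c) ℤ.* sum (fibre c)) marks ⟩
      sum (λ c → # (minF c) ℤ.* sum (fibre c)) ℤ.+ sum marks
        ≡⟨ cong₂ ℤ._+_ (trans (sym (sum-fibres face Fc.rep-rep weight)) (trans (sum-+ rR (λ d → + 3 ℤ.* bR d))
             (cong₂ ℤ._+_ three-VR (sum-*ˡ (+ 3) bR))))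
             (trans (sum-+ (λ c → + 2 ℤ.* # (c == X)) (λ c → + 2 ℤ.* # (c == Y))) (cong₂ ℤ._+_ (one-mark X) (one-mark Y))) ⟩
      + 3 ℤ.* VR ℤ.+ + 3 ℤ.* sum bR ℤ.+ + 4 ∎
    pw : ∀ c → + 6 ℤ.* (# (minF c) ℤ.* # (does (touched? c))) ℤ.≤ # (minF c) ℤ.* sum (fibre c) ℤ.+ marks c
    pw c = go (minF c)
      where
      go : ∀ b → + 6 ℤ.* (# b ℤ.* # (does (touched? c))) ℤ.≤ # b ℤ.* sum (fibre c) ℤ.+ marks c
      go true  = subst₂ ℤ._≤_ (cong (λ z → + 6 ℤ.* z) (sym (ℤ.*-identityˡ (# (does (touched? c))))))
                   (cong (ℤ._+ marks c) (sym (ℤ.*-identityˡ (sum (fibre c))))) (face-bound X Y ends c)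
      go false = subst (0ℤ ℤ.≤_) (sym (ℤ.+-identityˡ (marks c))) (marks≥0 c)
    face-total : + 6 ℤ.* Ft ℤ.≤ + 3 ℤ.* VR ℤ.+ + 3 ℤ.* sum bR ℤ.+ + 4
    face-total = subst₂ ℤ._≤_ (sum-*ˡ (+ 6) (λ c → # (minF c) ℤ.* # (does (touched? c)))) total (sum-mono pw)

-- Sharp turns of a flow, and pushing them over a triangle

gap-1 : ∀ {x y : ℤ} → x ℤ.< y → 1ℤ ℤ.≤ y ℤ.- x
gap-1 {x} {y} h = lin (ℤ.i<j⇒suc[i]≤j h) (alg x y)
  where
  alg : ∀ x y → y ℤ.- x ℤ.- 1ℤ ≡ y ℤ.- (1ℤ ℤ.+ x)
  alg = solve-∀

abs-up : ∀ {z} → z ℤ.< 0ℤ → + ℤ.∣ z ℤ.+ 1ℤ ∣ ℤ.< + ℤ.∣ z ∣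
abs-up {ℤ.-[1+ zero ]}  _ = ℤ.+<+ (s≤s z≤n)
abs-up {ℤ.-[1+ suc k ]} _ = ℤ.+<+ ℕ.≤-refl
abs-up {+ k} (ℤ.+<+ ())

abs-down : ∀ {z} → 0ℤ ℤ.< z → + ℤ.∣ z ℤ.- 1ℤ ∣ ℤ.< + ℤ.∣ z ∣
abs-down {+ suc k} _ = ℤ.+<+ ℕ.≤-refl
abs-down {+ zero} (ℤ.+<+ ())

module Corners {n′ : ℕ} (W : Web (suc n′)) where
  open Map W
  open Homology W

  -- The unit flow across the edge with source dart e, as an antisymmetric function on darts.
  δ : D → D → ℤ
  δ e d = # (d == e) ℤ.- # (d == a e)

  a-== : ∀ x y → (a x == y) ≡ (x == a y)
  a-== x y with x F.≟ a y
  ... | yes p = ≡-== (trans (cong a p) (aa y))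
  ... | no  p = ≢-== λ q → p (trans (sym (aa x)) (cong a q))

  δ-anti : ∀ e d → δ e (a d) ≡ ℤ.- δ e d
  δ-anti e d = trans (cong₂ (λ x y → # x ℤ.- # y) (a-== d e) (trans (a-== d (a e)) (cong (λ z → d == z) (aa e))))
                 (alg (# (d == e)) (# (d == a e)))
    where
    alg : ∀ x y → y ℤ.- x ≡ ℤ.- (x ℤ.- y)
    alg = solve-∀

  δ-a : ∀ e d → δ (a e) d ≡ ℤ.- δ e d
  δ-a e d = trans (cong (λ z → # (d == a e) ℤ.- # (d == z)) (aa e)) (alg (# (d == e)) (# (d == a e)))
    where
    alg : ∀ x y → y ℤ.- x ≡ ℤ.- (x ℤ.- y)
    alg = solve-∀

  at : D → D → ℤ
  at v d = # (vert d == vert v)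

  at-three : ∀ {v} → ¬ isHub W v → ∀ d → at v d ≡ # (d == v) ℤ.+ # (d == s v) ℤ.+ # (d == s (s v))
  at-three {v} h d with vert d F.≟ vert v
  ... | no ne = sym (cong₂ ℤ._+_ (cong₂ ℤ._+_
          (cong # (≢-== λ p → ne (cong vert p)))
          (cong # (≢-== λ p → ne (trans (cong vert p) (vert-s v)))))
          (cong # (≢-== λ p → ne (trans (cong vert p) (trans (vert-s _) (vert-s v))))))
  ... | yes e with vert-three h e
  ...   | inj₁ refl = sym (cong₂ ℤ._+_ (cong₂ ℤ._+_
          (cong # (≡-== {x = d} refl)) (cong # (≢-== λ p → s≢ h (sym p)))) (cong # (≢-== λ p → s²≢ h (sym p))))
  ...   | inj₂ (inj₁ refl) = sym (cong₂ ℤ._+_ (cong₂ ℤ._+_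
          (cong # (≢-== (s≢ h))) (cong # (≡-== {x = d} refl))) (cong # (≢-== λ p → s≢ (s-¬hub h) (sym p))))
  ...   | inj₂ (inj₂ refl) = sym (cong₂ ℤ._+_ (cong₂ ℤ._+_
          (cong # (≢-== (s²≢ h))) (cong # (≢-== (s≢ (s-¬hub h))))) (cong # (≡-== {x = d} refl)))

  -- As a flow, the difference of the indicator of a triangle is the closed walk around this
  -- triangle.
  at-d : ∀ {v} → ¬ isHub W v → ∀ d → at v d ℤ.- at v (a d) ≡ δ v d ℤ.+ δ (s v) d ℤ.+ δ (s (s v)) d
  at-d {v} h d = trans (cong₂ ℤ._-_ (at-three h d) (trans (at-three h (a d))
      (cong₂ ℤ._+_ (cong₂ ℤ._+_ (cong # (a-== d v)) (cong # (a-== d (s v)))) (cong # (a-== d (s (s v)))))))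
    (alg (# (d == v)) (# (d == s v)) (# (d == s (s v))) (# (d == a v)) (# (d == a (s v))) (# (d == a (s (s v)))))
    where
    alg : ∀ x y z x′ y′ z′ → x ℤ.+ y ℤ.+ z ℤ.- (x′ ℤ.+ y′ ℤ.+ z′) ≡ (x ℤ.- x′) ℤ.+ (y ℤ.- y′) ℤ.+ (z ℤ.- z′)
    alg = solve-∀

  at-hub : ∀ {v d} → ¬ isHub W v → isHub W d → at v d ≡ 0ℤ
  at-hub h h′ = cong # (≢-== λ e → h (vert-isHub e h′))

  at-s : ∀ v d → at v (s d) ≡ at v d
  at-s v d = cong (λ z → # (z == vert v)) (vert-s d)

  const-vert : ∀ {X : Set} (g : D → X) → (∀ d → g (s d) ≡ g d) → ∀ {x y} → vert x ≡ vert y → g x ≡ g y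
  const-vert g gs {x} e with i , refl ← V.rep⇒orb e = go i
    where
    go : ∀ i → g x ≡ g (iter s i x)
    go zero    = refl
    go (suc i) = trans (go i) (sym (gs _))

  area : ∀ {g} → Potential g → ℤ
  area P = sum (λ d → + ℤ.∣ Potential.w P d ∣)

  -- All triangles are directed 3-cycles. So two steps around one triangle have the same ends as the
  -- two steps around its neighbour across the third edge, and the exchange preserves the length.
  record Flip (g : D → ℤ) (P : Potential g) (p q : D) : Set where
    field
      p′ q′   : D
      col-p′  : col p′ ≡ true
      col-q′  : col q′ ≡ true
      begins : face (a p′) ≡ face (a p)
      middle  : face p′ ≡ face (a q′)
      ends : face q′ ≡ face q
      P′      : Potential (λ d → g d ℤ.+ (δ p′ d ℤ.+ δ q′ d ℤ.- δ p d ℤ.- δ q d))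
      smaller : area P′ ℤ.< area P

  -- A step p followed by a step q such that both cross edges of the same triangle, whose third
  -- edge t leads back from the end of q to the start of p.
  record Corner (g : D → ℤ) (P : Potential g) (X Y : D) : Set where
    field
      p q t  : D
      col-p  : col p ≡ true
      col-q  : col q ≡ true
      col-t  : col t ≡ true
      meet   : face p ≡ face (a q)
      p≢X    : face p ≢ X
      p≢Y    : face p ≢ Y
      g-p    : 1ℤ ℤ.≤ g p
      g-q    : 1ℤ ℤ.≤ g q
      t-end : face t ≡ face (a p)
      t-start : face (a t) ≡ face q
      -- The single triangle lies on one side of the turn or on the other; `straight-gap` will
      -- exclude both for straight lines.
      gap    : (f p ≡ a q) ⊎ ((f (a q) ≡ p) × ¬ isHub W p)
      next   : (1ℤ ℤ.≤ g t) ⊎ Flip g P p q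

  module _ {g : D → ℤ} (P : Potential g) (g≥0 : ∀ d → col d ≡ true → 0ℤ ℤ.≤ g d) (X Y : D) where
    open Potential P

    private
      anti : ∀ d → g (a d) ≡ ℤ.- g d
      anti d = trans (w-d (a d)) (trans (cong (λ z → w (a d) ℤ.- w z) (aa d)) (trans (alg (w d) (w (a d))) (cong ℤ.-_ (sym (w-d d)))))
        where
        alg : ∀ x y → y ℤ.- x ≡ ℤ.- (x ℤ.- y)
        alg = solve-∀

      positive : ∀ d → w (a d) ℤ.< w d → 1ℤ ℤ.≤ g d
      positive d h = subst (1ℤ ℤ.≤_) (sym (w-d d)) (gap-1 h)

      source : ∀ d → w (a d) ℤ.< w d → col d ≡ true
      source d h = case (col d) refl
        where
        case : ∀ b → col d ≡ b → col d ≡ true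
        case true  e = e
        case false e = contradiction (ℤ.neg-mono-≤ (g≥0 (a d) (trans (col-a d) (cong not e))))
          (ℤ.<⇒≱ (ℤ.<-≤-trans (ℤ.+<+ (s≤s z≤n)) (subst (1ℤ ℤ.≤_) (trans (sym (neg² (g d))) (cong ℤ.-_ (sym (anti d)))) (positive d h))))
          where
          neg² : ∀ x → ℤ.- (ℤ.- x) ≡ x
          neg² = solve-∀

      apart : ∀ {d e} → col d ≢ col e → vert d ≢ vert e
      apart ne h = ne (const-vert col col-s h)

      nonhub : ∀ {d} → w d ≢ 0ℤ → ¬ isHub W d
      nonhub ne h = ne (w-hub _ h)

      modify : (ε : ℤ) → ∀ {d e p q p′ q′} → ¬ isHub W d → ¬ isHub W e →
        (∀ x → δ p′ x ℤ.+ δ q′ x ℤ.- δ p x ℤ.- δ q x ≡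
               ε ℤ.* ((δ d x ℤ.+ δ (s d) x ℤ.+ δ (s (s d)) x) ℤ.+ (δ e x ℤ.+ δ (s e) x ℤ.+ δ (s (s e)) x))) →
        Potential (λ x → g x ℤ.+ (δ p′ x ℤ.+ δ q′ x ℤ.- δ p x ℤ.- δ q x))
      modify ε {d} {e} hd he eq = record
        { w = w′
        ; w-s = λ x → cong₂ (λ y z → y ℤ.+ ε ℤ.* z) (w-s x) (cong₂ ℤ._+_ (at-s d x) (at-s e x))
        ; w-hub = λ x h → trans (cong₂ (λ y z → y ℤ.+ ε ℤ.* z) (w-hub x h) (cong₂ ℤ._+_ (at-hub hd h) (at-hub he h)))
                            (trans (ℤ.+-identityˡ _) (ℤ.*-zeroʳ ε))
        ; w-d = λ x → trans (cong₂ ℤ._+_ (w-d x) (trans (eq x)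
                    (cong (λ z → ε ℤ.* z) (sym (cong₂ ℤ._+_ (at-d hd x) (at-d he x))))))
                    (alg ε (w x) (w (a x)) (at d x) (at d (a x)) (at e x) (at e (a x))) }
        where
        w′ : D → ℤ
        w′ x = w x ℤ.+ ε ℤ.* (at d x ℤ.+ at e x)
        alg : ∀ ε x x′ y y′ z z′ → x ℤ.- x′ ℤ.+ ε ℤ.* ((y ℤ.- y′) ℤ.+ (z ℤ.- z′)) ≡
              x ℤ.+ ε ℤ.* (y ℤ.+ z) ℤ.- (x′ ℤ.+ ε ℤ.* (y′ ℤ.+ z′))
        alg = solve-∀

      shrink : (ε : ℤ) → ∀ {d e} → vert d ≢ vert e →
        (∀ {x} → (vert x ≡ vert d) ⊎ (vert x ≡ vert e) → + ℤ.∣ w x ℤ.+ ε ∣ ℤ.< + ℤ.∣ w x ∣) →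
        sum (λ x → + ℤ.∣ w x ℤ.+ ε ℤ.* (at d x ℤ.+ at e x) ∣) ℤ.< sum (λ x → + ℤ.∣ w x ∣)
      shrink ε {d} {e} ne closer = sum-strict (λ x → le x (vert x F.≟ vert d) (vert x F.≟ vert e)) d (λ p → ℤ.<-irrefl (trans (cong (λ z → + ℤ.∣ z ∣) (sym (on-d refl))) p) (closer (inj₁ refl)))
        where
        one : ∀ z → z ℤ.+ ε ℤ.* 1ℤ ≡ z ℤ.+ ε
        one z = cong (λ y → z ℤ.+ y) (ℤ.*-identityʳ ε)
        on-d : ∀ {x} → vert x ≡ vert d → w x ℤ.+ ε ℤ.* (at d x ℤ.+ at e x) ≡ w x ℤ.+ ε
        on-d {x} p = trans (cong₂ (λ y z → w x ℤ.+ ε ℤ.* (# y ℤ.+ # z)) (≡-== p) (≢-== λ q → ne (trans (sym p) q))) (one (w x))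
        on-e : ∀ {x} → vert x ≢ vert d → vert x ≡ vert e → w x ℤ.+ ε ℤ.* (at d x ℤ.+ at e x) ≡ w x ℤ.+ ε
        on-e {x} np p = trans (cong₂ (λ y z → w x ℤ.+ ε ℤ.* (# y ℤ.+ # z)) (≢-== np) (≡-== p)) (one (w x))
        off : ∀ {x} → vert x ≢ vert d → vert x ≢ vert e → w x ℤ.+ ε ℤ.* (at d x ℤ.+ at e x) ≡ w x
        off {x} p q = trans (cong₂ (λ y z → w x ℤ.+ ε ℤ.* (# y ℤ.+ # z)) (≢-== p) (≢-== q))
                        (trans (cong (λ y → w x ℤ.+ y) (ℤ.*-zeroʳ ε)) (ℤ.+-identityʳ (w x)))
        le : ∀ x → Dec (vert x ≡ vert d) → Dec (vert x ≡ vert e) → + ℤ.∣ w x ℤ.+ ε ℤ.* (at d x ℤ.+ at e x) ∣ ℤ.≤ + ℤ.∣ w x ∣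
        le x (yes p) _       = subst (λ z → + ℤ.∣ z ∣ ℤ.≤ + ℤ.∣ w x ∣) (sym (on-d p)) (ℤ.<⇒≤ (closer (inj₁ p)))
        le x (no np) (yes p) = subst (λ z → + ℤ.∣ z ∣ ℤ.≤ + ℤ.∣ w x ∣) (sym (on-e np p)) (ℤ.<⇒≤ (closer (inj₂ p)))
        le x (no np) (no nq) = ℤ.≤-reflexive (cong (λ z → + ℤ.∣ z ∣) (off np nq))

    -- An edge that leaves the region w < 0 carries positive flow on its outer dart, which is
    -- therefore the source end. So all exits of the region are sinks, and `κ` is `false`.
    corner-below : ∀ {d₀} → w d₀ ℤ.< 0ℤ → Corner g P X Y
    corner-below {d₀} w<0 = build (lonely-exists X Y)
      where
      A : D → Bool
      A d = does (0ℤ ℤ.≤? w d)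
      A⇒ : ∀ {d} → A d ≡ true → 0ℤ ℤ.≤ w d
      A⇒ {d} e with 0ℤ ℤ.≤? w d
      ... | yes p = p
      ¬A⇒ : ∀ {d} → A d ≡ false → w d ℤ.< 0ℤ
      ¬A⇒ {d} e with 0ℤ ℤ.≤? w d
      ... | no p = ℤ.≰⇒> p
      open GaussBonnet W A (λ d → cong (λ z → does (0ℤ ℤ.≤? z)) (w-s d)) (λ {d} h → cong (λ z → does (0ℤ ℤ.≤? z)) (w-hub d h))
        false (λ d e e′ → trans (sym (trans (cong col (aa d)) refl)) (trans (col-a (a d)) (cong not
          (source (a d) (subst (λ z → w z ℤ.< w (a d)) (sym (aa d)) (ℤ.<-≤-trans (¬A⇒ e) (A⇒ e′)))))))
        d₀ (dec-false (0ℤ ℤ.≤? w d₀) (ℤ.<⇒≱ w<0)) using (lonely-exists)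
      build : (∃ λ d → (A d ≡ false) × (A (a d) ≡ true) × (A (a (s (s d))) ≡ true) × (face d ≢ X) × (face d ≢ Y)) → Corner g P X Y
      build (d , e₀ , e₁ , e₂ , nX , nY) = record
        { p = p ; q = q ; t = e
        ; col-p = source p step-p ; col-q = source q step-q ; col-t = col-e
        ; meet = trans (face-as² d-int) (cong face (sym (aa d)))
        ; p≢X = λ h → nX (trans (sym (face-as² d-int)) h) ; p≢Y = λ h → nY (trans (sym (face-as² d-int)) h)
        ; g-p = positive p step-p ; g-q = positive q step-q
        ; t-end = trans (face-as d) (cong face (sym (aa (s (s d)))))
        ; t-start = trans (cong face (aa (s d))) (face-s d)
        ; gap = inj₁ (trans (f-a (s (s d))) (trans (s³ d-int) (sym (aa d))))
        ; next = next (w e ℤ.<? 0ℤ) }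
        where
        p q e : D
        p = a (s (s d))
        q = a d
        e = a (s d)
        w-d<0 : w d ℤ.< 0ℤ
        w-d<0 = ¬A⇒ e₀
        d-int : ¬ isHub W d
        d-int = nonhub (ℤ.<⇒≢ w-d<0)
        ws² : w (s (s d)) ≡ w d
        ws² = trans (w-s (s d)) (w-s d)
        step-p : w (a p) ℤ.< w p
        step-p = subst (ℤ._< w p) (sym (trans (cong w (aa _)) ws²)) (ℤ.<-≤-trans w-d<0 (A⇒ e₂))
        step-q : w (a q) ℤ.< w q
        step-q = subst (ℤ._< w q) (sym (cong w (aa d))) (ℤ.<-≤-trans w-d<0 (A⇒ e₁))
        col-d : col d ≡ false
        col-d = trans (cong col (sym (aa d))) (trans (col-a q) (cong not (source q step-q)))
        col-e : col e ≡ true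
        col-e = trans (col-a (s d)) (cong not (trans (col-s d) col-d))
        next : Dec (w e ℤ.< 0ℤ) → (1ℤ ℤ.≤ g e) ⊎ Flip g P p q
        -- If w < 0 also on the triangle across the third edge, then raising `w` by 1 on both
        -- triangles performs the flip and reduces the area. Otherwise the third edge itself carries
        -- flow.
        next (no h) = inj₁ (positive e (subst (ℤ._< w e) (sym (trans (cong w (aa _)) (w-s d))) (ℤ.<-≤-trans w-d<0 (ℤ.≮⇒≥ h))))
        next (yes h) = inj₂ (record
          { p′ = s (s e) ; q′ = s e
          ; col-p′ = trans (col-s _) (trans (col-s e) col-e) ; col-q′ = trans (col-s e) col-e
          ; begins = trans (face-as² e-int) (trans (face-as d) (cong face (sym (aa (s (s d))))))
          ; middle = sym (face-as e)
          ; ends = trans (face-s e) (trans (cong face (aa (s d))) (face-s d))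
          ; P′ = modify 1ℤ d-int e-int (λ x → trans
              (cong₂ (λ y z → δ (s (s e)) x ℤ.+ δ (s e) x ℤ.- y ℤ.- z) (δ-a (s (s d)) x) (δ-a d x))
              (trans (alg (δ d x) (δ (s d) x) (δ (s (s d)) x) (δ (s e) x) (δ (s (s e)) x))
                (cong (λ y → 1ℤ ℤ.* ((δ d x ℤ.+ δ (s d) x ℤ.+ δ (s (s d)) x) ℤ.+ (y ℤ.+ δ (s e) x ℤ.+ δ (s (s e)) x)))
                  (sym (δ-a (s d) x)))))
          ; smaller = shrink 1ℤ (apart λ h → true≢false (trans h col-e) col-d)
              (λ { (inj₁ v) → abs-up (subst (ℤ._< 0ℤ) (sym (const-vert w w-s v)) w-d<0)
                 ; (inj₂ v) → abs-up (subst (ℤ._< 0ℤ) (sym (const-vert w w-s v)) h) }) })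
          where
          e-int : ¬ isHub W e
          e-int = nonhub (ℤ.<⇒≢ h)
          alg : ∀ A B C E F → F ℤ.+ E ℤ.- (ℤ.- C) ℤ.- (ℤ.- A) ≡ 1ℤ ℤ.* ((A ℤ.+ B ℤ.+ C) ℤ.+ (ℤ.- B ℤ.+ E ℤ.+ F))
          alg = solve-∀

    corner-above : ∀ {d₀} → 0ℤ ℤ.< w d₀ → Corner g P X Y
    corner-above {d₀} w>0 = build (lonely-exists X Y)
      where
      A : D → Bool
      A d = does (w d ℤ.≤? 0ℤ)
      A⇒ : ∀ {d} → A d ≡ true → w d ℤ.≤ 0ℤ
      A⇒ {d} e with w d ℤ.≤? 0ℤ
      ... | yes p = p
      ¬A⇒ : ∀ {d} → A d ≡ false → 0ℤ ℤ.< w d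
      ¬A⇒ {d} e with w d ℤ.≤? 0ℤ
      ... | no p = ℤ.≰⇒> p
      open GaussBonnet W A (λ d → cong (λ z → does (z ℤ.≤? 0ℤ)) (w-s d)) (λ {d} h → cong (λ z → does (z ℤ.≤? 0ℤ)) (w-hub d h))
        true (λ d e e′ → source d (ℤ.≤-<-trans (A⇒ e′) (¬A⇒ e)))
        d₀ (dec-false (w d₀ ℤ.≤? 0ℤ) (ℤ.<⇒≱ w>0)) using (lonely-exists)
      build : (∃ λ d → (A d ≡ false) × (A (a d) ≡ true) × (A (a (s (s d))) ≡ true) × (face d ≢ X) × (face d ≢ Y)) → Corner g P X Y
      build (d , e₀ , e₁ , e₂ , nX , nY) = record
        { p = d ; q = q ; t = s d
        ; col-p = col-d ; col-q = source q step-q ; col-t = trans (col-s d) col-d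
        ; meet = sym (face-as² d-int)
        ; p≢X = nX ; p≢Y = nY
        ; g-p = positive d (ℤ.≤-<-trans (A⇒ e₁) w-d>0) ; g-q = positive q step-q
        ; t-end = face-s d
        ; t-start = face-as d
        ; gap = inj₂ (trans (f-a q) (s³ d-int) , d-int)
        ; next = next (0ℤ ℤ.<? w e) }
        where
        q e : D
        q = s (s d)
        e = a (s d)
        w-d>0 : 0ℤ ℤ.< w d
        w-d>0 = ¬A⇒ e₀
        d-int : ¬ isHub W d
        d-int = nonhub (ℤ.<⇒≢ w-d>0 ∘ sym)
        col-d : col d ≡ true
        col-d = source d (ℤ.≤-<-trans (A⇒ e₁) w-d>0)
        step-q : w (a q) ℤ.< w q
        step-q = ℤ.≤-<-trans (A⇒ e₂) (subst (0ℤ ℤ.<_) (sym (trans (w-s (s d)) (w-s d))) w-d>0)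
        col-e : col e ≡ false
        col-e = trans (col-a (s d)) (cong not (trans (col-s d) col-d))
        next : Dec (0ℤ ℤ.< w e) → (1ℤ ℤ.≤ g (s d)) ⊎ Flip g P d q
        next (no h) = inj₁ (positive (s d) (ℤ.≤-<-trans (ℤ.≮⇒≥ h) (subst (0ℤ ℤ.<_) (sym (w-s d)) w-d>0)))
        next (yes h) = inj₂ (record
          { p′ = a (s e) ; q′ = a (s (s e))
          ; col-p′ = trans (col-a _) (cong not (trans (col-s e) col-e))
          ; col-q′ = trans (col-a _) (cong not (trans (col-s _) (trans (col-s e) col-e)))
          ; begins = trans (cong face (aa (s e))) (trans (face-s e) (trans (cong face (aa (s d))) (face-s d)))
          ; middle = trans (face-as e) (cong face (sym (aa (s (s e)))))
          ; ends = trans (face-as² e-int) (face-as d)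
          ; P′ = modify ℤ.-1ℤ d-int e-int (λ x → trans
              (cong₂ (λ y z → y ℤ.+ z ℤ.- δ d x ℤ.- δ (s (s d)) x) (δ-a (s e) x) (δ-a (s (s e)) x))
              (trans (alg (δ d x) (δ (s d) x) (δ (s (s d)) x) (δ (s e) x) (δ (s (s e)) x))
                (cong (λ y → ℤ.-1ℤ ℤ.* ((δ d x ℤ.+ δ (s d) x ℤ.+ δ (s (s d)) x) ℤ.+ (y ℤ.+ δ (s e) x ℤ.+ δ (s (s e)) x)))
                  (sym (δ-a (s d) x)))))
          ; smaller = shrink ℤ.-1ℤ (apart λ h → true≢false col-d (trans h col-e))
              (λ { (inj₁ v) → abs-down (subst (0ℤ ℤ.<_) (sym (const-vert w w-s v)) w-d>0)
                 ; (inj₂ v) → abs-down (subst (0ℤ ℤ.<_) (sym (const-vert w w-s v)) h) }) })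
          where
          e-int : ¬ isHub W e
          e-int = sink-¬hub col-e
          alg : ∀ A B C E F → ℤ.- E ℤ.+ ℤ.- F ℤ.- A ℤ.- C ≡ ℤ.-1ℤ ℤ.* ((A ℤ.+ B ℤ.+ C) ℤ.+ (ℤ.- B ℤ.+ E ℤ.+ F))
          alg = solve-∀

    corner : ∀ {e} → 1ℤ ℤ.≤ g e → Corner g P X Y
    corner {e} h = case (w e ℤ.≤? 0ℤ)
      where
      case : Dec (w e ℤ.≤ 0ℤ) → Corner g P X Y
      case (no p)  = corner-above {e} (ℤ.≰⇒> p)
      case (yes p) = corner-below {a e} (ℤ.<-≤-trans (lin′ (subst (1ℤ ℤ.≤_) (w-d e) h)) p)
        where
        lin′ : ∀ {x y} → 1ℤ ℤ.≤ x ℤ.- y → y ℤ.< x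
        lin′ {x} {y} q = ℤ.suc[i]≤j⇒i<j (lin q (alg x y))
          where
          alg : ∀ x y → x ℤ.- (1ℤ ℤ.+ y) ≡ x ℤ.- y ℤ.- 1ℤ
          alg = solve-∀

-- Directed paths in the dual graph and their flows

snoc? : ∀ {X : Set} (l : List X) → (l ≡ []) ⊎ (∃ λ l′ → ∃ λ z → l ≡ l′ ++ z ∷ [])
snoc? [] = inj₁ refl
snoc? (x ∷ l) with snoc? l
... | inj₁ refl            = inj₂ ([] , x , refl)
... | inj₂ (l′ , z , refl) = inj₂ (x ∷ l′ , z , refl)

∈-last : ∀ {X : Set} (l : List X) {z} → z ∈ l ++ z ∷ []
∈-last l = ∈-++⁺ʳ l (here refl)

module Paths {n′ : ℕ} (W : Web (suc n′)) where
  open Map W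
  open Count W
  open Homology W
  open Corners W

  -- A path is the list of the source darts that it crosses: the face of `a e` lies to the left of
  -- the edge, that of `e` to the right. The end points are darts that stand for their faces.
  IsPath : D → List D → D → Set
  IsPath x []      y = face x ≡ face y
  IsPath x (e ∷ l) y = (col e ≡ true) × (face (a e) ≡ face x) × IsPath e l y

  endOf : D → List D → D
  endOf x []      = x
  endOf x (e ∷ l) = endOf e l

  endOf-snoc : ∀ x l {z} → endOf x (l ++ z ∷ []) ≡ z
  endOf-snoc x []      = refl
  endOf-snoc x (e ∷ l) = endOf-snoc e l

  path-start : ∀ {x x′} l {y} → face x ≡ face x′ → IsPath x l y → IsPath x′ l y
  path-start []      e p           = trans (sym e) p
  path-start (_ ∷ _) e (c , q , p) = c , trans q e , p

  path-end : ∀ {x} l {y y′} → face y ≡ face y′ → IsPath x l y → IsPath x l y′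
  path-end []      e p           = trans p e
  path-end (_ ∷ l) e (c , q , p) = c , q , path-end l e p

  path-++ : ∀ {x} l {z l′ y} → IsPath x l z → IsPath z l′ y → IsPath x (l ++ l′) y
  path-++ []      {l′ = l′} p           p′ = path-start l′ (sym p) p′
  path-++ (_ ∷ l)           (c , q , p) p′ = c , q , path-++ l p p′

  path-split : ∀ {x} l {l′ y} → IsPath x (l ++ l′) y → IsPath x l (endOf x l) × IsPath (endOf x l) l′ y
  path-split []      p = refl , p
  path-split (_ ∷ l) (c , q , p) with p₁ , p₂ ← path-split l p = (c , q , p₁) , p₂

  path-endOf : ∀ {x} l {y} → IsPath x l y → face (endOf x l) ≡ face y
  path-endOf []      p           = p
  path-endOf (_ ∷ l) (_ , _ , p) = path-endOf l p

  path-last : ∀ {x} l {z y} → IsPath x (l ++ z ∷ []) y → face z ≡ face y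
  path-last {x} l p = trans (cong face (sym (endOf-snoc x l))) (path-endOf (l ++ _ ∷ []) p)

  path-col : ∀ {x} l {y e} → IsPath x l y → e ∈ l → col e ≡ true
  path-col (_ ∷ l) (c , _ , _) (here refl) = c
  path-col (_ ∷ l) (_ , _ , p) (there i)   = path-col l p i

  flow : List D → D → ℤ
  flow []      d = 0ℤ
  flow (e ∷ l) d = δ e d ℤ.+ flow l d

  flow-++ : ∀ l l′ d → flow (l ++ l′) d ≡ flow l d ℤ.+ flow l′ d
  flow-++ []      l′ d = sym (ℤ.+-identityˡ _)
  flow-++ (e ∷ l) l′ d = trans (cong (λ z → δ e d ℤ.+ z) (flow-++ l l′ d)) (sym (ℤ.+-assoc (δ e d) _ _))

  flow-anti : ∀ l d → flow l (a d) ≡ ℤ.- flow l d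
  flow-anti []      d = refl
  flow-anti (e ∷ l) d = trans (cong₂ ℤ._+_ (δ-anti e d) (flow-anti l d)) (sym (ℤ.neg-distrib-+ (δ e d) (flow l d)))

  δ-source : ∀ {e d} → col e ≡ true → col d ≡ true → δ e d ≡ # (d == e)
  δ-source {e} {d} ce cd = trans (cong (λ b → # (d == e) ℤ.- # b) (≢-== λ p →
    true≢false cd (trans (cong col p) (trans (col-a e) (cong not ce))))) (ℤ.+-identityʳ _)

  δ-≤ : ∀ {e d} → d ≢ e → δ e d ℤ.≤ 0ℤ
  δ-≤ {e} {d} ne = subst (λ b → # b ℤ.- # (d == a e) ℤ.≤ 0ℤ) (sym (≢-== ne)) (go (d == a e))
    where
    go : ∀ b → 0ℤ ℤ.- # b ℤ.≤ 0ℤ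
    go true  = ℤ.-≤+
    go false = ℤ.≤-refl

  flow-≥0 : ∀ {x} l {y} → IsPath x l y → ∀ d → col d ≡ true → 0ℤ ℤ.≤ flow l d
  flow-≥0 []      p           d cd = ℤ.≤-refl
  flow-≥0 (e ∷ l) (c , _ , p) d cd = ℤ.+-mono-≤ (subst (0ℤ ℤ.≤_) (sym (δ-source c cd)) (#≥0′ (d == e))) (flow-≥0 l p d cd)
    where
    #≥0′ : ∀ b → 0ℤ ℤ.≤ # b
    #≥0′ true  = ℤ.+≤+ z≤n
    #≥0′ false = ℤ.≤-refl

  flow-head : ∀ {x} e l {y} → IsPath x (e ∷ l) y → 1ℤ ℤ.≤ flow (e ∷ l) e
  flow-head e l (c , _ , p) = ℤ.+-mono-≤ (ℤ.≤-reflexive (sym (trans (δ-source c c) (cong # (≡-== {x = e} refl))))) (flow-≥0 l p e c)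

  flow-∈ : ∀ l d → 1ℤ ℤ.≤ flow l d → d ∈ l
  flow-∈ []      d (ℤ.+≤+ ())
  flow-∈ (e ∷ l) d h = go (d F.≟ e)
    where
    go : Dec (d ≡ e) → d ∈ e ∷ l
    go (yes p) = here p
    go (no ne) = there (flow-∈ l d (ℤ.≤-trans h (subst (δ e d ℤ.+ flow l d ℤ.≤_) (ℤ.+-identityˡ _) (ℤ.+-monoˡ-≤ (flow l d) (δ-≤ ne)))))

  flow-∈₂ : ∀ l l′ d → 1ℤ ℤ.≤ flow l d ℤ.+ flow l′ d → (d ∈ l) ⊎ (d ∈ l′)
  flow-∈₂ l l′ d h with 1ℤ ℤ.≤? flow l d
  ... | yes p = inj₁ (flow-∈ l d p)
  ... | no np = inj₂ (flow-∈ l′ d (ℤ.≤-trans h (subst (flow l d ℤ.+ flow l′ d ℤ.≤_) (ℤ.+-identityˡ _)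
                  (ℤ.+-monoˡ-≤ (flow l′ d) (ℤ.i<j⇒i≤pred[j] (ℤ.≰⇒> np))))))

  -- The divergence of a path: at an inner face the step that arrives contributes 1 and the step
  -- that leaves contributes -1.
  flow-circ : ∀ {x} l {y} c → IsPath x l y → sum (λ d → # (face d == c) ℤ.* flow l d) ≡ # (face y == c) ℤ.- # (face x == c)
  flow-circ {x} [] {y} c p = trans (sum-0 λ d → ℤ.*-zeroʳ (# (face d == c)))
    (sym (trans (cong (λ z → # (z == c) ℤ.- # (face x == c)) (sym p)) (ℤ.+-inverseʳ (# (face x == c)))))
  flow-circ {x} (e ∷ l) {y} c (_ , q , p) = begin
    sum (λ d → # (face d == c) ℤ.* (δ e d ℤ.+ flow l d))
      ≡⟨ sum-cong (λ d → alg (# (face d == c)) (# (d == e)) (# (d == a e)) (flow l d)) ⟩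
    sum (λ d → (# (d == e) ℤ.* # (face d == c) ℤ.- # (d == a e) ℤ.* # (face d == c)) ℤ.+ # (face d == c) ℤ.* flow l d)
      ≡⟨ trans (sum-+ _ (λ d → # (face d == c) ℤ.* flow l d)) (cong₂ ℤ._+_ (trans (sum-- _ _)
           (cong₂ ℤ._-_ (sum-δ e (λ d → # (face d == c))) (sum-δ (a e) (λ d → # (face d == c))))) (flow-circ l c p)) ⟩
    (# (face e == c) ℤ.- # (face (a e) == c)) ℤ.+ (# (face y == c) ℤ.- # (face e == c))
      ≡⟨ cong (λ z → (# (face e == c) ℤ.- # (z == c)) ℤ.+ (# (face y == c) ℤ.- # (face e == c))) q ⟩
    (# (face e == c) ℤ.- # (face x == c)) ℤ.+ (# (face y == c) ℤ.- # (face e == c))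
      ≡⟨ alg′ (# (face e == c)) (# (face x == c)) (# (face y == c)) ⟩
    # (face y == c) ℤ.- # (face x == c) ∎
    where
    open ≡-Reasoning
    alg : ∀ b x y z → b ℤ.* (x ℤ.- y ℤ.+ z) ≡ (x ℤ.* b ℤ.- y ℤ.* b) ℤ.+ b ℤ.* z
    alg = solve-∀
    alg′ : ∀ x y z → (x ℤ.- y) ℤ.+ (z ℤ.- x) ≡ z ℤ.- y
    alg′ = solve-∀

  flow₂ : List D → List D → D → ℤ
  flow₂ γ ω d = flow γ d ℤ.+ flow ω d

  closed-potential : ∀ {x y} γ ω → IsPath x γ y → IsPath y ω x → Potential (flow₂ γ ω)
  closed-potential {x} {y} γ ω p q = potential (flow₂ γ ω)
    (λ d → trans (cong₂ ℤ._+_ (flow-anti γ d) (flow-anti ω d)) (sym (ℤ.neg-distrib-+ (flow γ d) (flow ω d))))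
    (λ c → trans (trans (sum-cong λ d → ℤ.*-distribˡ-+ (# (face d == c)) (flow γ d) (flow ω d))
             (trans (sum-+ (λ d → # (face d == c) ℤ.* flow γ d) (λ d → # (face d == c) ℤ.* flow ω d))
               (cong₂ ℤ._+_ (flow-circ γ c p) (flow-circ ω c q)))) (alg (# (face x == c)) (# (face y == c))))
    where
    alg : ∀ x y → (y ℤ.- x) ℤ.+ (x ℤ.- y) ≡ 0ℤ
    alg = solve-∀

  potential-cong : ∀ {g g′} → (∀ d → g d ≡ g′ d) → Potential g → Potential g′
  potential-cong e P = record { w = w ; w-s = w-s ; w-hub = w-hub ; w-d = λ d → trans (sym (e d)) (w-d d) }
    where open Potential P

  Clash : List D → Set
  Clash l = ∃ λ u → ∃ λ e → ∃ λ v → ∃ λ e′ → ∃ λ z → (l ≡ u ++ e ∷ v ++ e′ ∷ z) × (face e ≡ face e′)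

  Simple : List D → Set
  Simple []      = ⊤
  Simple (e ∷ l) = (∀ {z} → z ∈ l → face e ≢ face z) × Simple l

  clash? : ∀ l → Clash l ⊎ Simple l
  clash? [] = inj₂ tt
  clash? (e ∷ l) with any? (λ z → face e F.≟ face z) l
  ... | yes h with z , i , q ← Mem.find h with u , v , refl ← ∈-∃++ i = inj₁ ([] , e , u , z , v , refl , q)
  ... | no nh with clash? l
  ...   | inj₁ (u , e₁ , v , e₂ , z , refl , q) = inj₁ (e ∷ u , e₁ , v , e₂ , z , refl , q)
  ...   | inj₂ sl = inj₂ ((λ i q → nh (Any-map i q)) , sl)
    where
    Any-map : ∀ {l z} → z ∈ l → face e ≡ face z → Any (λ z → face e ≡ face z) l
    Any-map (here refl) q = here q
    Any-map (there i)   q = there (Any-map i q)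

  -- Only the faces in which steps end are compared. In a closed walk made of two non-empty paths
  -- every visited face, the two common ends included, is thereby counted once.
  Disjoint : List D → List D → Set
  Disjoint l l′ = ∀ {e e′} → e ∈ l → e′ ∈ l′ → face e ≢ face e′

  common? : ∀ l l′ → (∃ λ e → ∃ λ e′ → (e ∈ l) × (e′ ∈ l′) × (face e ≡ face e′)) ⊎ Disjoint l l′
  common? [] l′ = inj₂ λ ()
  common? (e ∷ l) l′ with any? (λ z → face e F.≟ face z) l′
  ... | yes h with z , i , q ← Mem.find h = inj₁ (e , z , here refl , i , q)
  ... | no nh with common? l l′
  ...   | inj₁ (e₁ , e₂ , i , j , q) = inj₁ (e₁ , e₂ , there i , j , q)
  ...   | inj₂ dj = inj₂ λ { (here refl) j q → nh (Any-map j q) ; (there i) j q → dj i j q }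
    where
    Any-map : ∀ {l z} → z ∈ l → face e ≡ face z → Any (λ z → face e ≡ face z) l
    Any-map (here refl) q = here q
    Any-map (there i)   q = there (Any-map i q)

  simple-left : ∀ u {e v z} → Simple (u ++ e ∷ v) → z ∈ u → face z ≢ face e
  simple-left (z ∷ u) (h , _)  (here refl) q = h (∈-++⁺ʳ u (here refl)) q
  simple-left (_ ∷ u) (_ , sl) (there i)   q = simple-left u sl i q

  simple-right : ∀ u {e v z} → Simple (u ++ e ∷ v) → z ∈ v → face e ≢ face z
  simple-right []      (h , _)  i q = h i q
  simple-right (_ ∷ u) (_ , sl) i q = simple-right u sl i q

  simple-unique : ∀ l {e e′} → Simple l → e ∈ l → e′ ∈ l → face e ≡ face e′ → e ≡ e′
  simple-unique (_ ∷ l) _        (here refl) (here refl) q = refl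
  simple-unique (_ ∷ l) (h , _)  (here refl) (there j)   q = ⊥-elim (h j q)
  simple-unique (_ ∷ l) (h , _)  (there i)   (here refl) q = ⊥-elim (h i (sym q))
  simple-unique (_ ∷ l) (_ , sl) (there i)   (there j)   q = simple-unique l sl i j q

  -- In a simple closed walk only one step ends in the face where `q` starts, and `p` ends there. If
  -- `q` were the first step of `γ`, this face would be that of `x`, which is excluded.
  consecutive : ∀ {x y} γ ω {p q} → IsPath x γ y → Simple γ → Disjoint γ ω → (p ∈ γ) ⊎ (p ∈ ω) → q ∈ γ →
                face p ≡ face (a q) → face p ≢ face x → ∃ λ u → ∃ λ v → γ ≡ u ++ p ∷ q ∷ v
  consecutive {x} γ ω {p} {q} pγ sγ dj ip iq meet ne with u , v , refl ← ∈-∃++ iq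
    with _ , (_ , st , _) ← path-split u pγ with snoc? u
  ... | inj₁ refl = contradiction (trans meet st) ne
  ... | inj₂ (u′ , z , refl) = u′ , v , trans (L.++-assoc u′ (z ∷ []) (q ∷ v)) (cong (λ e → u′ ++ e ∷ q ∷ v) (same ip))
    where
    z∈ : z ∈ (u′ ++ z ∷ []) ++ q ∷ v
    z∈ = ∈-++⁺ˡ (∈-last u′)
    agree : face z ≡ face p
    agree = sym (trans meet (trans st (cong face (endOf-snoc x u′))))
    same : (p ∈ (u′ ++ z ∷ []) ++ q ∷ v) ⊎ (p ∈ ω) → z ≡ p
    same (inj₁ i) = simple-unique _ sγ z∈ i agree
    same (inj₂ i) = contradiction agree (dj z∈ i)

  -- If the third edge of a corner is also used, then the closed walk is the boundary of a triangle.
  triangle : ∀ {x y} γ ω u v {p q t} → IsPath x γ y → IsPath y ω x → Simple γ → Simple ω → Disjoint γ ω →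
             γ ≡ u ++ p ∷ q ∷ v → (t ∈ γ) ⊎ (t ∈ ω) → face t ≡ face (a p) → face (a t) ≡ face q → ω ≢ [] →
             (γ ≡ p ∷ q ∷ []) × (ω ≡ t ∷ [])
  triangle {x} {y} γ ω u v {p} {q} {t} pγ pω sγ sω dj refl (inj₂ i) te ts ne
    with m , m′ , refl ← ∈-∃++ i
    with p₁ , (_ , st , p₂) ← path-split u pγ
    with q₁ , (_ , st′ , q₂) ← path-split m pω
    with snoc? m
  ... | inj₂ (m₀ , z , refl) = contradiction (trans (sym ts) (trans st′ (cong face (endOf-snoc y m₀))))
          (dj (∈-++⁺ʳ u (there (here refl))) (∈-++⁺ˡ (∈-last m₀)))
  ... | inj₁ refl with snoc? v
  ...   | inj₂ (v₀ , z , refl) = contradiction (trans (trans (sym ts) st′) (sym (path-last v₀ (proj₂ (proj₂ p₂)))))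
            (simple-right (u ++ p ∷ []) (subst Simple (sym (L.++-assoc u (p ∷ []) _)) sγ) (∈-last v₀))
  ...   | inj₁ refl with snoc? u
  ...     | inj₂ (u₀ , z , refl) = contradiction (sym (trans te (trans st (cong face (endOf-snoc x u₀)))))
              (dj (∈-++⁺ˡ (∈-last u₀)) (here refl))
  ...     | inj₁ refl with snoc? m′
  ...       | inj₂ (m₁ , z , refl) = contradiction (trans te (trans st (sym (path-last m₁ q₂)))) (simple-right [] sω (∈-last m₁))
  ...       | inj₁ refl = refl , refl
  triangle {x} {y} γ ω u v {p} {q} {t} pγ pω sγ sω dj refl (inj₁ i) te ts ne
    with p₁ , (_ , st , p₂) ← path-split u pγ
    with snoc? ω
  ... | inj₁ e = contradiction e ne
  ... | inj₂ (ω₀ , z , refl) with snoc? u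
  ...   | inj₁ refl = contradiction (trans te (trans st (sym (path-last ω₀ pω)))) (dj i (∈-last ω₀))
  ...   | inj₂ (u₀ , z′ , refl)
    with refl ← simple-unique _ sγ i (∈-++⁺ˡ (∈-last u₀)) (trans te (trans st (cong face (endOf-snoc x u₀))))
    with p₃ , (_ , st′ , _) ← path-split u₀ p₁
    with snoc? u₀
  ...     | inj₁ refl = contradiction (trans (sym ts) (trans st′ (sym (path-last ω₀ pω))))
              (dj (∈-++⁺ʳ (t ∷ []) (there (here refl))) (∈-last ω₀))
  ...     | inj₂ (u₁ , z″ , refl) = contradiction (trans (trans (cong face (sym (endOf-snoc x u₁))) (sym st′)) ts)
              (simple-left (((u₁ ++ z″ ∷ []) ++ t ∷ []) ++ p ∷ []) (subst Simple (sym (L.++-assoc ((u₁ ++ z″ ∷ []) ++ t ∷ []) (p ∷ []) _)) sγ)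
                (∈-++⁺ˡ (∈-++⁺ˡ (∈-last u₁))))

-- Digons: two directed paths with exchanged ends

module Digons {n′ : ℕ} (W : Web (suc n′)) where
  open Map W
  open Homology W
  open Corners W
  open Paths W

  -- On one side of the two consecutive steps p, q there are exactly three triangles between them.
  Str : D → D → Set
  Str p q = (f (f (f p)) ≡ a q) × ¬ isHub W (f (f p))

  Straight : List D → Set
  Straight l = ∀ u p q v → l ≡ u ++ p ∷ q ∷ v → Str p q

  straight-left : ∀ l l′ → Straight (l ++ l′) → Straight l
  straight-left l l′ st u p q v e = st u p q (v ++ l′) (trans (cong (_++ l′) e) (L.++-assoc u (p ∷ q ∷ v) l′))

  straight-right : ∀ l l′ → Straight (l ++ l′) → Straight l′
  straight-right l l′ st u p q v e = st (l ++ u) p q v (trans (cong (l ++_) e) (sym (L.++-assoc l u (p ∷ q ∷ v))))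

  -- With the three triangles of `Str`, a sharp turn on the same side closes the face after two
  -- corners, and one on the other side after 3 + 1 = 4. Inner faces have at least six.
  straight-gap : ∀ {p q} → col p ≡ true → col q ≡ true → Str p q → (f p ≡ a q) ⊎ ((f (a q) ≡ p) × ¬ isHub W p) → ⊥
  straight-gap {p} {q} cp cq (e , h) (inj₁ g) = internal-face-≥6 W (a q) (λ i → proj₁ (two i)) 2 (s≤s z≤n) (s≤s (s≤s (s≤s z≤n))) cycle
    where
    cycle : f (f (a q)) ≡ a q
    cycle = trans (cong (f ∘ f) (sym g)) e
    hx : ¬ isHub W (a q)
    hx = sink-¬hub (trans (col-a q) (cong not cq))
    hy : ¬ isHub W (f (a q))
    hy = subst (λ z → ¬ isHub W (f z)) g h
    two : ∀ i → ¬ isHub W (iter f i (a q)) × ¬ isHub W (iter f (suc i) (a q))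
    two zero    = hx , hy
    two (suc i) with h₁ , h₂ ← two i = h₂ , subst (λ z → ¬ isHub W z)
      (trans (cong (iter f i) (sym cycle)) (trans (iter-shift f i (f (a q))) (cong f (iter-shift f i (a q))))) h₁
  straight-gap {p} {q} cp cq (e , h) (inj₂ (g , hp)) = internal-face-≥6 W p (λ i → proj₁ (four i)) 4 (s≤s z≤n) (s≤s (s≤s (s≤s (s≤s (s≤s z≤n))))) cycle
    where
    cycle : f (f (f (f p))) ≡ p
    cycle = trans (cong f e) g
    Off : D → Set
    Off z = ¬ isHub W z
    four : ∀ i → Off (iter f i p) × Off (iter f (1 ℕ.+ i) p) × Off (iter f (2 ℕ.+ i) p) × Off (iter f (3 ℕ.+ i) p)
    four zero = hp , sink-¬hub (trans (col-f p) (cong not cp)) , h , subst Off (sym e) (sink-¬hub (trans (col-a q) (cong not cq)))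
    four (suc i) with h₁ , h₂ , h₃ , h₄ ← four i = h₂ , h₃ , h₄ , subst Off (trans (cong (iter f i) (sym cycle)) (shift4 i p)) h₁
      where
      shift4 : ∀ i x → iter f i (f (f (f (f x)))) ≡ f (f (f (f (iter f i x))))
      shift4 i x = trans (sym (iter-+ f i 4 x)) (trans (cong (λ k → iter f k x) (ℕ.+-comm i 4)) (iter-+ f 4 i x))

  dpath-start : ∀ {k x x′ y} → face x ≡ face x′ → DPath W k x y → DPath W k x′ y
  dpath-start e (stay (i , p))    = stay (Fc.orb-trans (Fc.rep⇒orb (sym e)) (i , p))
  dpath-start e (cross (i , p) π) = cross (Fc.orb-trans (Fc.rep⇒orb (sym e)) (i , p)) π

  dpath-++ : ∀ {k l x y z} → DPath W k x y → DPath W l y z → DPath W (k ℕ.+ l) x z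
  dpath-++ (stay s)    π = dpath-start (sym (Fc.orb⇒rep s)) π
  dpath-++ (cross s ρ) π = cross s (dpath-++ ρ π)

  -- The two conclusions stand in one record because one induction proves both: on the total length,
  -- and for bounded length on the area.
  record Digon (x y : D) (γ ω : List D) : Set where
    field
      undirected : ∃ λ k → DPath W k x y × (3 ℕ.* k ℕ.≤ length γ ℕ.+ length ω)
      ray        : Straight ω → 2 ℕ.* length ω ℕ.≤ length γ

  len : ∀ (u : List D) {v} → length (u ++ v) ≡ length u ℕ.+ length v
  len u = L.length-++ u

  flow-splice : ∀ u v ω {p q p′ q′} d → flow₂ (u ++ p ∷ q ∷ v) ω d ℤ.+ (δ p′ d ℤ.+ δ q′ d ℤ.- δ p d ℤ.- δ q d) ≡ flow₂ (u ++ p′ ∷ q′ ∷ v) ω d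
  flow-splice u v ω {p} {q} {p′} {q′} d = trans
    (cong (λ z → z ℤ.+ flow ω d ℤ.+ (δ p′ d ℤ.+ δ q′ d ℤ.- δ p d ℤ.- δ q d)) (flow-++ u (p ∷ q ∷ v) d))
    (trans (alg (flow u d) (δ p d) (δ q d) (flow v d) (flow ω d) (δ p′ d) (δ q′ d))
           (cong (λ z → z ℤ.+ flow ω d) (sym (flow-++ u (p′ ∷ q′ ∷ v) d))))
    where
    alg : ∀ u p q v w p′ q′ → u ℤ.+ (p ℤ.+ (q ℤ.+ v)) ℤ.+ w ℤ.+ (p′ ℤ.+ q′ ℤ.- p ℤ.- q) ≡ u ℤ.+ (p′ ℤ.+ (q′ ℤ.+ v)) ℤ.+ w
    alg = solve-∀

  path-splice : ∀ {x y g P} u v {p q} → IsPath x (u ++ p ∷ q ∷ v) y → (F : Flip g P p q) →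
                IsPath x (u ++ Flip.p′ F ∷ Flip.q′ F ∷ v) y
  path-splice u v pγ F with p₁ , (_ , st , (_ , _ , p₂)) ← path-split u pγ =
    path-++ u p₁ (col-p′ , trans begins st , (col-q′ , sym middle , path-start v (sym ends) p₂))
    where open Flip F

  splice-length : ∀ (u : List D) v {p q p′ q′} → length (u ++ p′ ∷ q′ ∷ v) ≡ length (u ++ p ∷ q ∷ v)
  splice-length u v = trans (len u) (sym (len u))

  Disjoint-sym : ∀ {l l′} → Disjoint l l′ → Disjoint l′ l
  Disjoint-sym dj i j q = dj j i (sym q)

  module Step (r : ℕ) (IH : ∀ {x y} γ ω → IsPath x γ y → IsPath y ω x → length γ ℕ.+ length ω ℕ.< r → Digon x y γ ω)
              {x y : D} (γ ω : List D) (pγ : IsPath x γ y) (pω : IsPath y ω x) (lt : length γ ℕ.+ length ω ℕ.≤ r) where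

    within : ∀ {m} → m ℕ.< length γ ℕ.+ length ω → m ℕ.< r
    within h = ℕ.<-≤-trans h lt

    on-empty : face x ≡ face y → ∃ λ k → DPath W k x y × (3 ℕ.* k ℕ.≤ length γ ℕ.+ length ω)
    on-empty e = 0 , stay (Fc.rep⇒orb e) , z≤n

    clash-γ : Clash γ → Digon x y γ ω
    clash-γ (u , e , v , e′ , z , refl , q) with p₁ , (c , st , p₂) ← path-split u pγ with p₃ , (_ , _ , p₄) ← path-split v p₂ = record
      { undirected = let k , π , h = Digon.undirected ih in k , π , ℕ.≤-trans h (ℕ.<⇒≤ shorter)
      ; ray = λ st → ℕ.≤-trans (Digon.ray ih st) (ℕ.<⇒≤ γ-shorter) }
      where
      γ-shorter : length (u ++ e ∷ z) ℕ.< length (u ++ e ∷ v ++ e′ ∷ z)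
      γ-shorter = subst₂ ℕ._<_ (sym (len u)) (sym (len u)) (ℕ.+-monoʳ-< (length u) (s≤s
        (subst (length z ℕ.<_) (sym (len v)) (ℕ.m≤n+m (suc (length z)) (length v)))))
      shorter : length (u ++ e ∷ z) ℕ.+ length ω ℕ.< length γ ℕ.+ length ω
      shorter = ℕ.+-monoˡ-< (length ω) γ-shorter
      ih : Digon x y (u ++ e ∷ z) ω
      ih = IH _ ω (path-++ u p₁ (c , st , path-start z (sym q) p₄)) pω (within shorter)

    clash-ω : Clash ω → Digon x y γ ω
    clash-ω (u , e , v , e′ , z , refl , q) with p₁ , (c , st , p₂) ← path-split u pω with p₃ , (c′ , st′ , p₄) ← path-split v p₂ = record
      { undirected = let k , π , h = Digon.undirected ih in k , π , ℕ.≤-trans h (ℕ.<⇒≤ shorter)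
      -- A straight line cannot return to a face: its loop, paired with the empty path, would
      -- satisfy 2 · length ≤ 0.
      ; ray = λ str → contradiction (Digon.ray ih-loop (straight-left (v ++ e′ ∷ []) z
          (straight-right (u ++ e ∷ []) _ (subst Straight (trans (sym (L.++-assoc u (e ∷ []) _)) (cong ((u ++ e ∷ []) ++_) (sym (L.++-assoc v (e′ ∷ []) z)))) str))))
          (ℕ.<⇒≱ (subst (0 ℕ.<_) (sym (cong (2 ℕ.*_) loop-length)) (s≤s z≤n))) }
      where
      loop-length : length (v ++ e′ ∷ []) ≡ suc (length v)
      loop-length = trans (len v) (ℕ.+-comm (length v) 1)
      ω-shorter : length (u ++ e ∷ z) ℕ.< length (u ++ e ∷ v ++ e′ ∷ z)
      ω-shorter = subst₂ ℕ._<_ (sym (len u)) (sym (len u)) (ℕ.+-monoʳ-< (length u) (s≤s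
        (subst (length z ℕ.<_) (sym (len v)) (ℕ.m≤n+m (suc (length z)) (length v)))))
      shorter : length γ ℕ.+ length (u ++ e ∷ z) ℕ.< length γ ℕ.+ length ω
      shorter = ℕ.+-monoʳ-< (length γ) ω-shorter
      ih : Digon x y γ (u ++ e ∷ z)
      ih = IH γ _ pγ (path-++ u p₁ (c , st , path-start z (sym q) p₄)) (within shorter)
      loop-shorter : length (v ++ e′ ∷ []) ℕ.< length γ ℕ.+ length ω
      loop-shorter = ℕ.<-≤-trans (subst (ℕ._< length ω) (sym loop-length) (subst (suc (length v) ℕ.<_) (sym (trans (len u) (cong (λ m → length u ℕ.+ suc m) (len v))))
        (ℕ.≤-trans (s≤s (subst (suc (length v) ℕ.≤_) (sym (ℕ.+-suc (length v) (length z))) (s≤s (ℕ.m≤m+n _ _)))) (ℕ.m≤n+m _ (length u))))) (ℕ.m≤n+m (length ω) (length γ))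
      ih-loop : Digon e e [] (v ++ e′ ∷ [])
      ih-loop = IH [] _ refl (path-++ v p₃ (c′ , st′ , sym q)) (within loop-shorter)

    -- A common face cuts the closed walk into two shorter digons, and both conclusions are
    -- additive.
    meeting : (∃ λ e → ∃ λ e′ → (e ∈ γ) × (e′ ∈ ω) × (face e ≡ face e′)) → Digon x y γ ω
    meeting (e , e′ , i , i′ , q) with u , v , refl ← ∈-∃++ i with u′ , v′ , refl ← ∈-∃++ i′
      with p₁ , (c , st , p₂) ← path-split u pγ with q₁ , (c′ , st′ , q₂) ← path-split u′ pω = record
      { undirected = let k , π , h = Digon.undirected ih₁ ; k′ , π′ , h′ = Digon.undirected ih₂ in
          k ℕ.+ k′ , dpath-++ π π′ , subst₂ ℕ._≤_ (sym (ℕ.*-distribˡ-+ 3 k k′)) total (ℕ.+-mono-≤ h h′)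
      ; ray = λ str → subst₂ ℕ._≤_ (sym ω-total) γ-total (ℕ.+-mono-≤
          (Digon.ray ih₂ (straight-left (u′ ++ e′ ∷ []) v′ (subst Straight (sym (L.++-assoc u′ (e′ ∷ []) v′)) str)))
          (Digon.ray ih₁ (straight-right (u′ ++ e′ ∷ []) v′ (subst Straight (sym (L.++-assoc u′ (e′ ∷ []) v′)) str)))) }
      where
      γ₁ = u ++ e ∷ []
      ω₁ = u′ ++ e′ ∷ []
      len₁ : length γ₁ ≡ suc (length u)
      len₁ = trans (len u) (ℕ.+-comm (length u) 1)
      len₂ : length ω₁ ≡ suc (length u′)
      len₂ = trans (len u′) (ℕ.+-comm (length u′) 1)
      alg₁ : ∀ a b c d → (suc a ℕ.+ d) ℕ.+ (b ℕ.+ suc c) ≡ (a ℕ.+ suc b) ℕ.+ (c ℕ.+ suc d)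
      alg₁ = NR.solve-∀
      total : (length γ₁ ℕ.+ length v′) ℕ.+ (length v ℕ.+ length ω₁) ≡ length γ ℕ.+ length ω
      total = trans (cong₂ (λ m k → (m ℕ.+ length v′) ℕ.+ (length v ℕ.+ k)) len₁ len₂)
                (trans (alg₁ (length u) (length v) (length u′) (length v′)) (sym (cong₂ ℕ._+_ (len u) (len u′))))
      γ-total : length v ℕ.+ length γ₁ ≡ length γ
      γ-total = trans (cong (length v ℕ.+_) len₁) (trans (alg₂ (length v) (length u)) (sym (len u)))
        where
        alg₂ : ∀ a b → a ℕ.+ suc b ≡ b ℕ.+ suc a
        alg₂ = NR.solve-∀
      ω-total : 2 ℕ.* length ω ≡ 2 ℕ.* length ω₁ ℕ.+ 2 ℕ.* length v′
      ω-total = trans (cong (2 ℕ.*_) (trans (len u′) (trans (ℕ.+-suc (length u′) (length v′)) (cong (ℕ._+ length v′) (sym len₂))))) (ℕ.*-distribˡ-+ 2 (length ω₁) (length v′))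
      ih₁ : Digon x e γ₁ v′
      ih₁ = IH γ₁ v′ (path-++ u p₁ (c , st , refl)) (path-start v′ (sym q) q₂)
        (within (subst (length γ₁ ℕ.+ length v′ ℕ.<_) total (subst (length γ₁ ℕ.+ length v′ ℕ.<_)
          (cong (λ m → length γ₁ ℕ.+ length v′ ℕ.+ (length v ℕ.+ m)) (sym len₂)) (ℕ.m<m+n _ (subst (0 ℕ.<_) (sym (ℕ.+-suc (length v) (length u′))) (s≤s z≤n))))))
      ih₂ : Digon e y v ω₁
      ih₂ = IH v ω₁ p₂ (path-++ u′ q₁ (c′ , st′ , sym q))
        (within (subst (length v ℕ.+ length ω₁ ℕ.<_) total (subst (λ m → length v ℕ.+ length ω₁ ℕ.< m ℕ.+ length v′ ℕ.+ (length v ℕ.+ length ω₁)) (sym len₁)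
          (ℕ.m<n+m (length v ℕ.+ length ω₁) {suc (length u) ℕ.+ length v′} (s≤s z≤n)))))

    module Turn (sγ : Simple γ) (sω : Simple ω) (dj : Disjoint γ ω) (P : Potential (flow₂ γ ω))
                (again : ∀ γ′ ω′ → IsPath x γ′ y → IsPath y ω′ x → length γ′ ≡ length γ → length ω′ ≡ length ω →
                         (P′ : Potential (flow₂ γ′ ω′)) → area P′ ℤ.< area P → Digon x y γ′ ω′)
                (c : Corner (flow₂ γ ω) P (face x) (face y)) (ω≢[] : ω ≢ []) where
      open Corner c

      in-γ : ∀ u v → γ ≡ u ++ p ∷ q ∷ v → (1ℤ ℤ.≤ flow₂ γ ω t) ⊎ Flip (flow₂ γ ω) P p q → Digon x y γ ω
      in-γ u v eq (inj₁ h) with eγ , eω ← triangle γ ω u v pγ pω sγ sω dj eq (flow-∈₂ γ ω t h) t-end t-start ω≢[]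
        with _ , st , te ← subst (λ l → IsPath y l x) eω pω = record
        { undirected = 1 , cross (Fc.rep⇒orb (sym te)) (stay (Fc.rep⇒orb st)) ,
            subst₂ (λ m k → 3 ℕ.≤ length m ℕ.+ length k) (sym eγ) (sym eω) ℕ.≤-refl
        ; ray = λ _ → subst₂ (λ m k → 2 ℕ.* length k ℕ.≤ length m) (sym eγ) (sym eω) ℕ.≤-refl }
      in-γ u v eq (inj₂ F) = record
        { undirected = let k , π , h = Digon.undirected ih in k , π , subst (λ m → 3 ℕ.* k ℕ.≤ m ℕ.+ length ω) len-eq h
        ; ray = λ st → subst (2 ℕ.* length ω ℕ.≤_) len-eq (Digon.ray ih st) }
        where
        open Flip F
        len-eq : length (u ++ p′ ∷ q′ ∷ v) ≡ length γ
        len-eq = trans (splice-length u v) (cong length (sym eq))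
        ih : Digon x y (u ++ p′ ∷ q′ ∷ v) ω
        ih = again _ ω (path-splice u v (subst (λ l → IsPath x l y) eq pγ) F) pω len-eq refl
          (potential-cong (λ d → trans (cong (λ l → flow₂ l ω d ℤ.+ (δ p′ d ℤ.+ δ q′ d ℤ.- δ p d ℤ.- δ q d)) eq) (flow-splice u v ω d)) P′) smaller

      in-ω : ∀ u v → ω ≡ u ++ p ∷ q ∷ v → (1ℤ ℤ.≤ flow₂ γ ω t) ⊎ Flip (flow₂ γ ω) P p q → Digon x y γ ω
      in-ω u v eq nx = record
        { undirected = short nx
        -- A straight line has no sharp turn, so only the first conclusion has to cope with a corner
        -- on `ω`.
        ; ray = λ str → ⊥-elim (straight-gap col-p col-q (str u p q v eq) gap) }
        where
        swap : (t ∈ γ) ⊎ (t ∈ ω) → (t ∈ ω) ⊎ (t ∈ γ)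
        swap (inj₁ i) = inj₂ i
        swap (inj₂ i) = inj₁ i
        nonempty : ∀ (l : List D) {z} → l ++ z ∷ [] ≢ []
        nonempty [] ()
        nonempty (_ ∷ _) ()
        on-t : (γ ≡ []) ⊎ (∃ λ l → ∃ λ z → γ ≡ l ++ z ∷ []) → 1ℤ ℤ.≤ flow₂ γ ω t →
               ∃ λ k → DPath W k x y × (3 ℕ.* k ℕ.≤ length γ ℕ.+ length ω)
        on-t (inj₁ e) h = on-empty (subst (λ l → IsPath x l y) e pγ)
        on-t (inj₂ (l , z , e)) h
          with eω , eγ ← triangle ω γ u v pω pγ sω sγ (Disjoint-sym dj) eq (swap (flow-∈₂ γ ω t h)) t-end t-start (λ e′ → nonempty l (trans (sym e) e′))
          with _ , st , te ← subst (λ l → IsPath x l y) eγ pγ =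
            1 , cross (Fc.rep⇒orb (sym st)) (stay (Fc.rep⇒orb (trans (cong face (aa t)) te))) ,
            subst₂ (λ m k → 3 ℕ.≤ length m ℕ.+ length k) (sym eγ) (sym eω) ℕ.≤-refl
        short : (1ℤ ℤ.≤ flow₂ γ ω t) ⊎ Flip (flow₂ γ ω) P p q → ∃ λ k → DPath W k x y × (3 ℕ.* k ℕ.≤ length γ ℕ.+ length ω)
        short (inj₁ h) = on-t (snoc? γ) h
        short (inj₂ F) = let k , π , h = Digon.undirected ih in k , π , subst (λ m → 3 ℕ.* k ℕ.≤ length γ ℕ.+ m) len-eq h
          where
          open Flip F
          len-eq : length (u ++ p′ ∷ q′ ∷ v) ≡ length ω
          len-eq = trans (splice-length u v) (cong length (sym eq))
          pω′ : IsPath y (u ++ p ∷ q ∷ v) x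
          pω′ = subst (λ l → IsPath y l x) eq pω
          ih : Digon x y γ (u ++ p′ ∷ q′ ∷ v)
          ih = again γ _ pγ (path-splice u v pω′ F) refl len-eq
            (potential-cong (λ d → trans (cong (λ l → flow₂ γ l d ℤ.+ (δ p′ d ℤ.+ δ q′ d ℤ.- δ p d ℤ.- δ q d)) eq)
              (trans (cong (λ z → z ℤ.+ (δ p′ d ℤ.+ δ q′ d ℤ.- δ p d ℤ.- δ q d)) (ℤ.+-comm (flow γ d) _))
                (trans (flow-splice u v γ d) (ℤ.+-comm (flow (u ++ p′ ∷ q′ ∷ v) d) (flow γ d))))) P′) smaller

      result : Digon x y γ ω
      result = go (flow-∈₂ γ ω q g-q)
        where
        swap : (p ∈ γ) ⊎ (p ∈ ω) → (p ∈ ω) ⊎ (p ∈ γ)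
        swap (inj₁ i) = inj₂ i
        swap (inj₂ i) = inj₁ i
        go : (q ∈ γ) ⊎ (q ∈ ω) → Digon x y γ ω
        go (inj₁ i) with u , v , eq ← consecutive γ ω pγ sγ dj (flow-∈₂ γ ω p g-p) i meet p≢X = in-γ u v eq next
        go (inj₂ i) with u , v , eq ← consecutive ω γ pω sω (Disjoint-sym dj) (swap (flow-∈₂ γ ω p g-p)) i meet p≢Y = in-ω u v eq next

  area≥0 : ∀ {g} (P : Potential g) → 0ℤ ℤ.≤ area P
  area≥0 P = subst (ℤ._≤ area P) (sum-0 {f = λ _ → 0ℤ} λ _ → refl) (sum-mono λ d → ℤ.+≤+ z≤n)

  digon-area : ∀ r → (∀ {x y} γ ω → IsPath x γ y → IsPath y ω x → length γ ℕ.+ length ω ℕ.< r → Digon x y γ ω) →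
               ∀ k {x y} γ ω → IsPath x γ y → IsPath y ω x → length γ ℕ.+ length ω ℕ.≤ r →
               (P : Potential (flow₂ γ ω)) → area P ℤ.< + k → Digon x y γ ω
  digon-area r IH k γ [] pγ pω lt P ar = record
    { undirected = 0 , stay (Fc.rep⇒orb (sym pω)) , z≤n ; ray = λ _ → z≤n }
  digon-area r IH zero γ (e ∷ ω) pγ pω lt P ar = contradiction ar (ℤ.≤⇒≯ (area≥0 P))
  digon-area r IH (suc k) {x} {y} γ (e ∷ ω) pγ pω lt P ar with clash? γ | clash? (e ∷ ω) | common? γ (e ∷ ω)
  ... | inj₁ c  | _       | _       = Step.clash-γ r IH γ (e ∷ ω) pγ pω lt c
  ... | inj₂ _  | inj₁ c  | _       = Step.clash-ω r IH γ (e ∷ ω) pγ pω lt c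
  ... | inj₂ _  | inj₂ _  | inj₁ c  = Step.meeting r IH γ (e ∷ ω) pγ pω lt c
  ... | inj₂ sγ | inj₂ sω | inj₂ dj = Step.Turn.result r IH γ (e ∷ ω) pγ pω lt sγ sω dj P
        (λ γ′ ω′ pγ′ pω′ eγ eω P′ ar′ → digon-area r IH k γ′ ω′ pγ′ pω′ (subst₂ (λ m l → m ℕ.+ l ℕ.≤ r) (sym eγ) (sym eω) lt) P′
          (ℤ.<-≤-trans ar′ (ℤ.i<j⇒i≤pred[j] ar)))
        (corner P (λ d cd → ℤ.+-mono-≤ (flow-≥0 γ pγ d cd) (flow-≥0 (e ∷ ω) pω d cd)) (face x) (face y) {e}
          (ℤ.+-mono-≤ (flow-≥0 γ pγ e (proj₁ pω)) (flow-head e ω pω)))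
        (λ ())

  digon : ∀ r {x y} γ ω → IsPath x γ y → IsPath y ω x → length γ ℕ.+ length ω ℕ.< r → Digon x y γ ω
  digon (suc r) γ ω pγ pω (s≤s lt) = digon-area r (digon r) (suc ℤ.∣ area P ∣) γ ω pγ pω lt P
    (subst (ℤ._< + suc ℤ.∣ area P ∣) (ℤ.0≤i⇒+∣i∣≡i (area≥0 P)) (ℤ.+<+ ℕ.≤-refl))
    where
    P = closed-potential γ ω pγ pω

-- Alternating strips and the lines that bound them

∷ʳ-split : ∀ {X : Set} (k₁ k₂ : List X) {l z} → k₁ ++ k₂ ≡ l ++ z ∷ [] →
           (k₂ ≡ [] × k₁ ≡ l ++ z ∷ []) ⊎ (∃ λ k → k₂ ≡ k ++ z ∷ [] × l ≡ k₁ ++ k)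
∷ʳ-split k₁ k₂ {l} {z} e with snoc? k₂
... | inj₁ refl = inj₁ (refl , trans (sym (L.++-identityʳ k₁)) e)
... | inj₂ (k , z′ , refl) with p , refl ← L.∷ʳ-injective (k₁ ++ k) l (trans (L.++-assoc k₁ k (z′ ∷ [])) e) = inj₂ (k , refl , sym p)

module Strips {n′ : ℕ} (W : Web (suc n′)) where
  open Map W
  open Paths W
  open Digons W

  sink : ∀ {e} → col e ≡ true → col (a e) ≡ false
  sink {e} c = trans (col-a e) (cong not c)

  col-as : ∀ {d} → col d ≡ false → col (a (s d)) ≡ true
  col-as {d} c = trans (col-a (s d)) (cong not (trans (col-s d) c))

  col-as² : ∀ {d} → col d ≡ false → col (a (s (s d))) ≡ true
  col-as² {d} c = col-as (trans (col-s d) c)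

  -- A step against the orientation is replaced by two steps around the triangle at the sink.
  back : ∀ {x} l {y} → IsPath x l y → ∃ λ l′ → IsPath y l′ x × (length l′ ≡ 2 ℕ.* length l)
  back []      p = [] , sym p , refl
  back (e ∷ l) (c , st , p) with l′ , p′ , k ← back l p =
    l′ ++ a (s (a e)) ∷ a (s (s (a e))) ∷ [] ,
    path-++ l′ p′ (col-as (sink c) , trans (cong face (aa (s (a e)))) (trans (face-s (a e)) (cong face (aa e))) ,
      (col-as² (sink c) , trans (cong face (aa _)) (sym (face-as (a e))) , trans (face-as² (sink-¬hub (sink c))) st)) ,
    trans (len l′) (trans (cong (ℕ._+ 2) k) (trans (ℕ.+-comm _ 2) (sym (ℕ.*-suc 2 (length l)))))

  Directed : D → D → ℕ → Set
  Directed x y m = ∃ λ γ → ∃ λ ω → IsPath x γ y × IsPath y ω x × (length γ ℕ.+ length ω ≡ m)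

  directed-cross : ∀ {x y k} z → face x ≡ face z → Directed (a z) y (3 ℕ.* k) → Directed x y (3 ℕ.* suc k)
  directed-cross {x} {y} {k} z o (γ , ω , pγ , pω , total) = go (col z) refl
    where
    one : ∀ e → col e ≡ true → IsPath (a e) (e ∷ []) e
    one e c = c , refl , refl
    three : ∀ {m} → m ≡ length γ ℕ.+ length ω ℕ.+ 3 → m ≡ 3 ℕ.* suc k
    three e = trans e (trans (cong (ℕ._+ 3) total) (trans (ℕ.+-comm (3 ℕ.* k) 3) (sym (ℕ.*-suc 3 k))))
    against : ∀ b → col z ≡ true → IsPath z b (a z) → length b ≡ 2 → Directed x y (3 ℕ.* suc k)
    against b c pb kb = b ++ γ , ω ++ z ∷ [] , path-start (b ++ γ) (sym o) (path-++ b pb pγ) , path-++ ω pω (c , refl , sym o) ,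
      three (trans (cong₂ ℕ._+_ (trans (len b) (cong (ℕ._+ length γ) kb)) (len ω)) (alg (length γ) (length ω)))
      where
      alg : ∀ x y → (2 ℕ.+ x) ℕ.+ (y ℕ.+ 1) ≡ x ℕ.+ y ℕ.+ 3
      alg = NR.solve-∀
    along : ∀ b → col (a z) ≡ true → IsPath (a z) b (a (a z)) → length b ≡ 2 → Directed x y (3 ℕ.* suc k)
    along b c pb kb = a z ∷ γ , ω ++ b , (c , trans (cong face (aa z)) (sym o) , pγ) ,
      path-++ ω pω (path-end b (trans (cong face (aa z)) (sym o)) pb) ,
      three (trans (cong (suc (length γ) ℕ.+_) (trans (len ω) (cong (length ω ℕ.+_) kb))) (alg (length γ) (length ω)))
      where
      alg : ∀ x y → suc x ℕ.+ (y ℕ.+ 2) ≡ x ℕ.+ y ℕ.+ 3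
      alg = NR.solve-∀
    go : ∀ b → col z ≡ b → Directed x y (3 ℕ.* suc k)
    go true c = let b , pb , kb = back (z ∷ []) (one z c) in against b c pb kb
    go false c = let c′ = trans (col-a z) (cong not c) ; b , pb , kb = back (a z ∷ []) (one (a z) c′) in along b c′ pb kb

  -- Each crossing costs one step in one direction and two in the other, hence 3 for the way there
  -- and back. This is the bound opposite to `Digon.undirected`.
  directed : ∀ {k x y} → DPath W k x y → Directed x y (3 ℕ.* k)
  directed (stay o)             = [] , [] , Fc.orb⇒rep o , sym (Fc.orb⇒rep o) , refl
  directed {suc k} (cross {z = z} o π) = directed-cross {k = k} z (Fc.orb⇒rep o) (directed π)

  straight-bound : ∀ {x y} ω π → Straight ω → IsPath y ω x → IsPath x π y → 2 ℕ.* length ω ℕ.≤ length π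
  straight-bound ω π st pω pπ = Digon.ray (digon _ π ω pπ pω ℕ.≤-refl) st

  half : ∀ {m k} → 2 ℕ.* m ℕ.≤ suc (2 ℕ.* k) → m ℕ.≤ k
  half {m} {k} h = ℕ.≤-pred (ℕ.*-cancelˡ-< 2 m (suc k) (ℕ.≤-trans (s≤s h) (ℕ.≤-reflexive (sym (ℕ.*-suc 2 k)))))

  straight-snoc : ∀ l {p q} → Straight (l ++ p ∷ []) → Str p q → Straight ((l ++ p ∷ []) ++ q ∷ [])
  straight-snoc l {p} {q} st pq u p′ q′ v e with snoc? v
  ... | inj₁ refl with e₁ , refl ← L.∷ʳ-injective (l ++ p ∷ []) (u ++ p′ ∷ []) (trans e (sym (L.++-assoc u (p′ ∷ []) (q′ ∷ []))))
                  with _ , refl ← L.∷ʳ-injective l u e₁ = pq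
  straight-snoc l {p} {q} st pq u p′ q′ v e | inj₂ (v′ , z , refl)
    with e₁ , refl ← L.∷ʳ-injective (l ++ p ∷ []) (u ++ p′ ∷ q′ ∷ v′) (trans e (sym (L.++-assoc u (p′ ∷ q′ ∷ v′) (z ∷ [])))) = st u p′ q′ v′ e₁

  straight-one : ∀ p → Straight (p ∷ [])
  straight-one p []          _ _ _ ()
  straight-one p (_ ∷ [])    _ _ _ ()
  straight-one p (_ ∷ _ ∷ _) _ _ _ ()

  straight-cons : ∀ {p q l} → Str p q → Straight (q ∷ l) → Straight (p ∷ q ∷ l)
  straight-cons pq st []      _ _ _ refl = pq
  straight-cons pq st (c ∷ u) _ _ _ e    = st u _ _ _ (L.∷-injectiveʳ e)

  -- The strip of triangles through the rung e₀ that turns alternately, up to the hub dart h at its far end.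
  -- It is bounded by the lines L and K, and its rungs join the i-th faces of the two lines.
  record StripP (h e₀ : D) : Set where
    field
      L K     : List D
      L-path  : IsPath h L (a e₀)
      K-path  : IsPath (a h) K e₀
      L-end   : ∃ λ l → L ≡ l ++ a (s (s (a e₀))) ∷ []
      L-str   : Straight L
      rungs   : ∀ k₁ k₂ → K ≡ k₁ ++ k₂ → ∃ λ l₁ → ∃ λ l₂ → (L ≡ l₁ ++ l₂) × (length l₂ ≡ suc (length k₂)) ×
                ∃ λ e → (col e ≡ true) × (face (a e) ≡ face (endOf (a h) k₁)) × (face e ≡ face (endOf h l₁))

  module _ {e₀ : D} (c₀ : col e₀ ≡ true) where
    private
      e : D
      e = a (s (a e₀))
      ℓ : D
      ℓ = a (s (s (a e₀)))
      sk : col (a e₀) ≡ false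
      sk = sink c₀
      sk-int : ¬ isHub W (a e₀)
      sk-int = sink-¬hub sk
      e-start : face (a e) ≡ face e₀
      e-start = trans (cong face (aa _)) (trans (face-s (a e₀)) (cong face (aa e₀)))
      ℓ-start : face (a ℓ) ≡ face e
      ℓ-start = trans (cong face (aa _)) (sym (face-as (a e₀)))
      ℓ-end : face ℓ ≡ face (a e₀)
      ℓ-end = face-as² sk-int

    stripP-stop : StripP e e₀
    stripP-stop = record
      { L = ℓ ∷ [] ; K = [] ; L-path = col-as² sk , ℓ-start , ℓ-end ; K-path = e-start
      ; L-end = [] , refl ; L-str = straight-one ℓ ; rungs = rungs }
      where
      rungs : ∀ k₁ k₂ → [] ≡ k₁ ++ k₂ → ∃ λ l₁ → ∃ λ l₂ → (ℓ ∷ [] ≡ l₁ ++ l₂) × (length l₂ ≡ suc (length k₂)) ×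
              ∃ λ z → (col z ≡ true) × (face (a z) ≡ face (endOf (a e) k₁)) × (face z ≡ face (endOf e l₁))
      rungs [] [] refl = [] , ℓ ∷ [] , refl , refl , e , col-as sk , refl , refl

    -- Two triangles are added at the end next to `e₀`: the one at the sink `a e₀` gives `ℓ` to `L`,
    -- the one at the source `e` gives `s e` to `K`. At an inner face of `L` the strip therefore has
    -- a sink, a source and a sink: the three triangles of `Str`.
    stripP-step : ∀ {h} → ¬ isHub W e → StripP h (s (s e)) → StripP h e₀
    stripP-step {h} int S = record
      { L = L ++ ℓ ∷ [] ; K = K ++ s e ∷ []
      ; L-path = path-++ L L-path (col-as² sk , trans ℓ-start (sym (face-as² int)) , ℓ-end)
      ; K-path = path-++ K K-path (trans (col-s e) (col-as sk) , face-as e , trans (face-s e) e-start)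
      ; L-end = L , refl
      ; L-str = subst (λ l → Straight (l ++ ℓ ∷ [])) (sym (proj₂ L-end))
          (straight-snoc (proj₁ L-end) (subst Straight (proj₂ L-end) L-str) str)
      ; rungs = rungs′ }
      where
      open StripP S
      e₁ : D
      e₁ = s (s e)
      str : Str (a (s (s (a e₁)))) ℓ
      str = trans (cong (f ∘ f) first) (trans (cong f second) (trans (cong s (aa _)) (sym (aa _)))) ,
            subst (λ z → ¬ isHub W z) (sym (trans (cong f first) second)) int
        where
        first : f (a (s (s (a e₁)))) ≡ a e₁
        first = trans (f-a (s (s (a e₁)))) (s³ (sink-¬hub (sink (trans (col-s _) (trans (col-s e) (col-as sk))))))
        second : f (a e₁) ≡ e
        second = trans (f-a e₁) (s³ int)
      rungs′ : ∀ k₁ k₂ → K ++ s e ∷ [] ≡ k₁ ++ k₂ → ∃ λ l₁ → ∃ λ l₂ → (L ++ ℓ ∷ [] ≡ l₁ ++ l₂) × (length l₂ ≡ suc (length k₂)) ×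
               ∃ λ z → (col z ≡ true) × (face (a z) ≡ face (endOf (a h) k₁)) × (face z ≡ face (endOf h l₁))
      rungs′ k₁ k₂ eq with ∷ʳ-split k₁ k₂ (sym eq)
      ... | inj₁ (refl , refl) = L , ℓ ∷ [] , refl , refl , e , col-as sk ,
              trans e-start (sym (trans (cong face (endOf-snoc (a h) K)) (trans (face-s e) e-start))) ,
              sym (trans (path-endOf L L-path) (face-as² int))
      ... | inj₂ (k , refl , eK) with l₁ , l₂ , eL , n , z , cz , st , en ← rungs k₁ k eK =
              l₁ , l₂ ++ ℓ ∷ [] , trans (cong (_++ ℓ ∷ []) eL) (L.++-assoc l₁ l₂ _) ,
              trans (len l₂) (trans (ℕ.+-comm _ 1) (cong suc (trans n (sym (trans (len k) (ℕ.+-comm _ 1)))))) ,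
              z , cz , st , en

  module _ {h e₀ : D} (S : StripP h e₀) (c₀ : col e₀ ≡ true) where
    open StripP S

    -- The rung `e₀` followed by the reversal of `π` leads back along `L` in 1 + 2 · length π steps.
    -- Against a straight line this is at least twice the rest of `L`, and by parity the extra 1 is
    -- lost.
    stripP-L : ∀ l₁ l₂ → L ≡ l₁ ++ l₂ → ∀ π → IsPath (endOf h l₁) π e₀ → length l₂ ℕ.≤ length π
    stripP-L l₁ l₂ refl π p with b , pb , kb ← back π p = half (subst (λ m → 2 ℕ.* length l₂ ℕ.≤ suc m) kb
      (straight-bound l₂ (e₀ ∷ b) (straight-right l₁ l₂ L-str) (proj₂ (path-split l₁ L-path)) (c₀ , refl , pb)))

    stripP-K : ∀ k₁ k₂ → K ≡ k₁ ++ k₂ → ∀ π → IsPath (endOf (a h) k₁) π (a e₀) → suc (length k₂) ℕ.≤ length π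
    stripP-K k₁ k₂ eq π p with l₁ , l₂ , refl , n , z , cz , st , en ← rungs k₁ k₂ eq with b , pb , kb ← back π p =
      subst (ℕ._≤ length π) n (half (subst (2 ℕ.* length l₂ ℕ.≤_) (trans (len b) (trans (ℕ.+-comm _ 1) (cong suc kb)))
        (straight-bound l₂ (b ++ z ∷ []) (straight-right l₁ l₂ L-str) (proj₂ (path-split l₁ L-path)) (path-++ b pb (cz , st , en)))))

  -- The strip with the opposite alternation of turns. Its lines run away from the rung `e₀` instead
  -- of towards it, and the straight one starts at the face of `e₀`.
  record StripQ (h e₀ : D) : Set where
    field
      L K     : List D
      L-path  : IsPath e₀ L (a h)
      K-path  : IsPath (a e₀) K h
      L-start : ∃ λ l → L ≡ a (s (a e₀)) ∷ l
      L-str   : Straight L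
      rungs   : ∀ k₁ k₂ → K ≡ k₁ ++ k₂ → ∃ λ l₁ → ∃ λ l₂ → (L ≡ l₁ ++ l₂) × (length l₁ ≡ suc (length k₁)) ×
                ∃ λ e → (col e ≡ true) × (face (a e) ≡ face (endOf e₀ l₁)) × (face e ≡ face (endOf (a e₀) k₁))

  module _ {e₀ : D} (c₀ : col e₀ ≡ true) where
    private
      e : D
      e = a (s (s (a e₀)))
      ℓ : D
      ℓ = a (s (a e₀))
      sk : col (a e₀) ≡ false
      sk = sink c₀
      sk-int : ¬ isHub W (a e₀)
      sk-int = sink-¬hub sk
      ℓ-start : face (a ℓ) ≡ face e₀
      ℓ-start = trans (cong face (aa _)) (trans (face-s (a e₀)) (cong face (aa e₀)))
      ℓ-end : face ℓ ≡ face (a e)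
      ℓ-end = trans (face-as (a e₀)) (cong face (sym (aa _)))
      e-end : face e ≡ face (a e₀)
      e-end = face-as² sk-int

    stripQ-stop : StripQ e e₀
    stripQ-stop = record
      { L = ℓ ∷ [] ; K = [] ; L-path = col-as sk , ℓ-start , ℓ-end ; K-path = sym e-end
      ; L-start = [] , refl ; L-str = straight-one ℓ ; rungs = rungs }
      where
      rungs : ∀ k₁ k₂ → [] ≡ k₁ ++ k₂ → ∃ λ l₁ → ∃ λ l₂ → (ℓ ∷ [] ≡ l₁ ++ l₂) × (length l₁ ≡ suc (length k₁)) ×
              ∃ λ z → (col z ≡ true) × (face (a z) ≡ face (endOf e₀ l₁)) × (face z ≡ face (endOf (a e₀) k₁))
      rungs [] [] refl = ℓ ∷ [] , [] , refl , refl , e , col-as² sk , sym ℓ-end , e-end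

    stripQ-step : ∀ {h} → ¬ isHub W e → StripQ h (s e) → StripQ h e₀
    stripQ-step {h} int S = record
      { L = ℓ ∷ L ; K = s (s e) ∷ K
      ; L-path = col-as sk , ℓ-start , path-start L (trans (face-s e) (sym ℓ-end)) L-path
      ; K-path = trans (col-s _) (trans (col-s e) (col-as² sk)) , trans (face-as² int) e-end , path-start K (face-as e) K-path
      ; L-start = L , refl
      ; L-str = subst (λ l → Straight (ℓ ∷ l)) (sym (proj₂ L-start)) (straight-cons str (subst Straight (proj₂ L-start) L-str))
      ; rungs = rungs′ }
      where
      open StripQ S
      e₁ : D
      e₁ = s e
      str : Str ℓ (a (s (a e₁)))
      str = trans (cong f both) (sym (aa _)) , subst (λ z → ¬ isHub W z) (sym both) (s-¬hub int)
        where
        both : f (f ℓ) ≡ e₁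
        both = trans (cong f (trans (f-a (s (a e₀))) (sym (aa _)))) (f-a e)
      rungs′ : ∀ k₁ k₂ → s (s e) ∷ K ≡ k₁ ++ k₂ → ∃ λ l₁ → ∃ λ l₂ → (ℓ ∷ L ≡ l₁ ++ l₂) × (length l₁ ≡ suc (length k₁)) ×
               ∃ λ z → (col z ≡ true) × (face (a z) ≡ face (endOf e₀ l₁)) × (face z ≡ face (endOf (a e₀) k₁))
      rungs′ [] k₂ eq = ℓ ∷ [] , L , refl , refl , e , col-as² sk , sym ℓ-end , e-end
      rungs′ (_ ∷ k₁) k₂ eq with refl , eK ← L.∷-injective eq with rungs k₁ k₂ eK
      ... | [] , l₂ , eL , () , _
      ... | m ∷ l₁ , l₂ , eL , n , z , cz , st , en =
              ℓ ∷ m ∷ l₁ , l₂ , cong (ℓ ∷_) eL , cong suc n , z , cz , st , trans en (endOf-face k₁)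
        where
        endOf-face : ∀ k → face (endOf (a e₁) k) ≡ face (endOf (s (s e)) k)
        endOf-face []      = face-as e
        endOf-face (_ ∷ _) = refl

  module _ {h e₀ : D} (S : StripQ h e₀) (c₀ : col e₀ ≡ true) where
    open StripQ S

    stripQ-L : ∀ l₁ l₂ → L ≡ l₁ ++ l₂ → ∀ π → IsPath (a e₀) π (endOf e₀ l₁) → length l₁ ℕ.≤ length π
    stripQ-L l₁ l₂ refl π p with b , pb , kb ← back π p = half (subst (2 ℕ.* length l₁ ℕ.≤_) (trans (len b) (trans (ℕ.+-comm _ 1) (cong suc kb)))
      (straight-bound l₁ (b ++ e₀ ∷ []) (straight-left l₁ l₂ L-str) (proj₁ (path-split l₁ L-path)) (path-++ b pb (c₀ , refl , refl))))

    stripQ-K : ∀ k₁ k₂ → K ≡ k₁ ++ k₂ → ∀ π → IsPath e₀ π (endOf (a e₀) k₁) → suc (length k₁) ℕ.≤ length π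
    stripQ-K k₁ k₂ eq π p with l₁ , l₂ , refl , n , z , cz , st , en ← rungs k₁ k₂ eq with b , pb , kb ← back π p =
      subst (ℕ._≤ length π) n (half (subst (λ m → 2 ℕ.* length l₁ ℕ.≤ suc m) kb
        (straight-bound l₁ (z ∷ b) (straight-left l₁ l₂ L-str) (proj₁ (path-split l₁ L-path)) (cz , st , path-start b (sym en) pb))))

  -- A strip entered at the boundary leaves at the boundary, since its rungs run through an orbit of a permutation.
  stripP : ∀ {e₀} → isHub W e₀ → ∃ λ h → isHub W h × StripP h e₀
  stripP {e₀} hub₀ with suc k , _ , _ , per ← Orbits.period (λ e → s⁻ (a (s (a e)))) (λ e → a (s⁻ (a (s e))))
      (λ e → trans (cong (λ z → s⁻ (a (s z))) (aa _)) (trans (cong (λ z → s⁻ (a z)) (s-s⁻ _)) (trans (cong s⁻ (aa _)) (s⁻-s e))))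
      (λ e → trans (cong (λ z → a (s⁻ (a z))) (s-s⁻ _)) (trans (cong (λ z → a (s⁻ z)) (aa _)) (trans (cong a (s⁻-s _)) (aa e)))) e₀ =
    goP k (col-isHub hub₀) (subst (isHub W) (sym per) hub₀)
    where
    τ : D → D
    -- With `s⁻` in place of `s ∘ s` this is a permutation also at the hub; off the hub the two
    -- agree, so `τ` leads from rung to rung.
    τ e = s⁻ (a (s (a e)))
    extend : ∀ {e} → col e ≡ true → Dec (isHub W (a (s (a e)))) →
             (¬ isHub W (a (s (a e))) → ∃ λ h → isHub W h × StripP h (s (s (a (s (a e)))))) → ∃ λ h → isHub W h × StripP h e
    extend c (yes h)  _    = _ , h , stripP-stop c
    extend c (no nh) rest = let h , hh , S = rest nh in h , hh , stripP-step c nh S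
    goP : ∀ k {e} → col e ≡ true → isHub W (iter τ (suc k) e) → ∃ λ h → isHub W h × StripP h e
    goP zero    {e} c hk = extend c (hub? (a (s (a e)))) λ nh → contradiction (subst (isHub W) (s⁻-int nh) hk) (s-¬hub (s-¬hub nh))
    goP (suc k) {e} c hk = extend c (hub? (a (s (a e)))) λ nh → goP k {s (s (a (s (a e))))}
      (trans (col-s _) (trans (col-s _) (col-as (sink c))))
      (subst (isHub W) (trans (sym (iter-shift τ (suc k) e)) (cong (iter τ (suc k)) (s⁻-int nh))) hk)

  stripQ : ∀ {e₀} → isHub W e₀ → ∃ λ h → isHub W h × StripQ h e₀
  stripQ {e₀} hub₀ with suc k , _ , _ , per ← Orbits.period (λ e → s (a (s⁻ (a e)))) (λ e → a (s (a (s⁻ e))))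
      (λ e → trans (cong (λ z → s (a (s⁻ z))) (aa _)) (trans (cong (λ z → s (a z)) (s⁻-s _)) (trans (cong s (aa _)) (s-s⁻ e))))
      (λ e → trans (cong (λ z → a (s (a z))) (s⁻-s _)) (trans (cong (λ z → a (s z)) (aa _)) (trans (cong a (s-s⁻ _)) (aa e)))) e₀ =
    goQ k (col-isHub hub₀) (subst (isHub W) (sym per) hub₀)
    where
    τ : D → D
    τ e = s (a (s⁻ (a e)))
    τ-sink : ∀ {e} → col e ≡ true → τ e ≡ s (a (s (s (a e))))
    τ-sink c = cong (λ z → s (a z)) (s⁻-int (sink-¬hub (sink c)))
    extend : ∀ {e} → col e ≡ true → Dec (isHub W (a (s (s (a e))))) →
             (¬ isHub W (a (s (s (a e)))) → ∃ λ h → isHub W h × StripQ h (s (a (s (s (a e)))))) → ∃ λ h → isHub W h × StripQ h e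
    extend c (yes h)  _    = _ , h , stripQ-stop c
    extend c (no nh) rest = let h , hh , S = rest nh in h , hh , stripQ-step c nh S
    goQ : ∀ k {e} → col e ≡ true → isHub W (iter τ (suc k) e) → ∃ λ h → isHub W h × StripQ h e
    goQ zero    {e} c hk = extend c (hub? (a (s (s (a e))))) λ nh → contradiction (subst (isHub W) (τ-sink c) hk) (s-¬hub nh)
    goQ (suc k) {e} c hk = extend c (hub? (a (s (s (a e))))) λ nh → goQ k {s (a (s (s (a e))))}
      (trans (col-s _) (col-as² (sink c)))
      (subst (isHub W) (trans (sym (iter-shift τ (suc k) e)) (cong (iter τ (suc k)) (τ-sink c))) hk)

-- A discrete Jordan curve theorem for boundary faces

module Crossing {n′ : ℕ} (W : Web (suc n′)) where
  open Map W
  open Homology W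
  open Corners W
  open Paths W
  open Digons W

  hb-col : ∀ k → col (hb k) ≡ true
  hb-col k = col-isHub (hb-isHub k)

  hb-face : ∀ k → face (a (hb (suc k))) ≡ face (hb k)
  hb-face k = trans (sym (face-s _)) (cong face (s-hb k))

  arc : ℕ → ℕ → List D
  arc b zero    = []
  arc b (suc ℓ) = hb (suc b) ∷ arc (suc b) ℓ

  arc-path : ∀ b ℓ → IsPath (hb b) (arc b ℓ) (hb (ℓ ℕ.+ b))
  arc-path b zero    = refl
  arc-path b (suc ℓ) = hb-col (suc b) , hb-face b ,
    subst (λ k → IsPath (hb (suc b)) (arc (suc b) ℓ) (hb k)) (ℕ.+-suc ℓ b) (arc-path (suc b) ℓ)

  arc-hub : ∀ b ℓ {e} → e ∈ arc b ℓ → isHub W e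
  arc-hub b (suc ℓ) (here refl) = hb-isHub (suc b)
  arc-hub b (suc ℓ) (there i)   = arc-hub (suc b) ℓ i

  hb-unshift : ∀ b x y → hb (x ℕ.+ b) ≡ hb (y ℕ.+ b) → hb x ≡ hb y
  hb-unshift zero    x y e = subst₂ (λ x y → hb x ≡ hb y) (ℕ.+-identityʳ x) (ℕ.+-identityʳ y) e
  hb-unshift (suc b) x y e = hb-unshift b x y (trans (sym (s-hb (x ℕ.+ b))) (trans
    (cong s (subst₂ (λ x y → hb x ≡ hb y) (ℕ.+-suc x b) (ℕ.+-suc y b) e)) (s-hb (y ℕ.+ b))))

  hb-apart : ∀ b i → suc i ℕ.< N₀ → hb (suc (suc i) ℕ.+ b) ≢ hb (suc b)
  hb-apart b i i< e = hb-suc≢0 i i< (trans (sym (s-hb (suc i))) (trans (cong s (hb-unshift b (suc (suc i)) 1 e)) (s-hb 0)))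

  δ-hb : ∀ k l → δ (hb k) (hb l) ≡ # (hb l == hb k)
  δ-hb k l = δ-source (hb-col k) (hb-col l)

  arc-out : ∀ b ℓ i → ℓ ℕ.< i → i ℕ.≤ N₀ → flow (arc b ℓ) (hb (i ℕ.+ b)) ≡ 0ℤ
  arc-out b zero    i             _       _  = refl
  arc-out b (suc ℓ) (suc (suc i)) (s≤s p) i≤ = cong₂ ℤ._+_
    (trans (δ-hb _ _) (cong # (≢-== (hb-apart b i i≤))))
    (trans (cong (λ k → flow (arc (suc b) ℓ) (hb k)) (sym (ℕ.+-suc (suc i) b))) (arc-out (suc b) ℓ (suc i) p (ℕ.<⇒≤ i≤)))
  arc-out b (suc ℓ) (suc zero) (s≤s ()) _

  arc-in : ∀ b ℓ i → 1 ℕ.≤ i → i ℕ.≤ ℓ → ℓ ℕ.≤ N₀ → flow (arc b ℓ) (hb (i ℕ.+ b)) ≡ 1ℤ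
  arc-in b (suc ℓ) (suc zero)    _ _       ℓ≤ = cong₂ ℤ._+_
    (trans (δ-hb _ _) (cong # (≡-== {x = hb (suc b)} refl)))
    -- Relative to the base `suc b` this dart has index `N₀`, beyond the end of the shorter arc, so
    -- `arc-out` applies.
    (trans (cong (flow (arc (suc b) ℓ)) (trans (sym (hb-N (suc b))) (cong hb (ℕ.+-comm (suc b) N₀)))) (arc-out (suc b) ℓ N₀ ℓ≤ ℕ.≤-refl))
  arc-in b (suc ℓ) (suc (suc i)) _ (s≤s p) ℓ≤ = cong₂ ℤ._+_
    (trans (δ-hb _ _) (cong # (≢-== (hb-apart b i (ℕ.≤-trans (s≤s p) ℓ≤)))))
    (trans (cong (λ k → flow (arc (suc b) ℓ) (hb k)) (sym (ℕ.+-suc (suc i) b))) (arc-in (suc b) ℓ (suc i) (s≤s z≤n) p (ℕ.<⇒≤ ℓ≤)))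

  hb-near : ∀ b j → 1 ℕ.≤ j → j ℕ.≤ N₀ → ∃ λ i → (1 ℕ.≤ i) × (i ℕ.≤ N₀) × (hb (i ℕ.+ b) ≡ hb j)
  hb-near zero    j j≥ j≤ = j , j≥ , j≤ , cong hb (ℕ.+-identityʳ j)
  hb-near (suc b) j j≥ j≤ = shift (hb-near b j j≥ j≤)
    where
    shift : (∃ λ i → (1 ℕ.≤ i) × (i ℕ.≤ N₀) × (hb (i ℕ.+ b) ≡ hb j)) → ∃ λ i → (1 ℕ.≤ i) × (i ℕ.≤ N₀) × (hb (i ℕ.+ suc b) ≡ hb j)
    shift (suc zero    , _ , _  , e) = N₀ , s≤s z≤n , ℕ.≤-refl , trans (cong hb (ℕ.+-comm N₀ (suc b))) (trans (hb-N (suc b)) e)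
    shift (suc (suc i) , _ , i≤ , e) = suc i , s≤s z≤n , ℕ.<⇒≤ i≤ , trans (cong hb (ℕ.+-suc (suc i) b)) e

  hub-near : ∀ b {d} → isHub W d → ∃ λ i → (1 ℕ.≤ i) × (i ℕ.≤ N₀) × (d ≡ hb (i ℕ.+ b))
  hub-near b {d} h =
    let k , e = isHub⇒hub d h
        i , i≥ , i≤ , e′ = hb-near b (suc (toℕ k)) (s≤s z≤n) (F.toℕ<n k)
    in i , i≥ , i≤ , trans e (trans (hub-index k) (sym e′))

  Meet : D → List D → D → List D → Set
  Meet x γ y ω = ∃ λ γ₁ → ∃ λ γ₂ → ∃ λ ω₁ → ∃ λ ω₂ → (γ ≡ γ₁ ++ γ₂) × (ω ≡ ω₁ ++ ω₂) × (face (endOf x γ₁) ≡ face (endOf y ω₁))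

  visit : ∀ {x} l {z} → z ∈ x ∷ l → ∃ λ l₁ → ∃ λ l₂ → (l ≡ l₁ ++ l₂) × (z ≡ endOf x l₁)
  visit l       (here refl) = [] , l , refl , refl
  visit (e ∷ l) (there i) with l₁ , l₂ , refl , p ← visit l i = e ∷ l₁ , l₂ , refl , p

  end-visited : ∀ x l → endOf x l ∈ x ∷ l
  end-visited x []      = here refl
  end-visited x (e ∷ l) = there (end-visited e l)

  flow-0 : ∀ l d → ¬ (d ∈ l) → ¬ (a d ∈ l) → flow l d ≡ 0ℤ
  flow-0 []      d _ _ = refl
  flow-0 (e ∷ l) d p q = cong₂ ℤ._+_
    (cong₂ (λ x y → # x ℤ.- # y) (≢-== λ r → p (here r)) (≢-== λ r → q (here (trans (cong a r) (aa e)))))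
    (flow-0 l d (p ∘ there) (q ∘ there))

  source-visited : ∀ {x} l {y e} → IsPath x l y → e ∈ l → ∃ λ z → (z ∈ x ∷ l) × (face z ≡ face (a e))
  source-visited {x} (_ ∷ l) (_ , st , p) (here refl) = x , here refl , sym st
  source-visited     (_ ∷ l) (_ , _ , p)  (there i) with z , j , q ← source-visited l p i = z , there j , q

  -- Two paths in the dual whose ends separate each other on the boundary have a face in common.
  module Interleave (b ℓ : ℕ) (ℓ≤N : ℓ ℕ.≤ N₀) (ω : List D) (pω : IsPath (hb (ℓ ℕ.+ b)) ω (hb b)) where

    Seen : List D
    Seen = hb (ℓ ℕ.+ b) ∷ ω

    Unseen : D → Set
    Unseen d = ∀ e → e ∈ Seen → face d ≢ face e

    unseen-face : ∀ {d d′} → face d ≡ face d′ → Unseen d → Unseen d′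
    unseen-face p u e i q = u e i (trans p q)

    ω-0 : ∀ {d} → Unseen d → flow ω d ≡ 0ℤ
    ω-0 {d} u = flow-0 ω d (λ i → u _ (there i) refl)
      (λ i → let z , j , q = source-visited ω pω i in u _ j (trans (cong face (sym (aa d))) (sym q)))

    F : D → ℤ
    F = flow₂ ω (arc b ℓ)

    abstract
      P : Potential F
      P = closed-potential ω (arc b ℓ) pω (arc-path b ℓ)

    open Potential P

    -- The potential read off at the corners of a face, a hub corner taking its value from the adjacent sink.
    corner-value : ∀ d → Dec (isHub W d) → ℤ
    corner-value d (yes _) = w (a d)
    corner-value d (no  _) = w d

    abstract
      level : D → ℤ
      level d = corner-value d (hub? d)

      level-hub : ∀ {d} → isHub W d → level d ≡ w (a d)
      level-hub {d} h = go (hub? d)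
        where
        go : ∀ x → corner-value d x ≡ w (a d)
        go (yes _) = refl
        go (no nh) = contradiction h nh

      level-int : ∀ {d} → ¬ isHub W d → level d ≡ w d
      level-int {d} nh = go (hub? d)
        where
        go : ∀ x → corner-value d x ≡ w d
        go (yes h) = contradiction h nh
        go (no _)  = refl

    boundary : ∀ {h} → isHub W h → w (a h) ≡ ℤ.- F h
    boundary {h} hh = trans (alg (w (a h)) (w h)) (trans (cong (λ z → z ℤ.- (w h ℤ.- w (a h))) (w-hub h hh))
                        (trans (ℤ.+-identityˡ _) (cong ℤ.-_ (sym (w-d h)))))
      where
      alg : ∀ x y → x ≡ y ℤ.- (y ℤ.- x)
      alg = solve-∀

    base-seen : ¬ Unseen (hb b)
    base-seen u = u _ (end-visited (hb (ℓ ℕ.+ b)) ω) (sym (path-endOf ω pω))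

    arc-next : ∀ i → 1 ℕ.≤ i → i ℕ.≤ N₀ → Unseen (s (hb (i ℕ.+ b))) → flow (arc b ℓ) (hb (i ℕ.+ b)) ≡ flow (arc b ℓ) (s (hb (i ℕ.+ b)))
    arc-next (suc zero)    _ i≤ u = contradiction (unseen-face (cong face (s-hb b)) u) base-seen
    arc-next (suc (suc i)) _ i≤ u = trans (go (ℕ.<-cmp (suc i) ℓ)) (cong (flow (arc b ℓ)) (sym (s-hb (suc i ℕ.+ b))))
      where
      go : Tri (suc i ℕ.< ℓ) (suc i ≡ ℓ) (ℓ ℕ.< suc i) → flow (arc b ℓ) (hb (suc (suc i) ℕ.+ b)) ≡ flow (arc b ℓ) (hb (suc i ℕ.+ b))
      go (tri< lt _ _)   = trans (arc-in b ℓ (suc (suc i)) (s≤s z≤n) lt ℓ≤N) (sym (arc-in b ℓ (suc i) (s≤s z≤n) (ℕ.<⇒≤ lt) ℓ≤N))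
      go (tri≈ _ e _)    = contradiction (cong (λ k → face (hb (k ℕ.+ b))) e) (unseen-face (cong face (s-hb (suc i ℕ.+ b))) u _ (here refl))
      go (tri> _ _ gt)   = trans (arc-out b ℓ (suc (suc i)) (ℕ.m<n⇒m<1+n gt) i≤) (sym (arc-out b ℓ (suc i) gt (ℕ.<⇒≤ i≤)))

    -- In an unseen face `ω` has no flow, and off the hub the arc has none. At the hub the level is
    -- read at the sinks, so it changes only where the arc begins or ends, and these two faces lie
    -- on `ω`.
    level-f : ∀ {d} → Unseen d → level (f d) ≡ level d
    level-f {d} u = go (hub? d) (hub? (a d))
      where
      go : Dec (isHub W d) → Dec (isHub W (a d)) → level (f d) ≡ level d
      go (yes h) _       = trans (level-int (s-¬hub (sink-¬hub (trans (col-a d) (cong not (col-isHub h)))))) (trans (w-s (a d)) (sym (level-hub h)))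
      go (no nh) (no nh′) = trans (level-int (s-¬hub nh′)) (trans (w-s (a d)) (trans (sym (ℤ.i-j≡0⇒i≡j (w d) (w (a d)) (trans (sym (w-d d)) zero-flow))) (sym (level-int nh))))
        where
        zero-flow : F d ≡ 0ℤ
        zero-flow = cong₂ ℤ._+_ (ω-0 u) (flow-0 (arc b ℓ) d (nh ∘ arc-hub b ℓ) (nh′ ∘ arc-hub b ℓ))
      go (no nh) (yes h) = trans (level-hub (s-isHub h)) (trans (boundary (s-isHub h)) (trans (cong ℤ.-_ (sym (same (hub-near b h)))) (trans (sym (boundary h))
          (trans (cong w (aa d)) (sym (level-int nh))))))
        where
        same : (∃ λ i → (1 ℕ.≤ i) × (i ℕ.≤ N₀) × (a d ≡ hb (i ℕ.+ b))) → F (a d) ≡ F (f d)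
        same (i , i≥ , i≤ , e) = cong₂ ℤ._+_
          (trans (trans (flow-anti ω d) (cong ℤ.-_ (ω-0 u))) (sym (ω-0 (unseen-face (sym (face-f d)) u))))
          (subst (λ z → flow (arc b ℓ) z ≡ flow (arc b ℓ) (s z)) (sym e)
            (arc-next i i≥ i≤ (subst (λ z → Unseen (s z)) e (unseen-face (sym (face-f d)) u))))

    level-iter : ∀ {d} i → Unseen d → Unseen (iter f i d) × (level (iter f i d) ≡ level d)
    level-iter zero    u = u , refl
    level-iter (suc i) u = let u′ , q = level-iter i u in unseen-face (sym (face-f _)) u′ , trans (level-f u′) q

    level-face : ∀ {d d′} → face d ≡ face d′ → Unseen d → level d ≡ level d′
    level-face {d} e u = let i , p = Fc.rep⇒orb e in trans (sym (proj₂ (level-iter i u))) (cong level p)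

    level-step : ∀ {e} → col e ≡ true → Unseen e → level (a e) ≡ level e
    level-step {e} c u = trans (level-int int) (trans (sym (w-s (a e))) (trans (sym (level-int (s-¬hub int))) (level-f u)))
      where
      int : ¬ isHub W (a e)
      int = sink-¬hub (trans (col-a e) (cong not c))

    level-path : ∀ {x} γ {y} → IsPath x γ y → (∀ {e} → e ∈ x ∷ γ → Unseen e) → level x ≡ level y
    level-path []      p            un = level-face p (un (here refl))
    level-path (e ∷ γ) (c , st , p) un = trans (level-face (sym st) (un (here refl)))
      (trans (level-step c (un (there (here refl)))) (level-path γ p (un ∘ there)))

    -- As `w` vanishes at the hub and the arc has flow 1 on this boundary edge, the value at its
    -- sink is -1.
    level-inside : ∀ t → t ℕ.≤ ℓ → Unseen (hb (t ℕ.+ b)) → level (hb (t ℕ.+ b)) ≡ ℤ.-1ℤ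
    level-inside zero    t≤ u = contradiction u base-seen
    level-inside (suc t) t≤ u = trans (level-hub (hb-isHub _)) (trans (boundary (hb-isHub _))
      (cong ℤ.-_ (cong₂ ℤ._+_ (ω-0 u) (arc-in b ℓ (suc t) (s≤s z≤n) t≤ ℓ≤N))))

    level-outside : ∀ r → r ℕ.+ ℓ ℕ.≤ N₀ → Unseen (hb (r ℕ.+ (ℓ ℕ.+ b))) → level (hb (r ℕ.+ (ℓ ℕ.+ b))) ≡ 0ℤ
    level-outside zero    r≤ u = contradiction refl (u _ (here refl))
    level-outside (suc r) r≤ u = trans (level-hub (hb-isHub _)) (trans (boundary (hb-isHub _))
      (cong ℤ.-_ (cong₂ ℤ._+_ (ω-0 u) (trans (cong (λ k → flow (arc b ℓ) (hb k)) (sym (ℕ.+-assoc (suc r) ℓ b)))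
        (arc-out b ℓ (suc r ℕ.+ ℓ) (s≤s (ℕ.m≤n+m ℓ r)) r≤)))))

    Ends : ℕ → ℕ → D → D → Set
    Ends t r x y = ((x ≡ hb (t ℕ.+ b)) × (y ≡ hb (r ℕ.+ (ℓ ℕ.+ b)))) ⊎ ((x ≡ hb (r ℕ.+ (ℓ ℕ.+ b))) × (y ≡ hb (t ℕ.+ b)))

    separated : ∀ {t r} → t ℕ.≤ ℓ → r ℕ.+ ℓ ℕ.≤ N₀ → ∀ {x y} → Ends t r x y → Unseen x → Unseen y → level x ≢ level y
    separated {t} {r} t≤ r≤ (inj₁ (p , q)) ux uy e = -1≢0 (trans (sym (level-inside t t≤ (subst Unseen p ux)))
      (trans (cong level (sym p)) (trans e (trans (cong level q) (level-outside r r≤ (subst Unseen q uy))))))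
      where
      -1≢0 : ℤ.-1ℤ ≢ 0ℤ
      -1≢0 ()
    separated {t} {r} t≤ r≤ (inj₂ (p , q)) ux uy e = -1≢0 (trans (sym (level-inside t t≤ (subst Unseen q uy)))
      (trans (cong level (sym q)) (trans (sym e) (trans (cong level p) (level-outside r r≤ (subst Unseen p ux))))))
      where
      -1≢0 : ℤ.-1ℤ ≢ 0ℤ
      -1≢0 ()

    meets : ∀ {t r} → t ℕ.≤ ℓ → r ℕ.+ ℓ ℕ.≤ N₀ → ∀ {x y} γ → IsPath x γ y → Ends t r x y → Meet x γ (hb (ℓ ℕ.+ b)) ω
    meets {t} {r} t≤ r≤ {x} {y} γ p ends = go (common? (x ∷ γ) Seen)
      where
      go : (∃ λ e → ∃ λ e′ → (e ∈ x ∷ γ) × (e′ ∈ Seen) × (face e ≡ face e′)) ⊎ Disjoint (x ∷ γ) Seen → Meet x γ (hb (ℓ ℕ.+ b)) ω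
      go (inj₁ (e , e′ , i , j , q)) =
        let γ₁ , γ₂ , eγ , p₁ = visit γ i
            ω₁ , ω₂ , eω , p₂ = visit ω j
        in γ₁ , γ₂ , ω₁ , ω₂ , eγ , eω , trans (cong face (sym p₁)) (trans q (cong face p₂))
      go (inj₂ dj) = ⊥-elim (separated t≤ r≤ ends (λ _ j → dj (here refl) j)
        (unseen-face (path-endOf γ p) (λ _ j → dj (end-visited x γ) j)) (level-path γ p λ i _ j → dj i j))

-- Directed distances between boundary faces

least-ℕ : ∀ {P : ℕ → Set} → (∀ k → Dec (P k)) → ∀ k → P k → ∃ λ m → P m × (∀ j → P j → m ℕ.≤ j)
least-ℕ P? zero    p = 0 , p , λ _ _ → z≤n
least-ℕ P? (suc k) p with P? 0
... | yes p₀ = 0 , p₀ , λ _ _ → z≤n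
... | no ¬p₀ with m , pm , min ← least-ℕ (P? ∘ suc) k p =
  suc m , pm , λ { zero q → contradiction q ¬p₀ ; (suc j) q → s≤s (min j q) }

-- `suc A` and `B` are lengths of two walks that close up with the same return of length `r`; they
-- agree modulo 3, and the bounds leave only the differences 0 and 3.
step-mod-3 : ∀ A B r → 3 ∣ suc A ℕ.+ r → 3 ∣ B ℕ.+ r → B ℕ.≤ suc A → A ℕ.≤ 2 ℕ.+ B → (B ≡ suc A) ⊎ (A ≡ 2 ℕ.+ B)
step-mod-3 A B r h h′ B≤ A≤ = go (suc A ℕ.∸ B) (ℕ.m∸n+n≡m B≤) (ℕ.m≤n+o⇒m∸n≤o (suc A) B (ℕ.≤-trans (s≤s A≤) (ℕ.≤-reflexive (ℕ.+-comm 3 B))))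
  where
  go : ∀ c → c ℕ.+ B ≡ suc A → c ℕ.≤ 3 → (B ≡ suc A) ⊎ (A ≡ 2 ℕ.+ B)
  go c e c≤ = pick c e c≤ (∣m+n∣m⇒∣n (subst (3 ∣_) (trans (cong (ℕ._+ r) (sym e)) (alg c B r)) h) h′)
    where
    alg : ∀ c B r → c ℕ.+ B ℕ.+ r ≡ (B ℕ.+ r) ℕ.+ c
    alg = NR.solve-∀
    pick : ∀ c → c ℕ.+ B ≡ suc A → c ℕ.≤ 3 → 3 ∣ c → (B ≡ suc A) ⊎ (A ≡ 2 ℕ.+ B)
    pick 0 e _ _ = inj₁ e
    pick 1 e _ d = contradiction (∣⇒≤ d) λ { (s≤s ()) }
    pick 2 e _ d = contradiction (∣⇒≤ d) λ { (s≤s (s≤s ())) }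
    pick 3 e _ _ = inj₂ (sym (ℕ.suc-injective e))
    pick (suc (suc (suc (suc c)))) e (s≤s (s≤s (s≤s ()))) d

module Rows {n′ : ℕ} (W : Web (suc n′)) where
  open Map W
  open Count W
  open Homology W
  open Corners W
  open Paths W
  open Digons W
  open Strips W
  open Crossing W

  PathOf : ℕ → D → D → Set
  PathOf k x y = ∃ λ l → IsPath x l y × (length l ≡ k)

  path? : ∀ k x y → Dec (PathOf k x y)
  path? zero    x y = map′ (λ e → [] , e , refl) (λ { ([] , e , _) → e }) (face x F.≟ face y)
  path? (suc k) x y = map′
    (λ { (e , c , st , l , p , q) → e ∷ l , (c , st , p) , cong suc q })
    (λ { (e ∷ l , (c , st , p) , q) → e , c , st , l , p , ℕ.suc-injective q })
    (F.any? λ e → (col e Bool.≟ true) ×-dec ((face (a e) F.≟ face x) ×-dec path? k e y))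

  connected-path : ∀ i j → ∃ λ l → IsPath (hb i) l (hb j)
  connected-path i j = let b , pb , _ = back (arc 0 i) (to i) in b ++ arc 0 j , path-++ b pb (to j)
    where
    to : ∀ i → IsPath (hb 0) (arc 0 i) (hb i)
    to i = subst (λ k → IsPath (hb 0) (arc 0 i) (hb k)) (ℕ.+-identityʳ i) (arc-path 0 i)

  abstract
    dist : ℕ → ℕ → ℕ
    dist i j = let l , p = connected-path i j in proj₁ (least-ℕ (λ k → path? k (hb i) (hb j)) (length l) (l , p , refl))

    dist-path : ∀ i j → PathOf (dist i j) (hb i) (hb j)
    dist-path i j = let l , p = connected-path i j in proj₁ (proj₂ (least-ℕ (λ k → path? k (hb i) (hb j)) (length l) (l , p , refl)))

    dist-min : ∀ i j l → IsPath (hb i) l (hb j) → dist i j ℕ.≤ length l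
    dist-min i j l p = let l′ , p′ = connected-path i j in
      proj₂ (proj₂ (least-ℕ (λ k → path? k (hb i) (hb j)) (length l′) (l′ , p′ , refl))) (length l) (l , p , refl)

  dist-self : ∀ i → dist i i ≡ 0
  dist-self i = ℕ.n≤0⇒n≡0 (dist-min i i [] refl)

  dist-double : ∀ i j → dist i j ℕ.≤ 2 ℕ.* dist j i
  dist-double i j = let l , p , q = dist-path j i ; b , pb , kb = back l p in
    subst (dist i j ℕ.≤_) (trans kb (cong (2 ℕ.*_) q)) (dist-min i j b pb)

  length-flow : ∀ {x} l {y} → IsPath x l y → sum (λ d → # (col d) ℤ.* flow l d) ≡ + length l
  length-flow []      p           = sum-0 λ d → ℤ.*-zeroʳ (# (col d))
  length-flow (e ∷ l) (c , _ , p) = begin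
    sum (λ d → # (col d) ℤ.* (δ e d ℤ.+ flow l d))
      ≡⟨ sum-cong (λ d → alg (# (col d)) (# (d == e)) (# (d == a e)) (flow l d)) ⟩
    sum (λ d → (# (d == e) ℤ.* # (col d) ℤ.- # (d == a e) ℤ.* # (col d)) ℤ.+ # (col d) ℤ.* flow l d)
      ≡⟨ trans (sum-+ (λ d → # (d == e) ℤ.* # (col d) ℤ.- # (d == a e) ℤ.* # (col d)) (λ d → # (col d) ℤ.* flow l d))
           (cong₂ ℤ._+_ (trans (sum-- (λ d → # (d == e) ℤ.* # (col d)) (λ d → # (d == a e) ℤ.* # (col d)))
             (cong₂ ℤ._-_ (sum-δ e (λ d → # (col d))) (sum-δ (a e) (λ d → # (col d))))) (length-flow l p)) ⟩
    # (col e) ℤ.- # (col (a e)) ℤ.+ + length l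
      ≡⟨ cong₂ (λ x y → # x ℤ.- # y ℤ.+ + length l) c (sink c) ⟩
    1ℤ ℤ.+ + length l
      ≡⟨ sym (ℤ.pos-+ 1 (length l)) ⟩
    + suc (length l) ∎
    where
    open ≡-Reasoning
    alg : ∀ b x y z → b ℤ.* (x ℤ.- y ℤ.+ z) ≡ (x ℤ.* b ℤ.- y ℤ.* b) ℤ.+ b ℤ.* z
    alg = solve-∀

  -- The length is the sum of the flow over the source darts. By the potential this is the sum of
  -- `w` over sources minus that over sinks; `w` vanishes at the hub, and each other vertex has
  -- three darts.
  closed-length : ∀ {x y} γ ω → IsPath x γ y → IsPath y ω x → 3 ∣ length γ ℕ.+ length ω
  closed-length {x} {y} γ ω p q = divides ℤ.∣ T ∣ (trans (trans (cong ℤ.∣_∣ total) (ℤ.abs-* (+ 3) T)) (ℕ.*-comm 3 ℤ.∣ T ∣))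
    where
    open Potential (closed-potential γ ω p q)
    open ≡-Reasoning
    source-part sink-part : D → ℤ
    source-part d = # (col d) ℤ.* w d
    sink-part d = # (not (col d)) ℤ.* w d
    T : ℤ
    T = sum (λ d → # (minV d) ℤ.* source-part d) ℤ.- sum (λ d → # (minV d) ℤ.* sink-part d)
    three : ∀ (k : Bool → Bool) → sum (λ d → # (k (col d)) ℤ.* w d) ≡ + 3 ℤ.* sum (λ d → # (minV d) ℤ.* (# (k (col d)) ℤ.* w d))
    three k = sum-vertices _ (λ d → cong₂ (λ x y → # (k x) ℤ.* y) (col-s d) (w-s d))
      (λ d h → trans (cong (λ z → # (k (col d)) ℤ.* z) (w-hub d h)) (ℤ.*-zeroʳ (# (k (col d)))))
    factor : ∀ x y → + 3 ℤ.* x ℤ.- + 3 ℤ.* y ≡ + 3 ℤ.* (x ℤ.- y)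
    factor = solve-∀
    expand : ∀ b x y → b ℤ.* (x ℤ.- y) ≡ b ℤ.* x ℤ.- b ℤ.* y
    expand = solve-∀
    total : + (length γ ℕ.+ length ω) ≡ + 3 ℤ.* T
    total = begin
      + (length γ ℕ.+ length ω)
        ≡⟨ ℤ.pos-+ (length γ) (length ω) ⟩
      + length γ ℤ.+ + length ω
        ≡⟨ sym (cong₂ ℤ._+_ (length-flow γ p) (length-flow ω q)) ⟩
      sum (λ d → # (col d) ℤ.* flow γ d) ℤ.+ sum (λ d → # (col d) ℤ.* flow ω d)
        ≡⟨ sym (sum-+ (λ d → # (col d) ℤ.* flow γ d) (λ d → # (col d) ℤ.* flow ω d)) ⟩
      sum (λ d → # (col d) ℤ.* flow γ d ℤ.+ # (col d) ℤ.* flow ω d)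
        ≡⟨ sum-cong (λ d → trans (sym (ℤ.*-distribˡ-+ (# (col d)) (flow γ d) (flow ω d)))
             (trans (cong (λ z → # (col d) ℤ.* z) (w-d d)) (expand (# (col d)) (w d) (w (a d))))) ⟩
      sum (λ d → source-part d ℤ.- # (col d) ℤ.* w (a d))
        ≡⟨ trans (sum-- source-part (λ d → # (col d) ℤ.* w (a d))) (cong (λ z → sum source-part ℤ.- z)
             (trans (sum-cong λ d → cong (λ b → # b ℤ.* w (a d)) (sym (trans (cong not (col-a d)) (Bool.not-involutive (col d))))) (sum-a sink-part))) ⟩
      sum source-part ℤ.- sum sink-part
        ≡⟨ cong₂ ℤ._-_ (three (λ b → b)) (three not) ⟩
      + 3 ℤ.* sum (λ d → # (minV d) ℤ.* source-part d) ℤ.- + 3 ℤ.* sum (λ d → # (minV d) ℤ.* sink-part d)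
        ≡⟨ factor (sum (λ d → # (minV d) ℤ.* source-part d)) (sum (λ d → # (minV d) ℤ.* sink-part d)) ⟩
      + 3 ℤ.* T ∎

  hb-arc : ∀ i → IsPath (hb i) (hb (suc i) ∷ []) (hb (suc i))
  hb-arc i = hb-col (suc i) , hb-face i , refl

  hb-back : ∀ i → ∃ λ l → IsPath (hb (suc i)) l (hb i) × (length l ≡ 2)
  hb-back i = back (hb (suc i) ∷ []) (hb-arc i)

  dist-fwd : ∀ z i → (dist z (suc i) ≡ suc (dist z i)) ⊎ (dist z i ≡ 2 ℕ.+ dist z (suc i))
  dist-fwd z i =
    let l , p , k = dist-path z i ; l′ , p′ , k′ = dist-path z (suc i)
        r , pr , kr = dist-path (suc i) z ; b , pb , kb = hb-back i
        l+ = l ++ hb (suc i) ∷ []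
        p+ = path-++ l p (hb-arc i)
        k+ = trans (len l {hb (suc i) ∷ []}) (trans (ℕ.+-comm (length l) 1) (cong suc k))
        kb′ = trans (len l′ {b}) (trans (cong₂ ℕ._+_ k′ kb) (ℕ.+-comm (dist z (suc i)) 2))
    in step-mod-3 (dist z i) (dist z (suc i)) (dist (suc i) z)
         (subst (3 ∣_) (cong₂ ℕ._+_ k+ kr) (closed-length l+ r p+ pr))
         (subst (3 ∣_) (cong₂ ℕ._+_ k′ kr) (closed-length l′ r p′ pr))
         (subst (dist z (suc i) ℕ.≤_) k+ (dist-min z (suc i) l+ p+))
         (subst (dist z i ℕ.≤_) kb′ (dist-min z i (l′ ++ b) (path-++ l′ p′ pb)))

  dist-bwd : ∀ z i → (dist i z ≡ suc (dist (suc i) z)) ⊎ (dist (suc i) z ≡ 2 ℕ.+ dist i z)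
  dist-bwd z i =
    let l , p , k = dist-path (suc i) z ; l′ , p′ , k′ = dist-path i z
        r , pr , kr = dist-path z i ; b , pb , kb = hb-back i
        l+ = hb (suc i) ∷ l
        p+ = path-++ (hb (suc i) ∷ []) (hb-arc i) p
    in step-mod-3 (dist (suc i) z) (dist i z) (dist z i)
         (subst (3 ∣_) (cong₂ ℕ._+_ (cong suc k) kr) (closed-length l+ r p+ pr))
         (subst (3 ∣_) (cong₂ ℕ._+_ k′ kr) (closed-length l′ r p′ pr))
         (subst (dist i z ℕ.≤_) (cong suc k) (dist-min i z l+ p+))
         (subst (dist (suc i) z ℕ.≤_) (trans (len b {l′}) (cong₂ ℕ._+_ kb k′)) (dist-min (suc i) z (b ++ l′) (path-++ b pb p′)))

  webdist-dist : ∀ i j k → IsWebdist W (hb i) (hb j) k → 3 ℕ.* k ≡ dist i j ℕ.+ dist j i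
  webdist-dist i j k (π , min) = ℕ.≤-antisym upper lower
    where
    upper : 3 ℕ.* k ℕ.≤ dist i j ℕ.+ dist j i
    upper =
      let l , p , q = dist-path i j ; l′ , p′ , q′ = dist-path j i
          k₀ , π₀ , h = Digon.undirected (digon _ l l′ p p′ ℕ.≤-refl)
      in ℕ.≤-trans (ℕ.*-monoʳ-≤ 3 (ℕ.≮⇒≥ (λ lt → min k₀ lt π₀))) (subst (3 ℕ.* k₀ ℕ.≤_) (cong₂ ℕ._+_ q q′) h)
    lower : dist i j ℕ.+ dist j i ℕ.≤ 3 ℕ.* k
    lower = let γ , ω , pγ , pω , total = directed π in
      subst (dist i j ℕ.+ dist j i ℕ.≤_) total (ℕ.+-mono-≤ (dist-min i j γ pγ) (dist-min j i ω pω))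

  endOf-face : ∀ {x x′} l → face x ≡ face x′ → face (endOf x l) ≡ face (endOf x′ l)
  endOf-face []      e = e
  endOf-face (_ ∷ _) e = refl

  splice-≤ : ∀ (γ₁ : List D) {γ₂ l} → length l ℕ.≤ length γ₂ → length (γ₁ ++ l) ℕ.≤ length (γ₁ ++ γ₂)
  splice-≤ γ₁ h = subst₂ ℕ._≤_ (sym (len γ₁)) (sym (len γ₁)) (ℕ.+-monoʳ-≤ (length γ₁) h)

  splice-< : ∀ (γ₁ : List D) {γ₂ l} → length l ℕ.< length γ₂ → length (γ₁ ++ l) ℕ.< length (γ₁ ++ γ₂)
  splice-< γ₁ h = subst₂ ℕ._<_ (sym (len γ₁)) (sym (len γ₁)) (ℕ.+-monoʳ-< (length γ₁) h)

  splice-≤ˡ : ∀ (γ₁ l : List D) {γ₂} → length l ℕ.≤ length γ₁ → length (l ++ γ₂) ℕ.≤ length (γ₁ ++ γ₂)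
  splice-≤ˡ γ₁ l {γ₂} h = subst₂ ℕ._≤_ (sym (len l)) (sym (len γ₁)) (ℕ.+-monoˡ-≤ (length γ₂) h)

  splice-<ˡ : ∀ (γ₁ l : List D) {γ₂} → length l ℕ.< length γ₁ → length (l ++ γ₂) ℕ.< length (γ₁ ++ γ₂)
  splice-<ˡ γ₁ l {γ₂} h = subst₂ ℕ._<_ (sym (len l)) (sym (len γ₁)) (ℕ.+-monoˡ-< (length γ₂) h)

  private
    up-or-down : ∀ {A B} → (B ≡ suc A) ⊎ (A ≡ 2 ℕ.+ B) → (A ℕ.≤ B → B ≡ suc A) × (B ℕ.< A → A ≡ 2 ℕ.+ B)
    up-or-down {A} {B} (inj₁ e) = (λ _ → e) , λ h → contradiction h (ℕ.≤⇒≯ (subst (A ℕ.≤_) (sym e) (ℕ.n≤1+n A)))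
    up-or-down {A} {B} (inj₂ e) = (λ h → contradiction h (ℕ.<⇒≱ (subst (B ℕ.<_) (sym e) (ℕ.m<n+m B {2} (s≤s z≤n))))) , λ _ → e

  fwd-up : ∀ {z i} → dist z i ℕ.≤ dist z (suc i) → dist z (suc i) ≡ suc (dist z i)
  fwd-up {z} {i} = proj₁ (up-or-down (dist-fwd z i))

  fwd-down : ∀ {z i} → dist z (suc i) ℕ.< dist z i → dist z i ≡ 2 ℕ.+ dist z (suc i)
  fwd-down {z} {i} = proj₂ (up-or-down (dist-fwd z i))

  bwd-down : ∀ {z i} → dist (suc i) z ℕ.≤ dist i z → dist i z ≡ suc (dist (suc i) z)
  bwd-down {z} {i} = proj₁ (up-or-down (dist-bwd z i))

  bwd-up : ∀ {z i} → dist i z ℕ.< dist (suc i) z → dist (suc i) z ≡ 2 ℕ.+ dist i z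
  bwd-up {z} {i} = proj₂ (up-or-down (dist-bwd z i))

  hb-eq : ∀ {x y} → x ≡ y ℕ.+ N₀ → hb x ≡ hb y
  hb-eq {x} {y} e = trans (cong hb e) (hb-N y)

  -- The strip from boundary edge i + 1 ends at boundary edge p + i; the column t + i runs once
  -- around the boundary. In terms of the weight, `wall` says a = 0; it holds because `L` is
  -- straight.
  record RowP (i : ℕ) : Set where
    field
      p     : ℕ
      p≥1   : 1 ℕ.≤ p
      p≤N   : p ℕ.≤ N₀
      above : ∀ t → p ℕ.≤ t → t ℕ.≤ N₀ → dist (t ℕ.+ i) (suc i) ≡ suc (dist (t ℕ.+ i) i)
      below : ∀ t → 1 ℕ.≤ t → t ℕ.< p → dist (t ℕ.+ i) i ≡ 2 ℕ.+ dist (t ℕ.+ i) (suc i)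
      wall  : dist i (p ℕ.+ i) ≡ 2 ℕ.* dist (p ℕ.+ i) i

  module BuildP (i p′ : ℕ) (p≤ : suc p′ ℕ.≤ N₀) (S : StripP (hb (suc p′ ℕ.+ i)) (hb (suc i))) where
    open StripP S
    c₀ = hb-col (suc i)

    L-path′ : IsPath (hb (suc p′ ℕ.+ i)) L (hb i)
    L-path′ = path-end L (hb-face i) L-path

    -- A geodesic to B_{i+1} has to cross `L`, and by `stripP-L` the rest of `L` is no longer than
    -- the remainder of the geodesic. This inequality decides between the two alternatives of
    -- `dist-fwd`.
    above : ∀ t → suc p′ ℕ.≤ t → t ℕ.≤ N₀ → dist (t ℕ.+ i) (suc i) ≡ suc (dist (t ℕ.+ i) i)
    above t p≤t t≤ = let γ , pγ , k = dist-path (t ℕ.+ i) (suc i) in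
      fwd-up (subst (dist (t ℕ.+ i) i ℕ.≤_) k (shorter γ pγ
        (Interleave.meets i (suc p′) p≤ L L-path′ {t = 1} {r = t ℕ.∸ suc p′} (s≤s z≤n)
          (ℕ.≤-trans (ℕ.≤-reflexive (ℕ.m∸n+n≡m p≤t)) t≤) γ pγ
          (inj₂ (cong hb (trans (cong (ℕ._+ i) (sym (ℕ.m∸n+n≡m p≤t))) (ℕ.+-assoc (t ℕ.∸ suc p′) (suc p′) i)) , refl)))))
      where
      shorter : ∀ γ → IsPath (hb (t ℕ.+ i)) γ (hb (suc i)) → Meet (hb (t ℕ.+ i)) γ (hb (suc p′ ℕ.+ i)) L → dist (t ℕ.+ i) i ℕ.≤ length γ
      shorter γ pγ (γ₁ , γ₂ , l₁ , l₂ , refl , eL , q) =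
        let p₁ , p₂ = path-split γ₁ pγ
            _ , q₂ = path-split l₁ (subst (λ l → IsPath _ l _) eL L-path′)
        in ℕ.≤-trans (dist-min _ _ (γ₁ ++ l₂) (path-++ γ₁ p₁ (path-start l₂ (sym q) q₂)))
             (splice-≤ γ₁ (stripP-L S c₀ l₁ l₂ eL γ₂ (path-start γ₂ q p₂)))

    below : ∀ t → 1 ℕ.≤ t → t ℕ.< suc p′ → dist (t ℕ.+ i) i ≡ 2 ℕ.+ dist (t ℕ.+ i) (suc i)
    below (suc t) _ (s≤s t<) = go p′ t< p≤ refl
      where
      go : ∀ m → suc t ℕ.≤ m → suc m ℕ.≤ N₀ → m ≡ p′ → dist (suc t ℕ.+ i) i ≡ 2 ℕ.+ dist (suc t ℕ.+ i) (suc i)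
      go (suc m) (s≤s t≤) m≤ em = let γ , pγ , k = dist-path (suc t ℕ.+ i) i in
        fwd-down (subst (dist (suc t ℕ.+ i) (suc i) ℕ.<_) k (shorter γ pγ
          (Interleave.meets (suc i) m (ℕ.≤-trans (ℕ.n≤1+n m) (ℕ.≤-trans (ℕ.n≤1+n (suc m)) m≤)) K K-path′ {t = t} {r = N₀ ℕ.∸ suc m} t≤
            (ℕ.≤-trans (ℕ.+-monoʳ-≤ (N₀ ℕ.∸ suc m) (ℕ.n≤1+n m)) (ℕ.≤-reflexive (ℕ.m∸n+n≡m (ℕ.<⇒≤ m≤)))) γ pγ
            (inj₁ (cong hb (sym (ℕ.+-suc t i)) , sym (hb-eq wrap))))))
        where
        start : face (a (hb (suc p′ ℕ.+ i))) ≡ face (hb (m ℕ.+ suc i))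
        start = trans (hb-face (p′ ℕ.+ i)) (cong (face ∘ hb) (trans (cong (ℕ._+ i) (sym em)) (sym (ℕ.+-suc m i))))
        K-path′ : IsPath (hb (m ℕ.+ suc i)) K (hb (suc i))
        K-path′ = path-start K start K-path
        wrap : (N₀ ℕ.∸ suc m) ℕ.+ (m ℕ.+ suc i) ≡ i ℕ.+ N₀
        wrap = trans (alg (N₀ ℕ.∸ suc m) m i) (cong (i ℕ.+_) (ℕ.m∸n+n≡m (ℕ.<⇒≤ m≤)))
          where
          alg : ∀ x m i → x ℕ.+ (m ℕ.+ suc i) ≡ i ℕ.+ (x ℕ.+ suc m)
          alg = NR.solve-∀
        shorter : ∀ γ → IsPath (hb (suc t ℕ.+ i)) γ (hb i) → Meet (hb (suc t ℕ.+ i)) γ (hb (m ℕ.+ suc i)) K → dist (suc t ℕ.+ i) (suc i) ℕ.< length γ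
        shorter γ pγ (γ₁ , γ₂ , k₁ , k₂ , refl , eK , q) =
          let p₁ , p₂ = path-split γ₁ pγ
              _ , q₂ = path-split k₁ (subst (λ l → IsPath _ l _) eK K-path′)
          in ℕ.≤-<-trans (dist-min _ _ (γ₁ ++ k₂) (path-++ γ₁ p₁ (path-start k₂ (sym q) q₂)))
               (splice-< γ₁ (stripP-K S c₀ k₁ k₂ eK γ₂ (path-end γ₂ (sym (hb-face i)) (path-start γ₂ (trans q (sym (endOf-face k₁ start))) p₂))))

    wall : dist i (suc p′ ℕ.+ i) ≡ 2 ℕ.* dist (suc p′ ℕ.+ i) i
    wall = ℕ.≤-antisym (dist-double i (suc p′ ℕ.+ i)) (let γ , pγ , k = dist-path i (suc p′ ℕ.+ i) in
      ℕ.≤-trans (ℕ.*-monoʳ-≤ 2 (dist-min _ _ L L-path′)) (subst (2 ℕ.* length L ℕ.≤_) k (straight-bound L γ L-str L-path′ pγ)))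

  abstract
    rowP : ∀ i → RowP i
    rowP i = go (stripP (hb-isHub (suc i)))
      where
      go : (∃ λ h → isHub W h × StripP h (hb (suc i))) → RowP i
      go (h , hh , S) with hub-near i hh
      ... | suc p′ , p≥ , p≤ , refl = record { p = suc p′ ; p≥1 = p≥ ; p≤N = p≤
              ; above = BuildP.above i p′ p≤ S ; below = BuildP.below i p′ p≤ S ; wall = BuildP.wall i p′ p≤ S }

  -- The strip of the other kind ends at boundary edge q + 1 + i. In terms of the weight, `wall`
  -- says b = 0 in row i + 1 at column q + i.
  record RowQ (i : ℕ) : Set where
    field
      q     : ℕ
      q≤N   : suc q ℕ.≤ N₀
      above : ∀ t → suc q ℕ.≤ t → t ℕ.≤ N₀ → dist (suc i) (t ℕ.+ i) ≡ 2 ℕ.+ dist i (t ℕ.+ i)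
      below : ∀ t → 1 ℕ.≤ t → t ℕ.≤ q → dist i (t ℕ.+ i) ≡ suc (dist (suc i) (t ℕ.+ i))
      wall  : dist (q ℕ.+ i) (suc i) ≡ 2 ℕ.* dist (suc i) (q ℕ.+ i)

  module BuildQ (i q′ : ℕ) (q≤ : suc q′ ℕ.≤ N₀) (S : StripQ (hb (suc q′ ℕ.+ i)) (hb (suc i))) where
    open StripQ S
    c₀ = hb-col (suc i)

    L-path′ : IsPath (hb (suc i)) L (hb (q′ ℕ.+ i))
    L-path′ = path-end L (hb-face (q′ ℕ.+ i)) L-path

    K-path′ : IsPath (hb i) K (hb (suc q′ ℕ.+ i))
    K-path′ = path-start K (hb-face i) K-path

    above : ∀ t → suc q′ ℕ.≤ t → t ℕ.≤ N₀ → dist (suc i) (t ℕ.+ i) ≡ 2 ℕ.+ dist i (t ℕ.+ i)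
    above t q≤t t≤ = let γ , pγ , k = dist-path (suc i) (t ℕ.+ i) in
      bwd-up (subst (dist i (t ℕ.+ i) ℕ.<_) k (shorter γ pγ
        (Interleave.meets (suc q′ ℕ.+ i) ℓ (ℕ.m∸n≤m N₀ (suc q′)) K (subst (λ z → IsPath z K (hb (suc q′ ℕ.+ i))) (sym (hb-eq wrap)) K-path′)
          {t = t ℕ.∸ suc q′} {r = 1} (ℕ.∸-monoˡ-≤ (suc q′) t≤) (ℕ.≤-trans (s≤s (ℕ.m≤n+m ℓ q′)) (ℕ.≤-reflexive (trans (ℕ.+-comm (suc q′) ℓ) (ℕ.m∸n+n≡m q≤)))) γ pγ
          (inj₂ (sym (hb-eq (cong suc wrap)) , cong hb (trans (cong (ℕ._+ i) (sym (ℕ.m∸n+n≡m q≤t))) (ℕ.+-assoc (t ℕ.∸ suc q′) (suc q′) i)))))))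
      where
      ℓ : ℕ
      -- `K` runs from B_i to B_{q′+1+i}; the arc that closes it goes on from there through the rest
      -- of the boundary, back to i modulo N.
      ℓ = N₀ ℕ.∸ suc q′
      wrap : ℓ ℕ.+ (suc q′ ℕ.+ i) ≡ i ℕ.+ N₀
      wrap = trans (sym (ℕ.+-assoc ℓ (suc q′) i)) (trans (cong (ℕ._+ i) (ℕ.m∸n+n≡m q≤)) (ℕ.+-comm N₀ i))
      shorter : ∀ γ → IsPath (hb (suc i)) γ (hb (t ℕ.+ i)) → Meet (hb (suc i)) γ (hb (ℓ ℕ.+ (suc q′ ℕ.+ i))) K → dist i (t ℕ.+ i) ℕ.< length γ
      shorter γ pγ (γ₁ , γ₂ , k₁ , k₂ , refl , eK , e) =
        let p₁ , p₂ = path-split γ₁ pγ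
            e′ = trans e (endOf-face k₁ (cong face (hb-eq wrap)))
            q₁ , _ = path-split k₁ (subst (λ l → IsPath _ l _) eK K-path′)
        in ℕ.≤-<-trans (dist-min _ _ (k₁ ++ γ₂) (path-++ k₁ q₁ (path-start γ₂ e′ p₂)))
             (splice-<ˡ γ₁ k₁ (stripQ-K S c₀ k₁ k₂ eK γ₁ (path-end γ₁ (trans e′ (endOf-face k₁ (sym (hb-face i)))) p₁)))

    below : ∀ t → 1 ℕ.≤ t → t ℕ.≤ q′ → dist i (t ℕ.+ i) ≡ suc (dist (suc i) (t ℕ.+ i))
    below (suc t) _ t≤ = let γ , pγ , k = dist-path i (suc t ℕ.+ i) in
      bwd-down (subst (dist (suc i) (suc t ℕ.+ i) ℕ.≤_) k (shorter γ pγ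
        (Interleave.meets (q′ ℕ.+ i) (suc ℓ) suc-ℓ≤ L (subst (λ z → IsPath z L (hb (q′ ℕ.+ i))) (sym (hb-eq wrap′)) L-path′)
          {t = ℓ} {r = t} (ℕ.n≤1+n ℓ) (ℕ.≤-trans (ℕ.≤-reflexive (ℕ.+-suc t ℓ)) (ℕ.≤-trans (ℕ.+-monoˡ-≤ ℓ t≤) (ℕ.≤-reflexive (trans (ℕ.+-comm q′ ℓ) (ℕ.m∸n+n≡m (ℕ.<⇒≤ q≤)))))) γ pγ
          (inj₁ (sym (hb-eq wrap) , sym (hb-eq (trans (ℕ.+-suc t (ℓ ℕ.+ (q′ ℕ.+ i))) (cong suc (trans (cong (t ℕ.+_) wrap) (sym (ℕ.+-assoc t i N₀))))))))))) 
      where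
      ℓ : ℕ
      ℓ = N₀ ℕ.∸ q′
      suc-ℓ≤ : suc ℓ ℕ.≤ N₀
      suc-ℓ≤ = ℕ.∸-monoʳ-< {N₀} {q′} {0} (ℕ.≤-trans (s≤s z≤n) t≤) (ℕ.<⇒≤ q≤)
      wrap : ℓ ℕ.+ (q′ ℕ.+ i) ≡ i ℕ.+ N₀
      wrap = trans (sym (ℕ.+-assoc ℓ q′ i)) (trans (cong (ℕ._+ i) (ℕ.m∸n+n≡m (ℕ.<⇒≤ q≤))) (ℕ.+-comm N₀ i))
      wrap′ : suc ℓ ℕ.+ (q′ ℕ.+ i) ≡ suc i ℕ.+ N₀
      wrap′ = cong suc wrap
      shorter : ∀ γ → IsPath (hb i) γ (hb (suc t ℕ.+ i)) → Meet (hb i) γ (hb (suc ℓ ℕ.+ (q′ ℕ.+ i))) L → dist (suc i) (suc t ℕ.+ i) ℕ.≤ length γ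
      shorter γ pγ (γ₁ , γ₂ , l₁ , l₂ , refl , eL , e) =
        let p₁ , p₂ = path-split γ₁ pγ
            e′ = trans e (endOf-face l₁ (cong face (hb-eq wrap′)))
            q₁ , _ = path-split l₁ (subst (λ l → IsPath _ l _) eL L-path′)
        in ℕ.≤-trans (dist-min _ _ (l₁ ++ γ₂) (path-++ l₁ q₁ (path-start γ₂ e′ p₂)))
             (splice-≤ˡ γ₁ l₁ (stripQ-L S c₀ l₁ l₂ eL γ₁ (path-end γ₁ e′ (path-start γ₁ (sym (hb-face i)) p₁))))

    wall : dist (q′ ℕ.+ i) (suc i) ≡ 2 ℕ.* dist (suc i) (q′ ℕ.+ i)
    wall = ℕ.≤-antisym (dist-double (q′ ℕ.+ i) (suc i)) (let γ , pγ , k = dist-path (q′ ℕ.+ i) (suc i) in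
      ℕ.≤-trans (ℕ.*-monoʳ-≤ 2 (dist-min _ _ L L-path′)) (subst (2 ℕ.* length L ℕ.≤_) k (straight-bound L γ L-str L-path′ pγ)))

  abstract
    rowQ : ∀ i → RowQ i
    rowQ i = go (stripQ (hb-isHub (suc i)))
      where
      go : (∃ λ h → isHub W h × StripQ h (hb (suc i))) → RowQ i
      go (h , hh , S) with hub-near i hh
      ... | suc q′ , _ , q≤ , refl = record { q = q′ ; q≤N = q≤
              ; above = BuildQ.above i q′ q≤ S ; below = BuildQ.below i q′ q≤ S ; wall = BuildQ.wall i q′ q≤ S }

-- Promotion of a lattice word: the first letter is dropped; the first 2 and then the first 3 that exhausts
-- the surplus of 1s over 2s, respectively of 2s over 3s, is lowered by one; a last letter is appended.
-- The arguments are these surpluses, diminished by one where they have to be positive.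

lower₃ : List ℕ → List ℕ
lower₃ u = u ++ 3 ∷ []

lower₂ : ℕ → List ℕ → List ℕ
lower₂ b       []      = 2 ∷ []
lower₂ b       (1 ∷ u) = 1 ∷ lower₂ b u
lower₂ b       (2 ∷ u) = 2 ∷ lower₂ (suc b) u
lower₂ zero    (3 ∷ u) = 2 ∷ lower₃ u
lower₂ (suc b) (3 ∷ u) = 3 ∷ lower₂ b u
-- A default: no lattice word reaches this clause.
lower₂ b       (_ ∷ u) = []

lower₁ : ℕ → ℕ → List ℕ → List ℕ
lower₁ a       b       []      = 1 ∷ []
lower₁ a       b       (1 ∷ u) = 1 ∷ lower₁ (suc a) b u
lower₁ zero    b       (2 ∷ u) = 1 ∷ lower₂ b u
lower₁ (suc a) b       (2 ∷ u) = 2 ∷ lower₁ a (suc b) u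
lower₁ a       (suc b) (3 ∷ u) = 3 ∷ lower₁ a b u
lower₁ a       _       (_ ∷ u) = []

data Lattice : ℕ → ℕ → List ℕ → Set where
  []  : ∀ {a b} → Lattice a b []
  is1 : ∀ {a b u} → Lattice (suc a) b u → Lattice a b (1 ∷ u)
  is2 : ∀ {a b u} → Lattice a (suc b) u → Lattice (suc a) b (2 ∷ u)
  is3 : ∀ {a b u} → Lattice a b u → Lattice a (suc b) (3 ∷ u)

-- Jeu de taquin on tableaux given by row-index words

nth-++ : ∀ (X : List ℕ) {Y} c → nth (X ++ Y) (length X ℕ.+ c) ≡ nth Y c
nth-++ []      c = refl
nth-++ (_ ∷ X) c = nth-++ X c

setNth-++ : ∀ (X : List ℕ) {h Y v} → setNth (X ++ h ∷ Y) (length X) (λ _ → v) ≡ X ++ v ∷ Y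
setNth-++ []      = refl
setNth-++ (x ∷ X) = cong (x ∷_) (setNth-++ X)

length-snoc : ∀ (X : List ℕ) {v} → length (X ++ v ∷ []) ≡ suc (length X)
length-snoc X = trans (L.length-++ X) (ℕ.+-comm (length X) 1)

snoc-++ : ∀ (X : List ℕ) {v Y} → (X ++ v ∷ []) ++ Y ≡ X ++ v ∷ Y
snoc-++ X = L.++-assoc X _ _

-- For a slide an absent neighbour and a late entry are alike: both give way to an entry smaller
-- than `i`.
Late : ℕ → Maybe ℕ → Set
Late i m = (m ≡ nothing) ⊎ (∃ λ x → (m ≡ just x) × (i ℕ.≤ x))

late-mono : ∀ {i j m} → i ℕ.≤ j → Late j m → Late i m
late-mono h (inj₁ e)           = inj₁ e
late-mono h (inj₂ (x , e , p)) = inj₂ (x , e , ℕ.≤-trans h p)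

positions-late : ∀ r w i c → Late i (nth (positionsOf r w i) c)
positions-late r []      i c = inj₁ refl
positions-late r (x ∷ w) i c with x ≡ᵇ r
positions-late r (x ∷ w) i zero    | true  = inj₂ (i , refl , ℕ.≤-refl)
positions-late r (x ∷ w) i (suc c) | true  = late-mono (ℕ.n≤1+n i) (positions-late r w (suc i) c)
positions-late r (x ∷ w) i c       | false = late-mono (ℕ.n≤1+n i) (positions-late r w (suc i) c)

cut : ℕ → Maybe ℕ → Maybe ℕ
cut k nothing  = nothing
cut k (just x) = if x ≤ᵇ k then just x else nothing

getLe-cut : ∀ k T r c → getLe k T r c ≡ cut k (get T r c)
getLe-cut k T r c with get T r c
... | nothing = refl
... | just x  = refl

≤ᵇ-true : ∀ {m n} → m ℕ.≤ n → (m ≤ᵇ n) ≡ true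
≤ᵇ-true {m} {n} h with m ≤ᵇ n | ℕ.≤⇒≤ᵇ h
... | true | _ = refl

≤ᵇ-false : ∀ {m n} → n ℕ.< m → (m ≤ᵇ n) ≡ false
≤ᵇ-false {m} {n} h with m ≤ᵇ n in e
... | false = refl
... | true  = contradiction h (ℕ.≤⇒≯ (ℕ.≤ᵇ⇒≤ m n (subst Data.Bool.Base.T (sym e) _)))

<ᵇ-true : ∀ {m n} → m ℕ.< n → (m <ᵇ n) ≡ true
<ᵇ-true {m} {n} h with m <ᵇ n | ℕ.<⇒<ᵇ h
... | true | _ = refl

<ᵇ-false : ∀ {m n} → n ℕ.≤ m → (m <ᵇ n) ≡ false
<ᵇ-false {m} {n} h with m <ᵇ n in e
... | false = refl
... | true  = contradiction (ℕ.<ᵇ⇒< m n (subst Data.Bool.Base.T (sym e) _)) (ℕ.≤⇒≯ h)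

cut-late : ∀ {k i m} → Late i m → Late i (cut k m)
cut-late (inj₁ refl) = inj₁ refl
cut-late {k} (inj₂ (x , refl , p)) with x ≤ᵇ k
... | true  = inj₂ (x , refl , p)
... | false = inj₁ refl

cut-over : ∀ {k m} → Late (suc k) m → cut k m ≡ nothing
cut-over (inj₁ refl)           = refl
cut-over {k} (inj₂ (x , refl , p)) rewrite ≤ᵇ-false {x} {k} p = refl

cut-just : ∀ {k x} → x ℕ.≤ k → cut k (just x) ≡ just x
cut-just {k} {x} h rewrite ≤ᵇ-true h = refl

slide-stop : ∀ fu k T r c → getLe k T r (suc c) ≡ nothing → getLe k T (suc r) c ≡ nothing → slide fu k T r c ≡ (T , (r , c))
slide-stop zero     k T r c e e′ = refl
slide-stop (suc fu) k T r c e e′ rewrite e | e′ = refl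

slide-right : ∀ fu k T r c {x} → getLe k T r (suc c) ≡ just x → Late (suc x) (getLe k T (suc r) c) →
              slide (suc fu) k T r c ≡ slide fu k (set T r c x) r (suc c)
slide-right fu k T r c e (inj₁ e′) rewrite e | e′ = refl
slide-right fu k T r c {x} e (inj₂ (y , e′ , p)) rewrite e | e′ | <ᵇ-true {x} {y} p = refl

slide-down : ∀ fu k T r c {y} → Late y (getLe k T r (suc c)) → getLe k T (suc r) c ≡ just y →
             slide (suc fu) k T r c ≡ slide fu k (set T r c y) (suc r) c
slide-down fu k T r c (inj₁ e) e′ rewrite e | e′ = refl
slide-down fu k T r c {y} (inj₂ (x , e , p)) e′ rewrite e | e′ | <ᵇ-false {x} {y} p = refl

shiftDown : ℕ → ℕ → ℕ
shiftDown k x = if x ≤ᵇ k then x ∸ 1 else x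

finish : ℕ → Tab × (ℕ × ℕ) → Tab
finish k s = set (map (map (shiftDown k)) (proj₁ s)) (proj₁ (proj₂ s)) (proj₂ (proj₂ s)) k

shift-late : ∀ k r w i → k ℕ.< i → map (shiftDown k) (positionsOf r w i) ≡ positionsOf r w i
shift-late k r []      i h = refl
shift-late k r (x ∷ w) i h with x ≡ᵇ r
... | false = shift-late k r w (suc i) (ℕ.m<n⇒m<1+n h)
... | true  = cong₂ _∷_ (cong (λ b → if b then i ∸ 1 else i) (≤ᵇ-false h)) (shift-late k r w (suc i) (ℕ.m<n⇒m<1+n h))

shift-≤ : ∀ {k i} → suc i ℕ.≤ k → shiftDown k (suc i) ≡ i
shift-≤ {k} {i} h = cong (λ b → if b then i else suc i) (≤ᵇ-true h)

module Slides (k : ℕ) (t : List ℕ) where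

  P : ℕ → List ℕ → ℕ → List ℕ
  P r u i = positionsOf r (u ++ t) i

  S : List ℕ → List ℕ
  S = map (shiftDown k)

  row : ∀ X {v i Y} → shiftDown k v ≡ i → S (X ++ v ∷ []) ++ Y ≡ S X ++ i ∷ Y
  row X {v} {i} {Y} e = trans (cong (_++ Y) (L.map-++ (shiftDown k) X (v ∷ []))) (trans (snoc-++ (S X)) (cong (λ z → S X ++ z ∷ Y) e))

  hole : ∀ X h i → (∀ r → S (positionsOf r t i) ≡ positionsOf r t i) → ∀ r →
         setNth (S (X ++ h ∷ positionsOf r t i)) (length X) (λ _ → k) ≡ S X ++ k ∷ positionsOf r t i
  hole X h i late r = trans (cong₂ (λ l n → setNth l n (λ _ → k)) (trans (L.map-++ (shiftDown k) X _) (cong (λ Y → S X ++ shiftDown k h ∷ Y) (late r)))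
    (sym (L.length-map (shiftDown k) X))) (setNth-++ (S X))

  plain : ∀ X i → (∀ r → S (positionsOf r t i) ≡ positionsOf r t i) → ∀ r → S (X ++ positionsOf r t i) ≡ S X ++ positionsOf r t i
  plain X i late r = trans (L.map-++ (shiftDown k) X _) (cong (S X ++_) (late r))

  tab : List ℕ → List ℕ → List ℕ → Tab
  tab R₁ R₂ R₃ = R₁ ∷ R₂ ∷ R₃ ∷ []

  tab-cong : ∀ {R₁ R₁′ R₂ R₂′ R₃ R₃′} → R₁ ≡ R₁′ → R₂ ≡ R₂′ → R₃ ≡ R₃′ → tab R₁ R₂ R₃ ≡ tab R₁′ R₂′ R₃′
  tab-cong refl refl refl = refl

  at-end : ∀ {X Y : List ℕ} {c d} → c ≡ length X ℕ.+ d → nth (X ++ Y) c ≡ nth Y d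
  at-end {X} {Y} {d = d} e = trans (cong (nth (X ++ Y)) e) (nth-++ X d)

  past : ∀ (X : List ℕ) {h Y} → nth (X ++ h ∷ Y) (suc (length X)) ≡ nth Y 0
  past X {h} {Y} = trans (cong (nth (X ++ h ∷ Y)) (ℕ.+-comm 1 (length X))) (nth-++ X 1)

  target : List ℕ → List ℕ → List ℕ → List ℕ → ℕ → Tab
  target X₁ X₂ X₃ w i = tab (S X₁ ++ positionsOf 1 (w ++ t) i) (S X₂ ++ positionsOf 2 (w ++ t) i) (S X₃ ++ positionsOf 3 (w ++ t) i)

  -- Invariant of the scan: `X₁`, `X₂`, `X₃` hold the entries up to `i` in their new places, `u` is
  -- still to be read, and `t` contains the entries above `k`, which stay fixed. The hole is at the
  -- end of `X₃`; `h` is the stale value in it.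
  slide₃ : ∀ u fu i X₁ X₂ X₃ h {a b} → Lattice a b u → length u ℕ.≤ fu → i ℕ.+ length u ≡ k →
    finish k (slide fu k (tab (X₁ ++ P 1 u (suc i)) (X₂ ++ P 2 u (suc i)) (X₃ ++ h ∷ P 3 u (suc i))) 2 (length X₃))
    ≡ target X₁ X₂ X₃ (lower₃ u) i
  slide₃ [] fu i X₁ X₂ X₃ h [] _ e = trans
    (cong (finish k) (slide-stop fu k T 2 (length X₃)
      (trans (getLe-cut k T 2 _) (cut-over (subst (λ m → Late m (nth (X₃ ++ h ∷ P 3 [] (suc i)) (suc (length X₃)))) (cong suc i≡k)
        (subst (Late (suc i)) (sym (past X₃)) (positions-late 3 t (suc i) 0))))) refl))
    (tab-cong (plain X₁ (suc i) late 1) (plain X₂ (suc i) late 2)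
      (trans (hole X₃ h (suc i) late 3) (cong (λ j → S X₃ ++ j ∷ positionsOf 3 t (suc i)) (sym i≡k))))
    where
    T : Tab
    T = tab (X₁ ++ P 1 [] (suc i)) (X₂ ++ P 2 [] (suc i)) (X₃ ++ h ∷ P 3 [] (suc i))
    i≡k : i ≡ k
    i≡k = trans (sym (ℕ.+-identityʳ i)) e
    late : ∀ r → S (positionsOf r t (suc i)) ≡ positionsOf r t (suc i)
    late r = shift-late k r t (suc i) (s≤s (ℕ.≤-reflexive (sym i≡k)))
  slide₃ (1 ∷ u) fu i X₁ X₂ X₃ h (is1 la) f≥ e = trans
    (cong (λ R → finish k (slide fu k (tab R (X₂ ++ P 2 u (suc (suc i))) (X₃ ++ h ∷ P 3 u (suc (suc i)))) 2 (length X₃))) (sym (snoc-++ X₁)))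
    (trans (slide₃ u fu (suc i) (X₁ ++ suc i ∷ []) X₂ X₃ h la (ℕ.<⇒≤ f≥) (trans (sym (ℕ.+-suc i (length u))) e))
      (tab-cong (row X₁ (shift-≤ (subst (suc i ℕ.≤_) e (subst (suc i ℕ.≤_) (sym (ℕ.+-suc i (length u))) (s≤s (ℕ.m≤m+n i _)))))) refl refl))
  slide₃ (2 ∷ u) fu i X₁ X₂ X₃ h (is2 la) f≥ e = trans
    (cong (λ R → finish k (slide fu k (tab (X₁ ++ P 1 u (suc (suc i))) R (X₃ ++ h ∷ P 3 u (suc (suc i)))) 2 (length X₃))) (sym (snoc-++ X₂)))
    (trans (slide₃ u fu (suc i) X₁ (X₂ ++ suc i ∷ []) X₃ h la (ℕ.<⇒≤ f≥) (trans (sym (ℕ.+-suc i (length u))) e))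
      (tab-cong refl (row X₂ (shift-≤ (subst (suc i ℕ.≤_) e (subst (suc i ℕ.≤_) (sym (ℕ.+-suc i (length u))) (s≤s (ℕ.m≤m+n i _)))))) refl))
  slide₃ (3 ∷ u) (suc fu) i X₁ X₂ X₃ h (is3 la) (s≤s f≥) e = trans
    (cong (finish k) (slide-right fu k T 2 (length X₃) (trans (getLe-cut k T 2 _) (trans (cong (cut k) (past X₃)) (cut-just i≤k))) (inj₁ refl)))
    (trans (cong₂ (λ R c → finish k (slide fu k (tab (X₁ ++ P 1 u (suc (suc i))) (X₂ ++ P 2 u (suc (suc i))) R) 2 c))
        (trans (setNth-++ X₃) (sym (snoc-++ X₃))) (sym (length-snoc X₃)))
      (trans (slide₃ u fu (suc i) X₁ X₂ (X₃ ++ suc i ∷ []) (suc i) la f≥ (trans (sym (ℕ.+-suc i (length u))) e))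
        (tab-cong refl refl (row X₃ (shift-≤ i≤k)))))
    where
    T : Tab
    T = tab (X₁ ++ P 1 (3 ∷ u) (suc i)) (X₂ ++ P 2 (3 ∷ u) (suc i)) (X₃ ++ h ∷ P 3 (3 ∷ u) (suc i))
    i≤k : suc i ℕ.≤ k
    i≤k = subst (suc i ℕ.≤_) e (subst (suc i ℕ.≤_) (sym (ℕ.+-suc i (length u))) (s≤s (ℕ.m≤m+n i _)))

  -- The hole is `b` columns ahead of the next box of row 3. A letter 2 lies to its right and
  -- precedes whatever lies below, so the hole moves right. If b = 0, a letter 3 lies directly below
  -- the hole and precedes its right neighbour: the hole moves down, and the letter becomes 2.
  slide₂ : ∀ u fu i X₁ X₂ X₃ h {a b} → Lattice a (suc b) u → length X₂ ≡ length X₃ ℕ.+ b → length u ℕ.≤ fu → i ℕ.+ length u ≡ k →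
    finish k (slide fu k (tab (X₁ ++ P 1 u (suc i)) (X₂ ++ h ∷ P 2 u (suc i)) (X₃ ++ P 3 u (suc i))) 1 (length X₂))
    ≡ target X₁ X₂ X₃ (lower₂ b u) i
  slide₂ [] fu i X₁ X₂ X₃ h {b = b} [] cols _ e = trans
    (cong (finish k) (slide-stop fu k T 1 (length X₂)
      (trans (getLe-cut k T 1 _) (cut-over (subst (λ m → Late m (nth (X₂ ++ h ∷ P 2 [] (suc i)) (suc (length X₂)))) (cong suc i≡k)
        (subst (Late (suc i)) (sym (past X₂)) (positions-late 2 t (suc i) 0)))))
      (trans (getLe-cut k T 2 _) (cut-over (subst (λ m → Late m (nth (X₃ ++ P 3 [] (suc i)) (length X₂))) (cong suc i≡k)
        (subst (Late (suc i)) (sym (at-end {X₃} cols)) (positions-late 3 t (suc i) b)))))))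
    (tab-cong (plain X₁ (suc i) late 1)
      (trans (hole X₂ h (suc i) late 2) (cong (λ j → S X₂ ++ j ∷ positionsOf 2 t (suc i)) (sym i≡k))) (plain X₃ (suc i) late 3))
    where
    T : Tab
    T = tab (X₁ ++ P 1 [] (suc i)) (X₂ ++ h ∷ P 2 [] (suc i)) (X₃ ++ P 3 [] (suc i))
    i≡k : i ≡ k
    i≡k = trans (sym (ℕ.+-identityʳ i)) e
    late : ∀ r → S (positionsOf r t (suc i)) ≡ positionsOf r t (suc i)
    late r = shift-late k r t (suc i) (s≤s (ℕ.≤-reflexive (sym i≡k)))
  slide₂ (1 ∷ u) fu i X₁ X₂ X₃ h (is1 la) cols f≥ e = trans
    (cong (λ R → finish k (slide fu k (tab R (X₂ ++ h ∷ P 2 u (suc (suc i))) (X₃ ++ P 3 u (suc (suc i)))) 1 (length X₂))) (sym (snoc-++ X₁)))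
    (trans (slide₂ u fu (suc i) (X₁ ++ suc i ∷ []) X₂ X₃ h la cols (ℕ.<⇒≤ f≥) (trans (sym (ℕ.+-suc i (length u))) e))
      (tab-cong (row X₁ (shift-≤ (subst (suc i ℕ.≤_) e (subst (suc i ℕ.≤_) (sym (ℕ.+-suc i (length u))) (s≤s (ℕ.m≤m+n i _)))))) refl refl))
  slide₂ (2 ∷ u) (suc fu) i X₁ X₂ X₃ h {b = b} (is2 la) cols (s≤s f≥) e = trans
    (cong (finish k) (slide-right fu k T 1 (length X₂) (trans (getLe-cut k T 1 _) (trans (cong (cut k) (past X₂)) (cut-just i≤k)))
      (subst (Late (suc (suc i))) (sym (getLe-cut k T 2 _)) (cut-late (subst (Late (suc (suc i))) (sym (at-end {X₃} cols)) (positions-late 3 (u ++ t) (suc (suc i)) b))))))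
    (trans (cong₂ (λ R c → finish k (slide fu k (tab (X₁ ++ P 1 u (suc (suc i))) R (X₃ ++ P 3 u (suc (suc i)))) 1 c))
        (trans (setNth-++ X₂) (sym (snoc-++ X₂))) (sym (length-snoc X₂)))
      (trans (slide₂ u fu (suc i) X₁ (X₂ ++ suc i ∷ []) X₃ (suc i) la
          (trans (length-snoc X₂) (trans (cong suc cols) (sym (ℕ.+-suc (length X₃) b)))) f≥ (trans (sym (ℕ.+-suc i (length u))) e))
        (tab-cong refl (row X₂ (shift-≤ i≤k)) refl)))
    where
    T : Tab
    T = tab (X₁ ++ P 1 (2 ∷ u) (suc i)) (X₂ ++ h ∷ P 2 (2 ∷ u) (suc i)) (X₃ ++ P 3 (2 ∷ u) (suc i))
    i≤k : suc i ℕ.≤ k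
    i≤k = subst (suc i ℕ.≤_) e (subst (suc i ℕ.≤_) (sym (ℕ.+-suc i (length u))) (s≤s (ℕ.m≤m+n i _)))
  slide₂ (3 ∷ u) fu i X₁ X₂ X₃ h {b = suc b} (is3 la) cols f≥ e = trans
    (cong (λ R → finish k (slide fu k (tab (X₁ ++ P 1 u (suc (suc i))) (X₂ ++ h ∷ P 2 u (suc (suc i))) R) 1 (length X₂))) (sym (snoc-++ X₃)))
    (trans (slide₂ u fu (suc i) X₁ X₂ (X₃ ++ suc i ∷ []) h la
        (trans cols (trans (ℕ.+-suc (length X₃) b) (cong (ℕ._+ b) (sym (length-snoc X₃))))) (ℕ.<⇒≤ f≥) (trans (sym (ℕ.+-suc i (length u))) e))
      (tab-cong refl refl (row X₃ (shift-≤ (subst (suc i ℕ.≤_) e (subst (suc i ℕ.≤_) (sym (ℕ.+-suc i (length u))) (s≤s (ℕ.m≤m+n i _))))))))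
  slide₂ (3 ∷ u) (suc fu) i X₁ X₂ X₃ h {b = zero} (is3 la) cols (s≤s f≥) e = trans
    (cong (finish k) (slide-down fu k T 1 (length X₂)
      (subst (Late (suc i)) (sym (getLe-cut k T 1 _)) (cut-late (late-mono (ℕ.n≤1+n _) (subst (Late (suc (suc i))) (sym (past X₂)) (positions-late 2 (u ++ t) (suc (suc i)) 0)))))
      (trans (getLe-cut k T 2 _) (trans (cong (cut k) (at-end {X₃} cols)) (cut-just i≤k)))))
    (trans (cong₂ (λ R c → finish k (slide fu k (tab (X₁ ++ P 1 u (suc (suc i))) R (X₃ ++ suc i ∷ P 3 u (suc (suc i)))) 2 c))
        (trans (setNth-++ X₂) (sym (snoc-++ X₂))) (trans cols (ℕ.+-identityʳ _)))
      (trans (slide₃ u fu (suc i) X₁ (X₂ ++ suc i ∷ []) X₃ (suc i) la f≥ (trans (sym (ℕ.+-suc i (length u))) e))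
        (tab-cong refl (row X₂ (shift-≤ i≤k)) refl)))
    where
    T : Tab
    T = tab (X₁ ++ P 1 (3 ∷ u) (suc i)) (X₂ ++ h ∷ P 2 (3 ∷ u) (suc i)) (X₃ ++ P 3 (3 ∷ u) (suc i))
    i≤k : suc i ℕ.≤ k
    i≤k = subst (suc i ℕ.≤_) e (subst (suc i ℕ.≤_) (sym (ℕ.+-suc i (length u))) (s≤s (ℕ.m≤m+n i _)))

  slide₁ : ∀ u fu i X₁ X₂ X₃ h {a b} → Lattice (suc a) b u → length X₁ ≡ length X₂ ℕ.+ a → length X₂ ≡ length X₃ ℕ.+ b →
    length u ℕ.≤ fu → i ℕ.+ length u ≡ k →
    finish k (slide fu k (tab (X₁ ++ h ∷ P 1 u (suc i)) (X₂ ++ P 2 u (suc i)) (X₃ ++ P 3 u (suc i))) 0 (length X₁))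
    ≡ target X₁ X₂ X₃ (lower₁ a b u) i
  slide₁ [] fu i X₁ X₂ X₃ h {a} [] cols cols′ _ e = trans
    (cong (finish k) (slide-stop fu k T 0 (length X₁)
      (trans (getLe-cut k T 0 _) (cut-over (subst (λ m → Late m (nth (X₁ ++ h ∷ P 1 [] (suc i)) (suc (length X₁)))) (cong suc i≡k)
        (subst (Late (suc i)) (sym (past X₁)) (positions-late 1 t (suc i) 0)))))
      (trans (getLe-cut k T 1 _) (cut-over (subst (λ m → Late m (nth (X₂ ++ P 2 [] (suc i)) (length X₁))) (cong suc i≡k)
        (subst (Late (suc i)) (sym (at-end {X₂} cols)) (positions-late 2 t (suc i) a)))))))
    (tab-cong (trans (hole X₁ h (suc i) late 1) (cong (λ j → S X₁ ++ j ∷ positionsOf 1 t (suc i)) (sym i≡k)))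
      (plain X₂ (suc i) late 2) (plain X₃ (suc i) late 3))
    where
    T : Tab
    T = tab (X₁ ++ h ∷ P 1 [] (suc i)) (X₂ ++ P 2 [] (suc i)) (X₃ ++ P 3 [] (suc i))
    i≡k : i ≡ k
    i≡k = trans (sym (ℕ.+-identityʳ i)) e
    late : ∀ r → S (positionsOf r t (suc i)) ≡ positionsOf r t (suc i)
    late r = shift-late k r t (suc i) (s≤s (ℕ.≤-reflexive (sym i≡k)))
  slide₁ (1 ∷ u) (suc fu) i X₁ X₂ X₃ h {a} (is1 la) cols cols′ (s≤s f≥) e = trans
    (cong (finish k) (slide-right fu k T 0 (length X₁) (trans (getLe-cut k T 0 _) (trans (cong (cut k) (past X₁)) (cut-just i≤k)))
      (subst (Late (suc (suc i))) (sym (getLe-cut k T 1 _)) (cut-late (subst (Late (suc (suc i))) (sym (at-end {X₂} cols)) (positions-late 2 (u ++ t) (suc (suc i)) a))))))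
    (trans (cong₂ (λ R c → finish k (slide fu k (tab R (X₂ ++ P 2 u (suc (suc i))) (X₃ ++ P 3 u (suc (suc i)))) 0 c))
        (trans (setNth-++ X₁) (sym (snoc-++ X₁))) (sym (length-snoc X₁)))
      (trans (slide₁ u fu (suc i) (X₁ ++ suc i ∷ []) X₂ X₃ (suc i) la
          (trans (length-snoc X₁) (trans (cong suc cols) (sym (ℕ.+-suc (length X₂) a)))) cols′ f≥ (trans (sym (ℕ.+-suc i (length u))) e))
        (tab-cong (row X₁ (shift-≤ i≤k)) refl refl)))
    where
    T : Tab
    T = tab (X₁ ++ h ∷ P 1 (1 ∷ u) (suc i)) (X₂ ++ P 2 (1 ∷ u) (suc i)) (X₃ ++ P 3 (1 ∷ u) (suc i))
    i≤k : suc i ℕ.≤ k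
    i≤k = subst (suc i ℕ.≤_) e (subst (suc i ℕ.≤_) (sym (ℕ.+-suc i (length u))) (s≤s (ℕ.m≤m+n i _)))
  slide₁ (2 ∷ u) fu i X₁ X₂ X₃ h {suc a} {b} (is2 la) cols cols′ f≥ e = trans
    (cong (λ R → finish k (slide fu k (tab (X₁ ++ h ∷ P 1 u (suc (suc i))) R (X₃ ++ P 3 u (suc (suc i)))) 0 (length X₁))) (sym (snoc-++ X₂)))
    (trans (slide₁ u fu (suc i) X₁ (X₂ ++ suc i ∷ []) X₃ h la
        (trans cols (trans (ℕ.+-suc (length X₂) a) (cong (ℕ._+ a) (sym (length-snoc X₂)))))
        (trans (length-snoc X₂) (trans (cong suc cols′) (sym (ℕ.+-suc (length X₃) b)))) (ℕ.<⇒≤ f≥) (trans (sym (ℕ.+-suc i (length u))) e))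
      (tab-cong refl (row X₂ (shift-≤ (subst (suc i ℕ.≤_) e (subst (suc i ℕ.≤_) (sym (ℕ.+-suc i (length u))) (s≤s (ℕ.m≤m+n i _)))))) refl))
  slide₁ (2 ∷ u) (suc fu) i X₁ X₂ X₃ h {zero} {b} (is2 la) cols cols′ (s≤s f≥) e = trans
    (cong (finish k) (slide-down fu k T 0 (length X₁)
      (subst (Late (suc i)) (sym (getLe-cut k T 0 _)) (cut-late (late-mono (ℕ.n≤1+n _) (subst (Late (suc (suc i))) (sym (past X₁)) (positions-late 1 (u ++ t) (suc (suc i)) 0)))))
      (trans (getLe-cut k T 1 _) (trans (cong (cut k) (at-end {X₂} cols)) (cut-just i≤k)))))
    (trans (cong₂ (λ R c → finish k (slide fu k (tab R (X₂ ++ suc i ∷ P 2 u (suc (suc i))) (X₃ ++ P 3 u (suc (suc i)))) 1 c))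
        (trans (setNth-++ X₁) (sym (snoc-++ X₁))) (trans cols (ℕ.+-identityʳ _)))
      (trans (slide₂ u fu (suc i) (X₁ ++ suc i ∷ []) X₂ X₃ (suc i) la cols′ f≥ (trans (sym (ℕ.+-suc i (length u))) e))
        (tab-cong (row X₁ (shift-≤ i≤k)) refl refl)))
    where
    T : Tab
    T = tab (X₁ ++ h ∷ P 1 (2 ∷ u) (suc i)) (X₂ ++ P 2 (2 ∷ u) (suc i)) (X₃ ++ P 3 (2 ∷ u) (suc i))
    i≤k : suc i ℕ.≤ k
    i≤k = subst (suc i ℕ.≤_) e (subst (suc i ℕ.≤_) (sym (ℕ.+-suc i (length u))) (s≤s (ℕ.m≤m+n i _)))
  slide₁ (3 ∷ u) fu i X₁ X₂ X₃ h {a} {suc b} (is3 la) cols cols′ f≥ e = trans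
    (cong (λ R → finish k (slide fu k (tab (X₁ ++ h ∷ P 1 u (suc (suc i))) (X₂ ++ P 2 u (suc (suc i))) R) 0 (length X₁))) (sym (snoc-++ X₃)))
    (trans (slide₁ u fu (suc i) X₁ X₂ (X₃ ++ suc i ∷ []) h la cols
        (trans cols′ (trans (ℕ.+-suc (length X₃) b) (cong (ℕ._+ b) (sym (length-snoc X₃))))) (ℕ.<⇒≤ f≥) (trans (sym (ℕ.+-suc i (length u))) e))
      (trans (tab-cong refl refl (row X₃ (shift-≤ (subst (suc i ℕ.≤_) e (subst (suc i ℕ.≤_) (sym (ℕ.+-suc i (length u))) (s≤s (ℕ.m≤m+n i _)))))))
        (cong (λ w → target X₁ X₂ X₃ w i) (sym (lower₁-3 a)))))
    where
    lower₁-3 : ∀ a → lower₁ a (suc b) (3 ∷ u) ≡ 3 ∷ lower₁ a b u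
    lower₁-3 zero    = refl
    lower₁-3 (suc a) = refl

-- Guarantees the fuel of the slide: `promo` allots as much as there are entries.
positions-length : ∀ {a b} u t i → Lattice a b u →
  length u ℕ.≤ length (positionsOf 1 (u ++ t) i) ℕ.+ (length (positionsOf 2 (u ++ t) i) ℕ.+ length (positionsOf 3 (u ++ t) i))
positions-length []      t i []       = z≤n
positions-length (_ ∷ u) t i (is1 la) = s≤s (positions-length u t (suc i) la)
positions-length (_ ∷ u) t i (is2 la) = subst (suc (length u) ℕ.≤_) (sym (ℕ.+-suc (length (positionsOf 1 (u ++ t) (suc i))) _)) (s≤s (positions-length u t (suc i) la))
positions-length (_ ∷ u) t i (is3 la) = subst (suc (length u) ℕ.≤_)
  (sym (trans (cong (p₁ ℕ.+_) (ℕ.+-suc p₂ p₃)) (ℕ.+-suc p₁ (p₂ ℕ.+ p₃)))) (s≤s (positions-length u t (suc i) la))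
  where
  p₁ = length (positionsOf 1 (u ++ t) (suc i))
  p₂ = length (positionsOf 2 (u ++ t) (suc i))
  p₃ = length (positionsOf 3 (u ++ t) (suc i))

promo-word : ∀ u t → Lattice 1 0 u → promo (suc (length u)) (tabOf (1 ∷ u ++ t)) ≡ tabOf (lower₁ 0 0 u ++ t)
promo-word u t la = Slides.slide₁ (suc (length u)) t u _ 1 [] [] [] 1 la refl refl
  (ℕ.≤-trans (positions-length u t 2 la) (ℕ.≤-trans (ℕ.n≤1+n _) (ℕ.≤-reflexive (sym fuel)))) refl
  where
  P₁ = positionsOf 1 (u ++ t) 2
  P₂ = positionsOf 2 (u ++ t) 2
  P₃ = positionsOf 3 (u ++ t) 2
  fuel : length (concat (tabOf (1 ∷ u ++ t))) ≡ suc (length P₁ ℕ.+ (length P₂ ℕ.+ length P₃))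
  fuel = cong suc (trans (L.length-++ P₁) (cong (length P₁ ℕ.+_) (trans (L.length-++ P₂) (cong (length P₂ ℕ.+_) (cong length (L.++-identityʳ P₃))))))

-- Letters and dominant weights in terms of distances

too-big : ∀ k {A B} → A ℕ.≤ B → A ≡ suc k ℕ.+ B → ⊥
too-big k {A} {B} h e = ℕ.<⇒≱ (ℕ.m<n+m B {suc k} (s≤s z≤n)) (subst (ℕ._≤ B) e h)

-- The letter k of a step from the distances u, v (there and back) to u′, v′; 0 stands for the
-- combination that never occurs at the boundary.
data Letter (u u′ v v′ : ℕ) : ℕ → Set where
  one   : u′ ≡ suc u → v′ ≡ 2 ℕ.+ v → Letter u u′ v v′ 1
  two   : u′ ≡ suc u → v ≡ suc v′ → Letter u u′ v v′ 2
  three : u ≡ 2 ℕ.+ u′ → v ≡ suc v′ → Letter u u′ v v′ 3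
  bad   : u ≡ 2 ℕ.+ u′ → v′ ≡ 2 ℕ.+ v → Letter u u′ v v′ 0

up≢down : ∀ {u u′} → u′ ≡ suc u → u ≡ 2 ℕ.+ u′ → ⊥
up≢down {u} refl e = ℕ.<⇒≢ (ℕ.m<n+m u {3} (s≤s z≤n)) e

letter-unique : ∀ {u u′ v v′ k k′} → Letter u u′ v v′ k → Letter u u′ v v′ k′ → k ≡ k′
letter-unique (one _ _)   (one _ _)   = refl
letter-unique (two _ _)   (two _ _)   = refl
letter-unique (three _ _) (three _ _) = refl
letter-unique (bad _ _)   (bad _ _)   = refl
letter-unique (one _ y)   (two _ y′)   = ⊥-elim (up≢down y′ y)
letter-unique (one x _)   (three x′ _) = ⊥-elim (up≢down x x′)
letter-unique (one x _)   (bad x′ _)   = ⊥-elim (up≢down x x′)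
letter-unique (two _ y)   (one _ y′)   = ⊥-elim (up≢down y y′)
letter-unique (two x _)   (three x′ _) = ⊥-elim (up≢down x x′)
letter-unique (two x _)   (bad x′ _)   = ⊥-elim (up≢down x x′)
letter-unique (three x _) (one x′ _)   = ⊥-elim (up≢down x′ x)
letter-unique (three x _) (two x′ _)   = ⊥-elim (up≢down x′ x)
letter-unique (three _ y) (bad _ y′)   = ⊥-elim (up≢down y y′)
letter-unique (bad x _)   (one x′ _)   = ⊥-elim (up≢down x′ x)
letter-unique (bad x _)   (two x′ _)   = ⊥-elim (up≢down x′ x)
letter-unique (bad _ y)   (three _ y′) = ⊥-elim (up≢down y′ y)

-- A letter depends only on differences, so it survives if both ends of a step are shifted alike.
-- Away from `p` and `q` the passage to the next row is such a shift.
same-letter : ∀ {u u₁ v v₁ u′ u₁′ v′ v₁′ k} →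
  ((u ≡ suc u′) × (u₁ ≡ suc u₁′)) ⊎ ((u′ ≡ 2 ℕ.+ u) × (u₁′ ≡ 2 ℕ.+ u₁)) →
  ((v ≡ 2 ℕ.+ v′) × (v₁ ≡ 2 ℕ.+ v₁′)) ⊎ ((v′ ≡ suc v) × (v₁′ ≡ suc v₁)) →
  Letter u u₁ v v₁ k → Letter u′ u₁′ v′ v₁′ k
same-letter (inj₁ (refl , refl)) (inj₁ (refl , refl)) (one refl refl)   = one refl refl
same-letter (inj₁ (refl , refl)) (inj₁ (refl , refl)) (two refl refl)   = two refl refl
same-letter (inj₁ (refl , refl)) (inj₁ (refl , refl)) (three refl refl) = three refl refl
same-letter (inj₁ (refl , refl)) (inj₁ (refl , refl)) (bad refl refl)   = bad refl refl
same-letter (inj₁ (refl , refl)) (inj₂ (refl , refl)) (one refl refl)   = one refl refl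
same-letter (inj₁ (refl , refl)) (inj₂ (refl , refl)) (two refl refl)   = two refl refl
same-letter (inj₁ (refl , refl)) (inj₂ (refl , refl)) (three refl refl) = three refl refl
same-letter (inj₁ (refl , refl)) (inj₂ (refl , refl)) (bad refl refl)   = bad refl refl
same-letter (inj₂ (refl , refl)) (inj₁ (refl , refl)) (one refl refl)   = one refl refl
same-letter (inj₂ (refl , refl)) (inj₁ (refl , refl)) (two refl refl)   = two refl refl
same-letter (inj₂ (refl , refl)) (inj₁ (refl , refl)) (three refl refl) = three refl refl
same-letter (inj₂ (refl , refl)) (inj₁ (refl , refl)) (bad refl refl)   = bad refl refl
same-letter (inj₂ (refl , refl)) (inj₂ (refl , refl)) (one refl refl)   = one refl refl
same-letter (inj₂ (refl , refl)) (inj₂ (refl , refl)) (two refl refl)   = two refl refl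
same-letter (inj₂ (refl , refl)) (inj₂ (refl , refl)) (three refl refl) = three refl refl
same-letter (inj₂ (refl , refl)) (inj₂ (refl , refl)) (bad refl refl)   = bad refl refl

record Weight (u v a b : ℕ) : Set where
  constructor weight
  field
    wu : u ≡ a ℕ.+ 2 ℕ.* b
    wv : v ≡ 2 ℕ.* a ℕ.+ b

weight-1 : ∀ {u u₁ v v₁ a b} → Weight u v a b → u₁ ≡ suc u → v₁ ≡ 2 ℕ.+ v → Weight u₁ v₁ (suc a) b
weight-1 {a = a} {b} (weight refl refl) refl refl = weight refl (alg a b)
  where
  alg : ∀ a b → 2 ℕ.+ (2 ℕ.* a ℕ.+ b) ≡ 2 ℕ.* suc a ℕ.+ b
  alg = NR.solve-∀

weight-2 : ∀ {u u₁ v v₁ a b} → Weight u v (suc a) b → u₁ ≡ suc u → v ≡ suc v₁ → Weight u₁ v₁ a (suc b)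
weight-2 {a = a} {b} (weight refl e) refl refl = weight (alg a b) (ℕ.suc-injective (trans e (alg′ a b)))
  where
  alg : ∀ a b → suc (suc a ℕ.+ 2 ℕ.* b) ≡ a ℕ.+ 2 ℕ.* suc b
  alg = NR.solve-∀
  alg′ : ∀ a b → 2 ℕ.* suc a ℕ.+ b ≡ suc (2 ℕ.* a ℕ.+ suc b)
  alg′ = NR.solve-∀

weight-3 : ∀ {u u₁ v v₁ a b} → Weight u v a (suc b) → u ≡ 2 ℕ.+ u₁ → v ≡ suc v₁ → Weight u₁ v₁ a b
weight-3 {a = a} {b} (weight e e′) refl refl =
  weight (ℕ.suc-injective (ℕ.suc-injective (trans e (alg a b)))) (ℕ.suc-injective (trans e′ (ℕ.+-suc (2 ℕ.* a) b)))
  where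
  alg : ∀ a b → a ℕ.+ 2 ℕ.* suc b ≡ 2 ℕ.+ (a ℕ.+ 2 ℕ.* b)
  alg = NR.solve-∀

-- The inverse relations 2v - u = 3a and 2u - v = 3b are behind this lemma and the three that
-- follow.
weight-a≥1 : ∀ {u v a b} → Weight u v a b → 3 ℕ.+ u ℕ.≤ 2 ℕ.* v → ∃ λ a′ → a ≡ suc a′
weight-a≥1 {a = suc a} _ _ = a , refl
weight-a≥1 {a = zero} {b} (weight refl refl) h = ⊥-elim (too-big 2 h refl)

weight-b≥1 : ∀ {u v a b} → Weight u v a b → 3 ℕ.+ v ℕ.≤ 2 ℕ.* u → ∃ λ b′ → b ≡ suc b′
weight-b≥1 {b = suc b} _ _ = b , refl
weight-b≥1 {a = a} {zero} (weight refl refl) h = ⊥-elim (too-big 2 h (alg a))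
  where
  alg : ∀ a → 3 ℕ.+ (2 ℕ.* a ℕ.+ 0) ≡ 3 ℕ.+ 2 ℕ.* (a ℕ.+ 0)
  alg = NR.solve-∀

weight-a≡0 : ∀ {u v a b} → Weight u v a b → u ≡ 2 ℕ.* v → a ≡ 0
weight-a≡0 {a = zero} _ _ = refl
weight-a≡0 {a = suc a} {b} (weight refl refl) e = ⊥-elim (too-big (2 ℕ.+ 3 ℕ.* a) (ℕ.≤-reflexive (sym e)) (alg a b))
  where
  alg : ∀ a b → 2 ℕ.* (2 ℕ.* suc a ℕ.+ b) ≡ suc (2 ℕ.+ 3 ℕ.* a) ℕ.+ (suc a ℕ.+ 2 ℕ.* b)
  alg = NR.solve-∀

weight-b≡1 : ∀ {u v a b} → Weight u v a (suc b) → 3 ℕ.+ v ≡ 2 ℕ.* u → b ≡ 0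
weight-b≡1 {b = zero} _ _ = refl
weight-b≡1 {a = a} {suc b} (weight refl refl) e = ⊥-elim (too-big (2 ℕ.+ 3 ℕ.* b) (ℕ.≤-reflexive (sym e)) (alg a b))
  where
  alg : ∀ a b → 2 ℕ.* (a ℕ.+ 2 ℕ.* suc (suc b)) ≡ suc (2 ℕ.+ 3 ℕ.* b) ℕ.+ (3 ℕ.+ (2 ℕ.* a ℕ.+ suc (suc b)))
  alg = NR.solve-∀

lower₁-3 : ∀ a b u → lower₁ a (suc b) (3 ∷ u) ≡ 3 ∷ lower₁ a b u
lower₁-3 zero    b u = refl
lower₁-3 (suc a) b u = refl

-- The rows of letters and the passage from one row to the next

module Words {n′ : ℕ} (W : Web (suc n′)) where
  open Map W
  open Rows W

  letterOf : ∀ {u u′ v v′} → (u′ ≡ suc u) ⊎ (u ≡ 2 ℕ.+ u′) → (v ≡ suc v′) ⊎ (v′ ≡ 2 ℕ.+ v) → ∃ (Letter u u′ v v′)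
  letterOf (inj₁ x) (inj₁ y) = 2 , two x y
  letterOf (inj₁ x) (inj₂ y) = 1 , one x y
  letterOf (inj₂ x) (inj₁ y) = 3 , three x y
  letterOf (inj₂ x) (inj₂ y) = 0 , bad x y

  -- The letter of the step from B_j to B_{j+1} as seen from B_i.
  abstract
    letter : ℕ → ℕ → ℕ
    letter i j = proj₁ (letterOf (dist-fwd i j) (dist-bwd i j))

    letter-spec : ∀ i j → Letter (dist i j) (dist i (suc j)) (dist j i) (dist (suc j) i) (letter i j)
    letter-spec i j = proj₂ (letterOf (dist-fwd i j) (dist-bwd i j))

  letter≡ : ∀ {i j k} → Letter (dist i j) (dist i (suc j)) (dist j i) (dist (suc j) i) k → letter i j ≡ k
  letter≡ l = letter-unique (letter-spec _ _) l

  letters : ℕ → ℕ → ℕ → List ℕ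
  letters i j zero    = []
  letters i j (suc m) = letter i j ∷ letters i (suc j) m

  letters-length : ∀ i j m → length (letters i j m) ≡ m
  letters-length i j zero    = refl
  letters-length i j (suc m) = cong suc (letters-length i (suc j) m)

  letters-snoc : ∀ i j m → letters i j (suc m) ≡ letters i j m ++ letter i (m ℕ.+ j) ∷ []
  letters-snoc i j zero    = refl
  letters-snoc i j (suc m) = cong (letter i j ∷_) (trans (letters-snoc i (suc j) m) (cong (λ k → letters i (suc j) m ++ letter i k ∷ []) (ℕ.+-suc m j)))

  first-step : ∀ i → (dist i (suc i) ≡ 1) × (dist (suc i) i ≡ 2) × (letter i i ≡ 1)
  first-step i = go (letter-spec i i) refl
    where
    go : ∀ {k} → Letter (dist i i) (dist i (suc i)) (dist i i) (dist (suc i) i) k → letter i i ≡ k → (dist i (suc i) ≡ 1) × (dist (suc i) i ≡ 2) × (letter i i ≡ 1)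
    go (one x y)   e = trans x (cong suc (dist-self i)) , trans y (cong (2 ℕ.+_) (dist-self i)) , e
    go (two x y)   e with () ← trans (sym (dist-self i)) y
    go (three x y) e with () ← trans (sym (dist-self i)) x
    go (bad x y)   e with () ← trans (sym (dist-self i)) x

  no-wall-at-start : ∀ i → dist i (suc i) ≢ 2 ℕ.* dist (suc i) i
  no-wall-at-start i e with () ← trans (sym (proj₁ (first-step i))) (trans e (cong (2 ℕ.*_) (proj₁ (proj₂ (first-step i)))))

  module Row (i : ℕ) where
    open RowP (rowP i) renaming (above to V-far; below to V-near; wall to wall-p)
    open RowQ (rowQ i) renaming (above to U-far; below to U-near; wall to wall-q)

    1<p : 1 ℕ.< p
    1<p = ℕ.≤∧≢⇒< p≥1 λ e → no-wall-at-start i (subst (λ k → dist i (k ℕ.+ i) ≡ 2 ℕ.* dist (k ℕ.+ i) i) (sym e) wall-p)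

    1≤q : 1 ℕ.≤ q
    1≤q = ℕ.n≢0⇒n>0 λ e → absurd (trans (sym (proj₁ (first-step i)))
      (trans (subst (λ k → dist (k ℕ.+ i) (suc i) ≡ 2 ℕ.* dist (suc i) (k ℕ.+ i)) e wall-q) (cong (2 ℕ.*_) (proj₁ (proj₂ (first-step i))))))
      where
      absurd : 1 ≡ 4 → ⊥
      absurd ()

    -- From column q to q + 1 the difference of rows i and i + 1 falls from 1 to -2. As each row
    -- changes by 1 or -2, row i must fall and row i + 1 must rise.
    U-drop : dist i (q ℕ.+ i) ≡ 2 ℕ.+ dist i (suc q ℕ.+ i)
    U-drop = go (dist-fwd i (q ℕ.+ i)) (dist-fwd (suc i) (q ℕ.+ i)) (U-near q 1≤q ℕ.≤-refl) (U-far (suc q) ℕ.≤-refl q≤N)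
      where
      go : ∀ {u u₁ u′ u₁′} → (u₁ ≡ suc u) ⊎ (u ≡ 2 ℕ.+ u₁) → (u₁′ ≡ suc u′) ⊎ (u′ ≡ 2 ℕ.+ u₁′) → u ≡ suc u′ → u₁′ ≡ 2 ℕ.+ u₁ → u ≡ 2 ℕ.+ u₁
      go (inj₂ e) _ _ _ = e
      go {u′ = u′} (inj₁ refl) (inj₁ e) refl refl = ⊥-elim (too-big 2 (ℕ.≤-reflexive e) refl)
      go {u′ = u′} (inj₁ refl) (inj₂ e) refl refl = ⊥-elim (too-big 5 (ℕ.≤-reflexive (sym e)) refl)

    -- For q < p the equation `wall-q` would give b = 0 in row i at column q. Then the fall by
    -- `U-drop` would make the reverse distance at the next column more than twice the forward one.
    p≤q : p ℕ.≤ q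
    p≤q = ℕ.≮⇒≥ λ q<p → go (V-near q 1≤q q<p) (U-near q 1≤q ℕ.≤-refl) wall-q U-drop (dist-bwd i (q ℕ.+ i)) (dist-double (suc q ℕ.+ i) i)
      where
      go : ∀ {u u₁ v v₁ u′ v′} → v ≡ 2 ℕ.+ v′ → u ≡ suc u′ → v′ ≡ 2 ℕ.* u′ → u ≡ 2 ℕ.+ u₁ →
           (v ≡ suc v₁) ⊎ (v₁ ≡ 2 ℕ.+ v) → v₁ ℕ.≤ 2 ℕ.* u₁ → ⊥
      go {u₁ = u₁} {v₁ = v₁} refl refl refl refl (inj₁ e) h = too-big 2 h (ℕ.suc-injective (trans (sym e) (alg u₁)))
        where
        alg : ∀ u → 2 ℕ.+ 2 ℕ.* suc u ≡ suc (3 ℕ.+ 2 ℕ.* u)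
        alg = NR.solve-∀
      go {u₁ = u₁} refl refl refl refl (inj₂ refl) h = too-big 5 h (alg u₁)
        where
        alg : ∀ u → 4 ℕ.+ 2 ℕ.* suc u ≡ 6 ℕ.+ 2 ℕ.* u
        alg = NR.solve-∀

    module At (t : ℕ) (t≥1 : 1 ℕ.≤ t) (t<N : suc t ℕ.≤ N₀) where
      c : ℕ
      c = t ℕ.+ i

      same-U : t ≢ q → ((dist i c ≡ suc (dist (suc i) c)) × (dist i (suc c) ≡ suc (dist (suc i) (suc c)))) ⊎
                       ((dist (suc i) c ≡ 2 ℕ.+ dist i c) × (dist (suc i) (suc c) ≡ 2 ℕ.+ dist i (suc c)))
      same-U ne = go (ℕ.<-cmp t q)
        where
        go : Tri (t ℕ.< q) (t ≡ q) (q ℕ.< t) → _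
        go (tri< lt _ _) = inj₁ (U-near t t≥1 (ℕ.<⇒≤ lt) , U-near (suc t) (s≤s z≤n) lt)
        go (tri≈ _ e _)  = contradiction e ne
        go (tri> _ _ gt) = inj₂ (U-far t gt (ℕ.<⇒≤ t<N) , U-far (suc t) (ℕ.m<n⇒m<1+n gt) t<N)

      same-V : suc t ≢ p → ((dist c i ≡ 2 ℕ.+ dist c (suc i)) × (dist (suc c) i ≡ 2 ℕ.+ dist (suc c) (suc i))) ⊎
                           ((dist c (suc i) ≡ suc (dist c i)) × (dist (suc c) (suc i) ≡ suc (dist (suc c) i)))
      same-V ne = go (ℕ.<-cmp (suc t) p)
        where
        go : Tri (suc t ℕ.< p) (suc t ≡ p) (p ℕ.< suc t) → _
        go (tri< lt _ _)       = inj₁ (V-near t t≥1 (ℕ.<⇒≤ lt) , V-near (suc t) (s≤s z≤n) lt)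
        go (tri≈ _ e _)        = contradiction e ne
        go (tri> _ _ (s≤s gt)) = inj₂ (V-far t gt (ℕ.<⇒≤ t<N) , V-far (suc t) (ℕ.m≤n⇒m≤1+n gt) t<N)

      same : suc t ≢ p → t ≢ q → letter (suc i) c ≡ letter i c
      same ne ne′ = letter≡ (same-letter (same-U ne′) (same-V ne) (letter-spec i c))

      V-drop : suc t ≡ p → dist c i ≡ suc (dist (suc c) i)
      V-drop e = go (dist-bwd i c) (dist-bwd (suc i) c) (V-near t t≥1 (ℕ.≤-reflexive e)) (V-far (suc t) (ℕ.≤-reflexive (sym e)) t<N)
        where
        go : ∀ {v v₁ v′ v₁′} → (v ≡ suc v₁) ⊎ (v₁ ≡ 2 ℕ.+ v) → (v′ ≡ suc v₁′) ⊎ (v₁′ ≡ 2 ℕ.+ v′) → v ≡ 2 ℕ.+ v′ → v₁′ ≡ suc v₁ → v ≡ suc v₁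
        go (inj₁ e) _ _ _ = e
        go {v′ = v′} (inj₂ refl) (inj₁ e) refl refl = ⊥-elim (too-big 5 (ℕ.≤-reflexive (sym e)) refl)
        go {v′ = v′} (inj₂ refl) (inj₂ e) refl refl = ⊥-elim (too-big 2 (ℕ.≤-reflexive e) refl)

      -- The reverse distance of row i falls here. If the forward distance fell too, then by `wall`
      -- the forward distance of row i + 1 would exceed twice its reverse. So the letter is 2, and
      -- it is 1 in row i + 1, where the reverse distance rises.
      at-p : suc t ≡ p → (letter i c ≡ 2) × (letter (suc i) c ≡ 1) × (dist i (suc c) ≡ 2 ℕ.* dist (suc c) i)
      at-p e = letter≡ (proj₁ both) , letter≡ (proj₂ both) , wall
        where
        wall : dist i (suc c) ≡ 2 ℕ.* dist (suc c) i
        wall = subst (λ k → dist i (k ℕ.+ i) ≡ 2 ℕ.* dist (k ℕ.+ i) i) (sym e) wall-p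
        t<q : suc t ℕ.≤ q
        t<q = subst (ℕ._≤ q) (sym e) p≤q
        go : ∀ {u u₁ v v₁ u′ u₁′ v′ v₁′} → (u₁ ≡ suc u) ⊎ (u ≡ 2 ℕ.+ u₁) → v ≡ suc v₁ → u ≡ suc u′ → u₁ ≡ suc u₁′ → v ≡ 2 ℕ.+ v′ → v₁′ ≡ suc v₁ →
             u₁ ≡ 2 ℕ.* v₁ → u′ ℕ.≤ 2 ℕ.* v′ → Letter u u₁ v v₁ 2 × Letter u′ u₁′ v′ v₁′ 1
        go (inj₁ x) y p₁ p₂ p₃ p₄ _ _ = two x y , one (ℕ.suc-injective (trans (sym p₂) (trans x (cong suc p₁)))) (trans p₄ (trans (sym y) p₃))
        go {v′ = v′} (inj₂ refl) refl p₁ refl refl refl w h = ⊥-elim (too-big 2 h (ℕ.suc-injective (trans (sym p₁) (trans (cong (2 ℕ.+_) w) (alg v′)))))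
          where
          alg : ∀ v → 2 ℕ.+ 2 ℕ.* suc v ≡ suc (3 ℕ.+ 2 ℕ.* v)
          alg = NR.solve-∀
        both : Letter (dist i c) (dist i (suc c)) (dist c i) (dist (suc c) i) 2 × Letter (dist (suc i) c) (dist (suc i) (suc c)) (dist c (suc i)) (dist (suc c) (suc i)) 1
        both = go (dist-fwd i c) (V-drop e) (U-near t t≥1 (ℕ.<⇒≤ t<q)) (U-near (suc t) (s≤s z≤n) t<q) (V-near t t≥1 (ℕ.≤-reflexive e))
          (V-far (suc t) (ℕ.≤-reflexive (sym e)) t<N) wall (dist-double (suc i) c)

      not-bad-at-q : t ≡ q → letter i c ≢ 0
      not-bad-at-q refl e = go (subst (Letter _ _ _ _) e (letter-spec i c)) U-drop (U-near q t≥1 ℕ.≤-refl)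
          (V-far q p≤q (ℕ.<⇒≤ t<N)) wall-q (dist-double (suc c) i)
        where
        go : ∀ {u u₁ v v₁ u′ v′} → Letter u u₁ v v₁ 0 → u ≡ 2 ℕ.+ u₁ → u ≡ suc u′ → v′ ≡ suc v → v′ ≡ 2 ℕ.* u′ → v₁ ℕ.≤ 2 ℕ.* u₁ → ⊥
        go {u₁ = u₁} {v = v} (bad _ refl) refl refl refl w h = too-big 2 h (ℕ.suc-injective (trans (cong (2 ℕ.+_) w) (alg u₁)))
          where
          alg : ∀ u → 2 ℕ.+ 2 ℕ.* suc u ≡ suc (3 ℕ.+ 2 ℕ.* u)
          alg = NR.solve-∀

      at-q : t ≡ q → letter i c ≢ 0 → (letter i c ≡ 3) × (letter (suc i) c ≡ 2) × (3 ℕ.+ dist c i ≡ 2 ℕ.* dist i c)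
      at-q refl nb = go (letter-spec i c) refl U-drop (U-near q t≥1 ℕ.≤-refl) (U-far (suc q) ℕ.≤-refl t<N)
          (V-far q p≤q (ℕ.<⇒≤ t<N)) (V-far (suc q) (ℕ.m≤n⇒m≤1+n p≤q) t<N) wall-q
        where
        go : ∀ {k u₁ v₁} → Letter (dist i c) u₁ (dist c i) v₁ k → letter i c ≡ k → dist i c ≡ 2 ℕ.+ u₁ → dist i c ≡ suc (dist (suc i) c) → dist (suc i) (suc c) ≡ 2 ℕ.+ u₁ →
             dist c (suc i) ≡ suc (dist c i) → dist (suc c) (suc i) ≡ suc v₁ → dist c (suc i) ≡ 2 ℕ.* dist (suc i) c →
             (letter i c ≡ 3) × (letter (suc i) c ≡ 2) × (3 ℕ.+ dist c i ≡ 2 ℕ.* dist i c)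
        go (one x _) _ d _ _ _ _ _ = ⊥-elim (up≢down x d)
        go (two x _) _ d _ _ _ _ _ = ⊥-elim (up≢down x d)
        go (bad _ _) e _ _ _ _ _ _ = contradiction e nb
        go (three x y) e d p₁ p₂ p₃ p₄ w = e , letter≡ (two (trans p₂ (trans (sym d) p₁)) (trans p₃ (cong suc (trans y (sym p₄))))) ,
          trans (cong (2 ℕ.+_) (trans (sym p₃) w)) (trans (alg (dist (suc i) c)) (cong (2 ℕ.*_) (sym p₁)))
          where
          alg : ∀ u → 2 ℕ.+ 2 ℕ.* u ≡ 2 ℕ.* suc u
          alg = NR.solve-∀

  -- A bad letter would persist in all later rows, but the first letter of a row is 1.
  not-bad : ∀ t i → suc t ℕ.≤ N₀ → letter i (t ℕ.+ i) ≢ 0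
  not-bad zero    i _  e = letter-1≢0 (trans (sym (proj₂ (proj₂ (first-step i)))) e)
    where
    letter-1≢0 : 1 ≡ 0 → ⊥
    letter-1≢0 ()
  not-bad (suc t) i t< e = go (suc (suc t) ℕ.≟ RowP.p (rowP i)) (suc t ℕ.≟ RowQ.q (rowQ i))
    where
    open Row.At i (suc t) (s≤s z≤n) t<
    letter-2≢0 : 2 ≡ 0 → ⊥
    letter-2≢0 ()
    go : Dec (suc (suc t) ≡ RowP.p (rowP i)) → Dec (suc t ≡ RowQ.q (rowQ i)) → ⊥
    go (yes h) _       = letter-2≢0 (trans (sym (proj₁ (at-p h))) e)
    go (no _)  (yes h) = not-bad-at-q h e
    go (no h)  (no h′) = not-bad t (suc i) (ℕ.<⇒≤ t<) (trans (cong (letter (suc i)) (ℕ.+-suc t i)) (trans (same h h′) e))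

  module Advance (i : ℕ) where
    open Row i
    open RowP (rowP i) using (p) renaming (above to V-far; below to V-near)
    open RowQ (rowQ i) using (q) renaming (above to U-far; below to U-near)

    letter-pair : ∀ t → 1 ℕ.≤ t → suc t ℕ.≤ N₀ → (letter (suc i) (t ℕ.+ i) ≡ letter i (t ℕ.+ i)) ⊎
      ((letter (suc i) (t ℕ.+ i) ≡ 1) × (letter i (t ℕ.+ i) ≡ 2)) ⊎ ((letter (suc i) (t ℕ.+ i) ≡ 2) × (letter i (t ℕ.+ i) ≡ 3))
    letter-pair t t≥1 t<N = go (suc t ℕ.≟ p) (t ℕ.≟ q)
      where
      open At t t≥1 t<N
      go : Dec (suc t ≡ p) → Dec (t ≡ q) → _
      go (yes h) _       = inj₂ (inj₁ (proj₁ (proj₂ (at-p h)) , proj₁ (at-p h)))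
      go (no _)  (yes h) = let x , y , _ = at-q h (not-bad t i t<N) in inj₂ (inj₂ (y , x))
      go (no h)  (no h′) = inj₁ (same h h′)

    Weights : ℕ → ℕ → ℕ → Set
    Weights t a b = Weight (dist i (t ℕ.+ i)) (dist (t ℕ.+ i) i) a b

    start : Weights 1 1 0
    start = weight (proj₁ (first-step i)) (proj₁ (proj₂ (first-step i)))

    data Next (t : ℕ) : ℕ → ℕ → Set where
      next1 : ∀ {a b} → letter i (t ℕ.+ i) ≡ 1 → Weights (suc t) (suc a) b → Next t a b
      next2 : ∀ {a b} → letter i (t ℕ.+ i) ≡ 2 → Weights (suc t) a (suc b) → Next t (suc a) b
      next3 : ∀ {a b} → letter i (t ℕ.+ i) ≡ 3 → Weights (suc t) a b → Next t a (suc b)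

    -- Distances there and back differ at most by the factor 2. This keeps the weight dominant: a
    -- letter 2 requires a > 0, and a letter 3 requires b > 0.
    next : ∀ t {a b} → suc t ℕ.≤ N₀ → Weights t a b → Next t a b
    next t t<N w = go refl (letter-spec i (t ℕ.+ i)) w
      where
      go : ∀ {a b k} → letter i (t ℕ.+ i) ≡ k → Letter (dist i (t ℕ.+ i)) (dist i (suc t ℕ.+ i)) (dist (t ℕ.+ i) i) (dist (suc t ℕ.+ i) i) k → Weights t a b → Next t a b
      go e (one x y) w = next1 e (weight-1 w x y)
      go {suc a} e (two x y) w = next2 e (weight-2 w x y)
      go {zero} {b} e (two x y) (weight wu wv) = ⊥-elim (too-big 2 (ℕ.≤-trans (dist-double i (suc t ℕ.+ i)) ℕ.≤-refl) (dominance wu wv x y))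
        where
        dominance : ∀ {u u₁ v v₁} → u ≡ 0 ℕ.+ 2 ℕ.* b → v ≡ 2 ℕ.* 0 ℕ.+ b → u₁ ≡ suc u → v ≡ suc v₁ → u₁ ≡ 3 ℕ.+ 2 ℕ.* v₁
        dominance {v₁ = v₁} refl refl refl e = trans (cong (λ z → suc (2 ℕ.* z)) e) (alg v₁)
          where
          alg : ∀ v → suc (2 ℕ.* suc v) ≡ 3 ℕ.+ 2 ℕ.* v
          alg = NR.solve-∀
      go {b = suc b} e (three x y) w = next3 e (weight-3 w x y)
      go {a} {zero} e (three x y) (weight wu wv) = ⊥-elim (too-big 2 (dist-double (suc t ℕ.+ i) i) (dominance wu wv x y))
        where
        dominance : ∀ {u u₁ v v₁} → u ≡ a ℕ.+ 2 ℕ.* 0 → v ≡ 2 ℕ.* a ℕ.+ 0 → u ≡ 2 ℕ.+ u₁ → v ≡ suc v₁ → v₁ ≡ 3 ℕ.+ 2 ℕ.* u₁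
        dominance {u₁ = u₁} e refl e′ e″ = ℕ.suc-injective (trans (sym e″) (trans (alg a) (trans (cong (2 ℕ.*_) (trans (sym e) e′)) (alg′ u₁))))
          where
          alg : ∀ a → 2 ℕ.* a ℕ.+ 0 ≡ 2 ℕ.* (a ℕ.+ 2 ℕ.* 0)
          alg = NR.solve-∀
          alg′ : ∀ u → 2 ℕ.* (2 ℕ.+ u) ≡ suc (3 ℕ.+ 2 ℕ.* u)
          alg′ = NR.solve-∀
      go e (bad _ _) w = contradiction e (not-bad t i t<N)

    lattice : ∀ m t {a b} → t ℕ.+ m ℕ.≤ N₀ → Weights t a b → Lattice a b (letters i (t ℕ.+ i) m)
    lattice zero    t le w = []
    lattice (suc m) t {a} {b} le w = go (next t (ℕ.≤-trans (s≤s (ℕ.m≤m+n t m)) le′) w)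
      where
      le′ : suc t ℕ.+ m ℕ.≤ N₀
      le′ = subst (ℕ._≤ N₀) (ℕ.+-suc t m) le
      go : ∀ {a b} → Next t a b → Lattice a b (letters i (t ℕ.+ i) (suc m))
      go {a} {b} (next1 e w′) = subst (λ k → Lattice a b (k ∷ letters i (suc t ℕ.+ i) m)) (sym e) (is1 (lattice m (suc t) le′ w′))
      go {a} {b} (next2 e w′) = subst (λ k → Lattice a b (k ∷ letters i (suc t ℕ.+ i) m)) (sym e) (is2 (lattice m (suc t) le′ w′))
      go {a} {b} (next3 e w′) = subst (λ k → Lattice a b (k ∷ letters i (suc t ℕ.+ i) m)) (sym e) (is3 (lattice m (suc t) le′ w′))

    -- The last letter of the promoted word is the letter of the step from B_{i+1} to B_i seen from the other end.
    Last : ℕ → ℕ → Set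
    Last t k = Letter (dist (suc i) (t ℕ.+ i)) (dist i (t ℕ.+ i)) (dist (t ℕ.+ i) (suc i)) (dist (t ℕ.+ i) i) k

    Result : ℕ → ℕ → List ℕ → Set
    Result t m w = ∃ λ k → Last (t ℕ.+ m) k × (w ≡ letters (suc i) (t ℕ.+ i) m ++ k ∷ [])

    here-result : ∀ t {k w} → Last t k → w ≡ k ∷ [] → Result t 0 w
    here-result t {k} l e = k , subst (λ s → Last s k) (sym (ℕ.+-identityʳ t)) l , e

    cons-result : ∀ t m {k w w′} → letter (suc i) (t ℕ.+ i) ≡ k → w′ ≡ k ∷ w → Result (suc t) m w → Result t (suc m) w′
    cons-result t m e e′ (k , l , p) = k , subst (λ s → Last s k) (sym (ℕ.+-suc t m)) l , trans e′ (cong₂ _∷_ (sym e) p)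

    private
      bound : ∀ {t m} → t ℕ.+ suc m ℕ.≤ N₀ → suc t ℕ.+ m ℕ.≤ N₀
      bound {t} {m} = subst (ℕ._≤ N₀) (ℕ.+-suc t m)

      bound′ : ∀ {t m} → t ℕ.+ suc m ℕ.≤ N₀ → suc t ℕ.≤ N₀
      bound′ {t} {m} le = ℕ.≤-trans (s≤s (ℕ.m≤m+n t m)) (bound {t} {m} le)

    advance₃ : ∀ m t → q ℕ.< t → t ℕ.+ m ℕ.≤ N₀ → Result t m (lower₃ (letters i (t ℕ.+ i) m))
    advance₃ zero    t q<t le = here-result t (three (U-far t q<t t≤) (V-far t (ℕ.≤-trans p≤q (ℕ.<⇒≤ q<t)) t≤)) refl
      where
      t≤ : t ℕ.≤ N₀
      t≤ = ℕ.≤-trans (ℕ.m≤m+n t 0) le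
    advance₃ (suc m) t q<t le = cons-result t m
      (At.same t (ℕ.≤-trans (s≤s z≤n) q<t) (bound′ {t} {m} le) (ℕ.<⇒≢ (s≤s (ℕ.≤-trans p≤q (ℕ.<⇒≤ q<t))) ∘ sym) (ℕ.<⇒≢ q<t ∘ sym)) refl
      (advance₃ m (suc t) (ℕ.m<n⇒m<1+n q<t) (bound {t} {m} le))

    -- The factor 2 bound for row i + 1, carried back to row i, gives b > 0 from p up to q; so
    -- `lower₂` has no occasion to stop before q. In the same way `near-a` keeps a > 0 before p.
    near-b : ∀ t → p ℕ.≤ t → t ℕ.≤ q → t ℕ.≤ N₀ → 3 ℕ.+ dist (t ℕ.+ i) i ℕ.≤ 2 ℕ.* dist i (t ℕ.+ i)
    near-b t p≤t t≤q t≤N = go (U-near t (ℕ.≤-trans (ℕ.<⇒≤ 1<p) p≤t) t≤q) (V-far t p≤t t≤N) (dist-double (t ℕ.+ i) (suc i))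
      where
      go : ∀ {u v u′ v′} → u ≡ suc u′ → v′ ≡ suc v → v′ ℕ.≤ 2 ℕ.* u′ → 3 ℕ.+ v ℕ.≤ 2 ℕ.* u
      go {v = v} {u′} refl refl h = subst (3 ℕ.+ v ℕ.≤_) (alg u′) (s≤s (s≤s h))
        where
        alg : ∀ u → 2 ℕ.+ 2 ℕ.* u ≡ 2 ℕ.* suc u
        alg = NR.solve-∀

    near-a : ∀ t → 1 ℕ.≤ t → t ℕ.< p → 3 ℕ.+ dist i (t ℕ.+ i) ℕ.≤ 2 ℕ.* dist (t ℕ.+ i) i
    near-a t t≥1 t<p = go (U-near t t≥1 (ℕ.≤-trans (ℕ.<⇒≤ t<p) p≤q)) (V-near t t≥1 t<p) (dist-double (suc i) (t ℕ.+ i))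
      where
      go : ∀ {u v u′ v′} → u ≡ suc u′ → v ≡ 2 ℕ.+ v′ → u′ ℕ.≤ 2 ℕ.* v′ → 3 ℕ.+ u ℕ.≤ 2 ℕ.* v
      go {u′ = u′} {v′} refl refl h = subst (4 ℕ.+ u′ ℕ.≤_) (alg v′) (s≤s (s≤s (s≤s (s≤s h))))
        where
        alg : ∀ v → 4 ℕ.+ 2 ℕ.* v ≡ 2 ℕ.* (2 ℕ.+ v)
        alg = NR.solve-∀

    advance₂ : ∀ m t {a b} → p ℕ.≤ t → t ℕ.≤ q → t ℕ.+ m ℕ.≤ N₀ → Weights t a (suc b) → Result t m (lower₂ b (letters i (t ℕ.+ i) m))
    advance₂ zero t {b = b} p≤t t≤q le w = here-result t (two (U-near t (ℕ.≤-trans (ℕ.<⇒≤ 1<p) p≤t) t≤q) (V-far t p≤t (ℕ.≤-trans (ℕ.m≤m+n t 0) le))) (nil b)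
      where
      nil : ∀ b → lower₂ b [] ≡ 2 ∷ []
      nil zero    = refl
      nil (suc b) = refl
    advance₂ (suc m) t {a} {b} p≤t t≤q le w = go (t ℕ.≟ q)
      where
      t≥1 : 1 ℕ.≤ t
      t≥1 = ℕ.≤-trans (ℕ.<⇒≤ 1<p) p≤t
      open At t t≥1 (bound′ {t} {m} le) hiding (c)
      rest : List ℕ
      rest = letters i (suc t ℕ.+ i) m
      move : t ℕ.< q → ∀ {a b′} → Next t a b′ → ∀ b → b′ ≡ suc b → Result t (suc m) (lower₂ b (letter i (t ℕ.+ i) ∷ rest))
      move t<q (next1 e w′) b refl = cons-result t m (trans (same (ℕ.<⇒≢ (s≤s p≤t) ∘ sym) (ℕ.<⇒≢ t<q)) e) (trans (cong (λ k → lower₂ b (k ∷ rest)) e) (first b))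
        (advance₂ m (suc t) (ℕ.m≤n⇒m≤1+n p≤t) t<q (bound {t} {m} le) w′)
        where
        first : ∀ b → lower₂ b (1 ∷ rest) ≡ 1 ∷ lower₂ b rest
        first zero    = refl
        first (suc b) = refl
      move t<q (next2 e w′) b refl = cons-result t m (trans (same (ℕ.<⇒≢ (s≤s p≤t) ∘ sym) (ℕ.<⇒≢ t<q)) e) (trans (cong (λ k → lower₂ b (k ∷ rest)) e) (first b))
        (advance₂ m (suc t) (ℕ.m≤n⇒m≤1+n p≤t) t<q (bound {t} {m} le) w′)
        where
        first : ∀ b → lower₂ b (2 ∷ rest) ≡ 2 ∷ lower₂ (suc b) rest
        first zero    = refl
        first (suc b) = refl
      move t<q {a} (next3 e w′) b refl = kept b w′ (weight-b≥1 w′ (near-b (suc t) (ℕ.m≤n⇒m≤1+n p≤t) t<q (bound′ {t} {m} le)))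
        where
        kept : ∀ b → Weights (suc t) a b → (∃ λ b″ → b ≡ suc b″) → Result t (suc m) (lower₂ b (letter i (t ℕ.+ i) ∷ rest))
        kept (suc b) w″ _ = cons-result t m (trans (same (ℕ.<⇒≢ (s≤s p≤t) ∘ sym) (ℕ.<⇒≢ t<q)) e) (cong (λ k → lower₂ (suc b) (k ∷ rest)) e)
          (advance₂ m (suc t) (ℕ.m≤n⇒m≤1+n p≤t) t<q (bound {t} {m} le) w″)
        kept zero _ (_ , ())
      go : Dec (t ≡ q) → Result t (suc m) (lower₂ b (letter i (t ℕ.+ i) ∷ rest))
      go (no ne) = move (ℕ.≤∧≢⇒< t≤q ne) (next t (bound′ {t} {m} le) w) b refl
      go (yes e) = let x , y , z = at-q e (not-bad t i (bound′ {t} {m} le)) in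
        cons-result t m y (trans (cong₂ (λ b k → lower₂ b (k ∷ rest)) (weight-b≡1 w z) x) refl)
          (advance₃ m (suc t) (s≤s (ℕ.≤-reflexive (sym e))) (bound {t} {m} le))

    -- The 2 that first exhausts the surplus of 1s is the letter leading to column p: earlier
    -- `near-a` keeps a positive, and at p `wall` makes it zero.
    advance₁ : ∀ m t {a b} → 1 ℕ.≤ t → t ℕ.< p → t ℕ.+ m ℕ.≤ N₀ → Weights t (suc a) b → Result t m (lower₁ a b (letters i (t ℕ.+ i) m))
    advance₁ zero t {a} {b} t≥1 t<p le w = here-result t (one (U-near t t≥1 (ℕ.≤-trans (ℕ.<⇒≤ t<p) p≤q)) (V-near t t≥1 t<p)) (nil a b)
      where
      nil : ∀ a b → lower₁ a b [] ≡ 1 ∷ []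
      nil zero    b = refl
      nil (suc a) b = refl
    advance₁ (suc m) t {a} {b} t≥1 t<p le w = go (suc t ℕ.≟ p)
      where
      open At t t≥1 (bound′ {t} {m} le) hiding (c)
      rest : List ℕ
      rest = letters i (suc t ℕ.+ i) m
      t≢q : t ≢ q
      t≢q = ℕ.<⇒≢ (ℕ.<-≤-trans t<p p≤q)
      move : suc t ℕ.< p → ∀ {a′ b} → Next t a′ b → ∀ a → a′ ≡ suc a → Result t (suc m) (lower₁ a b (letter i (t ℕ.+ i) ∷ rest))
      move lt {b = b} (next1 e w′) a refl = cons-result t m (trans (same (ℕ.<⇒≢ lt) t≢q) e) (trans (cong (λ k → lower₁ a b (k ∷ rest)) e) (first a))
        (advance₁ m (suc t) (s≤s z≤n) lt (bound {t} {m} le) w′)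
        where
        first : ∀ a → lower₁ a b (1 ∷ rest) ≡ 1 ∷ lower₁ (suc a) b rest
        first zero    = refl
        first (suc a) = refl
      move lt {b = b} (next2 e w′) a refl = kept a w′ (weight-a≥1 w′ (near-a (suc t) (s≤s z≤n) lt))
        where
        kept : ∀ a → Weights (suc t) a (suc b) → (∃ λ a″ → a ≡ suc a″) → Result t (suc m) (lower₁ a b (letter i (t ℕ.+ i) ∷ rest))
        kept (suc a) w″ _ = cons-result t m (trans (same (ℕ.<⇒≢ lt) t≢q) e) (cong (λ k → lower₁ (suc a) b (k ∷ rest)) e)
          (advance₁ m (suc t) (s≤s z≤n) lt (bound {t} {m} le) w″)
        kept zero _ (_ , ())
      move lt {b = suc b} (next3 e w′) a refl = cons-result t m (trans (same (ℕ.<⇒≢ lt) t≢q) e) (trans (cong (λ k → lower₁ a (suc b) (k ∷ rest)) e) (lower₁-3 a b rest))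
        (advance₁ m (suc t) (s≤s z≤n) lt (bound {t} {m} le) w′)
      turn : ∀ {a′ b} → suc t ≡ p → Next t a′ b → ∀ a → a′ ≡ suc a → Result t (suc m) (lower₁ a b (letter i (t ℕ.+ i) ∷ rest))
      turn h (next1 e _) a refl = ⊥-elim (2≢1 (trans (sym (proj₁ (at-p h))) e))
        where
        2≢1 : 2 ≡ 1 → ⊥
        2≢1 ()
      turn h (next3 e _) a refl = ⊥-elim (2≢3 (trans (sym (proj₁ (at-p h))) e))
        where
        2≢3 : 2 ≡ 3 → ⊥
        2≢3 ()
      turn {b = b} h (next2 e w′) a refl = lowered a w′ (weight-a≡0 w′ (proj₂ (proj₂ (at-p h))))
        where
        lowered : ∀ a → Weights (suc t) a (suc b) → a ≡ 0 → Result t (suc m) (lower₁ a b (letter i (t ℕ.+ i) ∷ rest))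
        lowered zero w″ _ = cons-result t m (proj₁ (proj₂ (at-p h))) (cong (λ k → lower₁ 0 b (k ∷ rest)) e)
          (advance₂ m (suc t) (ℕ.≤-reflexive (sym h)) (subst (ℕ._≤ q) (sym h) p≤q) (bound {t} {m} le) w″)
      go : Dec (suc t ≡ p) → Result t (suc m) (lower₁ a b (letter i (t ℕ.+ i) ∷ rest))
      go (no ne) = move (ℕ.≤∧≢⇒< t<p ne) (next t (bound′ {t} {m} le) w) a refl
      go (yes h) = turn h (next t (bound′ {t} {m} le) w) a refl

    advance : ∀ m → suc m ℕ.≤ N₀ → Lattice 1 0 (letters i (suc i) m) × Result 1 m (lower₁ 0 0 (letters i (suc i) m))
    advance m le = lattice m 1 le start , advance₁ m 1 (s≤s z≤n) 1<p le start

-- From changes of webdist to letters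

⊖-up : ∀ d k → d ⊖ (d ℕ.+ k) ≡ 0 ⊖ k
⊖-up zero    k = refl
⊖-up (suc d) k = trans (ℤ.[1+m]⊖[1+n]≡m⊖n d (d ℕ.+ k)) (⊖-up d k)

⊖-down : ∀ d k → (d ℕ.+ k) ⊖ d ≡ k ⊖ 0
⊖-down zero    k = refl
⊖-down (suc d) k = trans (ℤ.[1+m]⊖[1+n]≡m⊖n (d ℕ.+ k) d) (⊖-down d k)

cancel-3 : ∀ {x y k} → 3 ℕ.* x ≡ 3 ℕ.* (y ℕ.+ k) → x ≡ y ℕ.+ k
cancel-3 {x} {y} {k} = ℕ.*-cancelˡ-≡ x (y ℕ.+ k) 3

up-3 : ∀ {x y z} k → 3 ℕ.* x ≡ z → 3 ℕ.* y ≡ 3 ℕ.* k ℕ.+ z → y ≡ x ℕ.+ k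
up-3 {x} {y} k e e′ = cancel-3 {y} {x} {k} (trans e′ (trans (cong (3 ℕ.* k ℕ.+_) (sym e)) (alg k x)))
  where
  alg : ∀ k x → 3 ℕ.* k ℕ.+ 3 ℕ.* x ≡ 3 ℕ.* (x ℕ.+ k)
  alg = NR.solve-∀

rise : ∀ {u u′ v v′} → u′ ≡ suc u → v′ ≡ 2 ℕ.+ v → u′ ℕ.+ v′ ≡ 3 ℕ.+ (u ℕ.+ v)
rise {u} {v = v} refl refl = alg u v
  where
  alg : ∀ u v → suc u ℕ.+ (2 ℕ.+ v) ≡ 3 ℕ.+ (u ℕ.+ v)
  alg = NR.solve-∀

level₂ : ∀ {u u′ v v′} → u′ ≡ suc u → v ≡ suc v′ → u′ ℕ.+ v′ ≡ u ℕ.+ v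
level₂ {u} {v′ = v′} refl refl = sym (ℕ.+-suc u v′)

fall : ∀ {u u′ v v′} → u ≡ 2 ℕ.+ u′ → v ≡ suc v′ → u ℕ.+ v ≡ 3 ℕ.+ (u′ ℕ.+ v′)
fall {u′ = u′} {v′ = v′} refl refl = alg u′ v′
  where
  alg : ∀ u v → (2 ℕ.+ u) ℕ.+ suc v ≡ 3 ℕ.+ (u ℕ.+ v)
  alg = NR.solve-∀

diff-up : ∀ {d d′} k → d′ ≡ d ℕ.+ k → d ⊖ d′ ≡ 0 ⊖ k
diff-up {d} k refl = ⊖-up d k

diff-down : ∀ {d d′} k → d ≡ d′ ℕ.+ k → d ⊖ d′ ≡ k ⊖ 0
diff-down {d′ = d′} k refl = ⊖-down d′ k

Φ-letter : ∀ {u u′ v v′ k d d′} → Letter u u′ v v′ k → k ≢ 0 → 3 ℕ.* d ≡ u ℕ.+ v → 3 ℕ.* d′ ≡ u′ ℕ.+ v′ → Φ (d ⊖ d′) ≡ k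
Φ-letter {d = d} {d′} (one x y)   _ e e′ = cong Φ (diff-up {d} {d′} 1 (up-3 1 e (trans e′ (rise x y))))
Φ-letter {d = d} {d′} (two x y)   _ e e′ = cong Φ (diff-up {d} {d′} 0 (up-3 0 e (trans e′ (level₂ x y))))
Φ-letter {d = d} {d′} (three x y) _ e e′ = cong Φ (diff-down {d} {d′} 1 (up-3 1 e′ (trans e (fall x y))))
Φ-letter (bad _ _) n _ _ = contradiction refl n

-- The change of webdist alone does not determine the pair: 0 would also fit (1,3) and (3,1), while
-- -1 and 1 would fit (2,1) and (3,2). These are excluded by the relation between `r` and `k`, which
-- `letter-pair` supplies.
Λ-letters : ∀ {u₀ u₁ u₂ v₀ v₁ v₂ r k d₀ d₂} → Letter u₀ u₁ v₀ v₁ r → Letter u₁ u₂ v₁ v₂ k → r ≢ 0 →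
  (r ≡ k) ⊎ ((r ≡ 1) × (k ≡ 2)) ⊎ ((r ≡ 2) × (k ≡ 3)) → 3 ℕ.* d₀ ≡ u₀ ℕ.+ v₀ → 3 ℕ.* d₂ ≡ u₂ ℕ.+ v₂ → Λ (d₀ ⊖ d₂) ≡ r ∷ k ∷ []
Λ-letters {d₀ = d} {d′} (one x y)   (one x′ y′)   _ _ e e′ = cong Λ (diff-up {d} {d′} 2 (up-3 2 e (trans e′ (trans (rise x′ y′) (cong (3 ℕ.+_) (rise x y))))))
Λ-letters {d₀ = d} {d′} (one x y)   (two x′ y′)   _ _ e e′ = cong Λ (diff-up {d} {d′} 1 (up-3 1 e (trans e′ (trans (level₂ x′ y′) (rise x y)))))
Λ-letters {d₀ = d} {d′} (two x y)   (two x′ y′)   _ _ e e′ = cong Λ (diff-up {d} {d′} 0 (up-3 0 e (trans e′ (trans (level₂ x′ y′) (level₂ x y)))))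
Λ-letters {d₀ = d} {d′} (two x y)   (three x′ y′) _ _ e e′ = cong Λ (diff-down {d} {d′} 1 (up-3 1 e′ (trans e (trans (sym (level₂ x y)) (fall x′ y′)))))
Λ-letters {d₀ = d} {d′} (three x y) (three x′ y′) _ _ e e′ = cong Λ (diff-down {d} {d′} 2 (up-3 2 e′ (trans e (trans (fall x y) (cong (3 ℕ.+_) (fall x′ y′))))))
Λ-letters (bad _ _) _ n _ _ _ = contradiction refl n
Λ-letters (one _ _)   (three _ _) _ (inj₁ ())
Λ-letters (one _ _)   (three _ _) _ (inj₂ (inj₁ (_ , ())))
Λ-letters (one _ _)   (three _ _) _ (inj₂ (inj₂ (() , _)))
Λ-letters (one _ _)   (bad _ _)   _ (inj₁ ())
Λ-letters (one _ _)   (bad _ _)   _ (inj₂ (inj₁ (_ , ())))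
Λ-letters (one _ _)   (bad _ _)   _ (inj₂ (inj₂ (() , _)))
Λ-letters (two _ _)   (one _ _)   _ (inj₁ ())
Λ-letters (two _ _)   (one _ _)   _ (inj₂ (inj₁ (() , _)))
Λ-letters (two _ _)   (one _ _)   _ (inj₂ (inj₂ (_ , ())))
Λ-letters (two _ _)   (bad _ _)   _ (inj₁ ())
Λ-letters (two _ _)   (bad _ _)   _ (inj₂ (inj₁ (() , _)))
Λ-letters (two _ _)   (bad _ _)   _ (inj₂ (inj₂ (_ , ())))
Λ-letters (three _ _) (one _ _)   _ (inj₁ ())
Λ-letters (three _ _) (one _ _)   _ (inj₂ (inj₁ (() , _)))
Λ-letters (three _ _) (one _ _)   _ (inj₂ (inj₂ (() , _)))
Λ-letters (three _ _) (two _ _)   _ (inj₁ ())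
Λ-letters (three _ _) (two _ _)   _ (inj₂ (inj₁ (() , _)))
Λ-letters (three _ _) (two _ _)   _ (inj₂ (inj₂ (() , _)))
Λ-letters (three _ _) (bad _ _)   _ (inj₁ ())
Λ-letters (three _ _) (bad _ _)   _ (inj₂ (inj₁ (() , _)))
Λ-letters (three _ _) (bad _ _)   _ (inj₂ (inj₂ (() , _)))

isOdd-even : ∀ j r → isOdd (2 ℕ.* j ℕ.+ r) ≡ isOdd r
isOdd-even zero    r = refl
isOdd-even (suc j) r = trans (cong (λ k → isOdd (k ℕ.+ r)) (ℕ.*-suc 2 j)) (isOdd-even j r)

map-upTo : ∀ (g : ℕ → ℕ) (h : ℕ → ℕ) m {l : ℕ → ℕ → List ℕ} → (∀ c → l c 0 ≡ []) → (k : ℕ → ℕ) → (∀ c m → l c (suc m) ≡ k c ∷ l (suc c) m) →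
  ∀ c → (∀ x → x ℕ.< m → g (h x) ≡ k (c ℕ.+ x)) → map g (applyUpTo h m) ≡ l c m
map-upTo g h zero    nil k cons c e = sym (nil c)
map-upTo g h (suc m) {l} nil k cons c e = trans (cong₂ _∷_ (trans (e 0 (s≤s z≤n)) (cong k (ℕ.+-identityʳ c)))
  (map-upTo g (h ∘ suc) m {l} nil k cons (suc c) (λ x x<m → trans (e (suc x) (s≤s x<m)) (cong k (ℕ.+-suc c x))))) (sym (cons c m))

-- Reflection and folding

module Folding {n′ : ℕ} (W : Web (suc n′)) where
  open Map W
  open Paths W
  open Crossing W
  open Rows W
  open Words W

  hb-in-face : ∀ j → j ℕ.≤ N₀ → IsB W j (hb j)
  hb-in-face zero    _  = fromℕ< {N₀ ∸ 1} ℕ.≤-refl , trans (sym (hb-N 0)) (trans (cong (hb ∘ suc) (sym (F.toℕ-fromℕ< _))) (sym (hub-index _))) ,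
    inj₂ (refl , cong suc (F.toℕ-fromℕ< _))
  hb-in-face (suc j) j< = fromℕ< j< , trans (cong (hb ∘ suc) (sym (F.toℕ-fromℕ< j<))) (sym (hub-index _)) , inj₁ (cong suc (F.toℕ-fromℕ< j<))

  WD-dist : ∀ {i j k} → i ℕ.≤ N₀ → j ℕ.≤ N₀ → WD W i j k → 3 ℕ.* k ≡ dist i j ℕ.+ dist j i
  WD-dist i≤ j≤ d = webdist-dist _ _ _ (d _ _ (hb-in-face _ i≤) (hb-in-face _ j≤))

  module Reflection (sym-W : Symmetrical W) where
    ρ : D → D
    ρ = proj₁ sym-W

    ρ-a : ∀ d → ρ (a d) ≡ a (ρ d)
    ρ-a = proj₁ (proj₂ (proj₂ sym-W))

    ρ-s : ∀ d → s (ρ (s d)) ≡ ρ d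
    ρ-s = proj₁ (proj₂ (proj₂ (proj₂ sym-W)))

    ρ-hub : ∀ k → ρ (hub W k) ≡ hub W (opposite k)
    ρ-hub = proj₁ (proj₂ (proj₂ (proj₂ (proj₂ sym-W))))

    ρ-col : ∀ d → col (ρ d) ≡ col d
    ρ-col = proj₂ (proj₂ (proj₂ (proj₂ (proj₂ sym-W))))

    -- The face of d is reflected to the face of α (ρ d).
    mirror : D → D
    mirror d = a (ρ d)

    mirror-f : ∀ d → face (mirror (f d)) ≡ face (mirror d)
    mirror-f d = trans (sym (face-s (ρ (f d)))) (cong face (trans (ρ-s (a d)) (ρ-a d)))

    mirror-face : ∀ {d e} → face d ≡ face e → face (mirror d) ≡ face (mirror e)
    mirror-face {d} h = let i , p = Fc.rep⇒orb h in trans (sym (go i)) (cong (face ∘ mirror) p)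
      where
      go : ∀ i → face (mirror (iter f i d)) ≡ face (mirror d)
      go zero    = refl
      go (suc i) = trans (mirror-f _) (go i)

    -- A reflection preserves the direction of the edges but exchanges left and right, so it
    -- reverses paths in the dual.
    mirror-path : ∀ {x} l {y} → IsPath x l y → ∃ λ l′ → IsPath (mirror y) l′ (mirror x) × (length l′ ≡ length l)
    mirror-path []      p           = [] , mirror-face (sym p) , refl
    mirror-path (e ∷ l) (c , st , p) = let l′ , p′ , k = mirror-path l p in
      l′ ++ ρ e ∷ [] , path-++ l′ p′ (trans (ρ-col e) c , refl , trans (cong face (sym (trans (cong a (ρ-a e)) (aa (ρ e))))) (mirror-face st)) ,
      trans (length-snoc′ l′) (cong suc k)
      where
      length-snoc′ : ∀ l → length (l ++ ρ e ∷ []) ≡ suc (length l)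
      length-snoc′ l = trans (L.length-++ l) (ℕ.+-comm (length l) 1)

    -- The dart of vertex j + 1 goes to that of vertex N - j; `mirror` takes the face to the left of
    -- the latter, which is B_{N-j-1}.
    mirror-hb : ∀ j → j ℕ.≤ N₀ → face (mirror (hb j)) ≡ face (hb (N₀ ∸ j))
    mirror-hb zero    _  = trans (mirror-face (cong face (sym (hb-N 0)))) (trans (at-suc (N₀ ∸ 1) ℕ.≤-refl) (cong face (trans (cong hb (ℕ.n∸n≡0 N₀)) (sym (hb-N 0)))))
      where
      at-suc : ∀ j → suc j ℕ.≤ N₀ → face (mirror (hb (suc j))) ≡ face (hb (N₀ ∸ suc j))
      at-suc j j< = trans (cong face (trans (cong mirror (trans (cong (hb ∘ suc) (sym (F.toℕ-fromℕ< j<))) (sym (hub-index _))))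
        (cong a (trans (ρ-hub (fromℕ< j<)) (trans (hub-index _) (cong (hb ∘ suc) (trans (F.opposite-prop (fromℕ< j<)) (cong (λ k → N₀ ∸ suc k) (F.toℕ-fromℕ< j<)))))))))
        (hb-face (N₀ ∸ suc j))
    mirror-hb (suc j) j< = trans (cong face (trans (cong mirror (trans (cong (hb ∘ suc) (sym (F.toℕ-fromℕ< j<))) (sym (hub-index _))))
        (cong a (trans (ρ-hub (fromℕ< j<)) (trans (hub-index _) (cong (hb ∘ suc) (trans (F.opposite-prop (fromℕ< j<)) (cong (λ k → N₀ ∸ suc k) (F.toℕ-fromℕ< j<)))))))))
        (hb-face (N₀ ∸ suc j))

    dist-mirror-≤ : ∀ i j → i ℕ.≤ N₀ → j ℕ.≤ N₀ → dist (N₀ ∸ j) (N₀ ∸ i) ℕ.≤ dist i j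
    dist-mirror-≤ i j i≤ j≤ = let l , p , k = dist-path i j ; l′ , p′ , k′ = mirror-path l p in
      subst (dist (N₀ ∸ j) (N₀ ∸ i) ℕ.≤_) (trans k′ k)
        (dist-min _ _ l′ (path-start l′ (mirror-hb j j≤) (path-end l′ (mirror-hb i i≤) p′)))

    dist-mirror : ∀ i j → i ℕ.≤ N₀ → j ℕ.≤ N₀ → dist (N₀ ∸ j) (N₀ ∸ i) ≡ dist i j
    dist-mirror i j i≤ j≤ = ℕ.≤-antisym (dist-mirror-≤ i j i≤ j≤)
      (subst₂ (λ x y → dist x y ℕ.≤ dist (N₀ ∸ j) (N₀ ∸ i)) (ℕ.m∸[m∸n]≡n i≤) (ℕ.m∸[m∸n]≡n j≤)
        (dist-mirror-≤ (N₀ ∸ j) (N₀ ∸ i) (ℕ.m∸n≤m N₀ j) (ℕ.m∸n≤m N₀ i)))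

  wordT-letters : ∀ ds → (∀ i → i ℕ.≤ N₀ → WD W 0 i (ds i)) → wordT N₀ ds ≡ letters 0 0 N₀
  wordT-letters ds hyp = map-upTo (λ i → Φ (ds i ⊖ ds (suc i))) (λ i → i) N₀ {letters 0} (λ _ → refl) (letter 0) (λ _ _ → refl) 0
    (λ x x<N → Φ-letter {d = ds x} {ds (suc x)} (letter-spec 0 x) (subst (λ k → letter 0 k ≢ 0) (ℕ.+-identityʳ x) (not-bad x 0 x<N))
      (WD-dist z≤n (ℕ.<⇒≤ x<N) (hyp x (ℕ.<⇒≤ x<N))) (WD-dist z≤n x<N (hyp (suc x) x<N)))

  module Folded (sym-W : Symmetrical W) (hs : ℕ → ℕ) (hyp : ∀ j → j ℕ.≤ N₀ / 2 → WD W j (N₀ ∸ j) (hs j)) where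
    open Reflection sym-W

    half-≤ : ∀ {j} → j ℕ.≤ N₀ / 2 → j ℕ.≤ N₀
    half-≤ h = ℕ.≤-trans h (m/n≤m N₀ 2)

    -- By the reflection, the letter appended by the promotion is the last letter that was there before.
    pair : ∀ j m k → suc j ℕ.≤ N₀ / 2 → m ℕ.+ (suc j ℕ.+ suc j) ≡ N₀ → Advance.Last j (1 ℕ.+ suc m) k →
           Λ (hs (suc j) ⊖ hs j) ≡ letter (suc j) (m ℕ.+ suc j) ∷ k ∷ []
    pair j m k j< total last = subst (λ k → Λ (hs (suc j) ⊖ hs j) ≡ letter (suc j) c ∷ k ∷ []) (sym k≡)
      (Λ-letters {d₀ = hs (suc j)} {hs j} (letter-spec (suc j) c) last″
        (not-bad m (suc j) (ℕ.≤-trans (ℕ.m<m+n m (s≤s z≤n)) c≤))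
        pairs
        (subst (λ x → 3 ℕ.* hs (suc j) ≡ dist (suc j) x ℕ.+ dist x (suc j)) c≡ (WD-dist (half-≤ j<) (ℕ.m∸n≤m N₀ (suc j)) (hyp (suc j) j<)))
        (subst (λ x → 3 ℕ.* hs j ≡ dist j x ℕ.+ dist x j) c′≡ (WD-dist (half-≤ (ℕ.<⇒≤ j<)) (ℕ.m∸n≤m N₀ j) (hyp j (ℕ.<⇒≤ j<)))))
      where
      c : ℕ
      c = m ℕ.+ suc j
      c+ : c ℕ.+ suc j ≡ N₀
      c+ = trans (ℕ.+-assoc m (suc j) (suc j)) total
      c≡ : N₀ ∸ suc j ≡ c
      c≡ = trans (cong (_∸ suc j) (sym c+)) (ℕ.m+n∸n≡m c (suc j))
      c′+ : suc c ℕ.+ j ≡ N₀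
      c′+ = trans (sym (ℕ.+-suc c j)) c+
      c′≡ : N₀ ∸ j ≡ suc c
      c′≡ = trans (cong (_∸ j) (sym c′+)) (ℕ.m+n∸n≡m (suc c) j)
      c≤ : c ℕ.≤ N₀
      c≤ = subst (c ℕ.≤_) c+ (ℕ.m≤m+n c (suc j))
      c′≤ : suc c ℕ.≤ N₀
      c′≤ = subst (suc c ℕ.≤_) c′+ (ℕ.m≤m+n (suc c) j)
      j≤ : j ℕ.≤ N₀
      j≤ = half-≤ (ℕ.<⇒≤ j<)
      back-j : N₀ ∸ suc c ≡ j
      back-j = trans (cong (_∸ suc c) (sym c′+)) (ℕ.m+n∸m≡n (suc c) j)
      -- Since c = N - j - 1, the reflection takes the pair (j + 1, c + 1) to (j, c) in this order.
      there≡ : dist (suc j) (suc c) ≡ dist j c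
      there≡ = trans (sym (dist-mirror (suc j) (suc c) (half-≤ j<) c′≤)) (cong₂ dist back-j c≡)
      back≡ : dist (suc c) (suc j) ≡ dist c j
      back≡ = trans (sym (dist-mirror (suc c) (suc j) c′≤ (half-≤ j<))) (cong₂ dist c≡ back-j)
      end : (1 ℕ.+ suc m) ℕ.+ j ≡ suc c
      end = cong suc (sym (ℕ.+-suc m j))
      last′ : Letter (dist (suc j) (suc c)) (dist j (suc c)) (dist (suc c) (suc j)) (dist (suc c) j) k
      last′ = subst (λ x → Letter (dist (suc j) x) (dist j x) (dist x (suc j)) (dist x j) k) end last
      k≡ : k ≡ letter j c
      k≡ = letter-unique (subst₂ (λ x y → Letter x (dist j (suc c)) y (dist (suc c) j) k) there≡ back≡ last′) (letter-spec j c)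
      last″ : Letter (dist (suc j) (suc c)) (dist j (suc c)) (dist (suc c) (suc j)) (dist (suc c) j) (letter j c)
      last″ = subst (Letter (dist (suc j) (suc c)) (dist j (suc c)) (dist (suc c) (suc j)) (dist (suc c) j)) k≡ last′
      pairs : (letter (suc j) c ≡ letter j c) ⊎ ((letter (suc j) c ≡ 1) × (letter j c ≡ 2)) ⊎ ((letter (suc j) c ≡ 2) × (letter j c ≡ 3))
      pairs = subst (λ x → (letter (suc j) x ≡ letter j x) ⊎ ((letter (suc j) x ≡ 1) × (letter j x ≡ 2)) ⊎ ((letter (suc j) x ≡ 2) × (letter j x ≡ 3)))
        (sym (ℕ.+-suc m j)) (Advance.letter-pair j (suc m) (s≤s z≤n)
          (ℕ.≤-trans (s≤s (ℕ.m<m+n m (s≤s z≤n))) c′≤))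

    -- After j promotions the word consists of the letters of row j up to column N − j, followed by
    -- the letters that are already final.
    folded : ∀ j m → j ℕ.≤ N₀ / 2 → m ℕ.+ (j ℕ.+ j) ≡ N₀ → fold N₀ j (tabOf (letters 0 0 N₀)) ≡ tabOf (letters j j m ++ wordDpairs hs j)
    folded zero    m _  e = cong tabOf (trans (cong (letters 0 0) (sym (trans (sym (ℕ.+-identityʳ m)) e))) (sym (L.++-identityʳ (letters 0 0 m))))
    folded (suc j) m j< e = begin
      promo (N₀ ℕ.+ 2 ∸ 2 ℕ.* suc j) (fold N₀ j (tabOf (letters 0 0 N₀)))
        ≡⟨ cong₂ promo size (folded j (suc (suc m)) (ℕ.<⇒≤ j<) e′) ⟩
      promo (suc (length u)) (tabOf (letter j j ∷ u ++ t))
        ≡⟨ cong (λ k → promo (suc (length u)) (tabOf (k ∷ u ++ t))) (proj₂ (proj₂ (first-step j))) ⟩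
      promo (suc (length u)) (tabOf (1 ∷ u ++ t))
        ≡⟨ promo-word u t (proj₁ adv) ⟩
      tabOf (lower₁ 0 0 u ++ t)
        ≡⟨ cong (λ w → tabOf (w ++ t)) (proj₂ (proj₂ (proj₂ adv))) ⟩
      tabOf ((letters (suc j) (suc j) (suc m) ++ k ∷ []) ++ t)
        ≡⟨ cong tabOf regroup ⟩
      tabOf (letters (suc j) (suc j) m ++ Λ (hs (suc j) ⊖ hs j) ++ t) ∎
      where
      open ≡-Reasoning
      u t : List ℕ
      u = letters j (suc j) (suc m)
      t = wordDpairs hs j
      e′ : suc (suc m) ℕ.+ (j ℕ.+ j) ≡ N₀
      e′ = trans (alg m j) e
        where
        alg : ∀ m j → suc (suc m) ℕ.+ (j ℕ.+ j) ≡ m ℕ.+ (suc j ℕ.+ suc j)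
        alg = NR.solve-∀
      size : N₀ ℕ.+ 2 ∸ 2 ℕ.* suc j ≡ suc (length u)
      size = trans (cong (λ x → x ℕ.+ 2 ∸ 2 ℕ.* suc j) (sym e)) (trans (cong (_∸ 2 ℕ.* suc j) (alg m j)) (trans (ℕ.m+n∸n≡m (suc (suc m)) (2 ℕ.* suc j))
        (cong suc (sym (letters-length j (suc j) (suc m))))))
        where
        alg : ∀ m j → m ℕ.+ (suc j ℕ.+ suc j) ℕ.+ 2 ≡ suc (suc m) ℕ.+ 2 ℕ.* suc j
        alg = NR.solve-∀
      adv : Lattice 1 0 u × Advance.Result j 1 (suc m) (lower₁ 0 0 u)
      adv = Advance.advance j (suc m) (subst (suc (suc m) ℕ.≤_) e′ (ℕ.m≤m+n (suc (suc m)) (j ℕ.+ j)))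
      k : ℕ
      k = proj₁ (proj₂ adv)
      regroup : (letters (suc j) (suc j) (suc m) ++ k ∷ []) ++ t ≡ letters (suc j) (suc j) m ++ Λ (hs (suc j) ⊖ hs j) ++ t
      regroup = begin
        (letters (suc j) (suc j) (suc m) ++ k ∷ []) ++ t
          ≡⟨ cong (λ l → (l ++ k ∷ []) ++ t) (letters-snoc (suc j) (suc j) m) ⟩
        ((letters (suc j) (suc j) m ++ r ∷ []) ++ k ∷ []) ++ t
          ≡⟨ cong (_++ t) (L.++-assoc (letters (suc j) (suc j) m) (r ∷ []) (k ∷ [])) ⟩
        (letters (suc j) (suc j) m ++ r ∷ k ∷ []) ++ t
          ≡⟨ L.++-assoc (letters (suc j) (suc j) m) (r ∷ k ∷ []) t ⟩
        letters (suc j) (suc j) m ++ r ∷ k ∷ t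
          ≡⟨ cong (λ l → letters (suc j) (suc j) m ++ l ++ t) (sym (pair j m k j< e (proj₁ (proj₂ (proj₂ adv))))) ⟩
        letters (suc j) (suc j) m ++ Λ (hs (suc j) ⊖ hs j) ++ t ∎
        where
        r : ℕ
        r = letter (suc j) (m ℕ.+ suc j)

    -- For odd N a single letter is never promoted; as the first letter of its row it is 1, in
    -- accordance with the first letter of `wordD`.
    remaining : ∀ mid r → r ℕ.< 2 → letters mid mid r ≡ (if isOdd r then 1 ∷ [] else [])
    remaining mid zero       _ = refl
    remaining mid (suc zero) _ = cong (_∷ []) (proj₂ (proj₂ (first-step mid)))
    remaining mid (suc (suc _)) (s≤s (s≤s ()))

    result : Fold N₀ (tabOf (letters 0 0 N₀)) ≡ tabOf (wordD N₀ hs)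
    result = trans (folded mid r ℕ.≤-refl total) (cong (λ w → tabOf (w ++ wordDpairs hs mid))
      (trans (remaining mid r (m%n<n N₀ 2)) (cong (λ b → if b then 1 ∷ [] else []) (sym parity))))
      where
      mid r : ℕ
      mid = N₀ / 2
      r = N₀ % 2
      total : r ℕ.+ (mid ℕ.+ mid) ≡ N₀
      total = trans (cong (r ℕ.+_) (alg mid)) (sym (m≡m%n+[m/n]*n N₀ 2))
        where
        alg : ∀ mid → mid ℕ.+ mid ≡ mid ℕ.* 2
        alg = NR.solve-∀
      parity : isOdd N₀ ≡ isOdd r
      parity = trans (cong isOdd (sym (trans (alg mid r) total))) (isOdd-even mid r)
        where
        alg : ∀ mid r → 2 ℕ.* mid ℕ.+ r ≡ r ℕ.+ (mid ℕ.+ mid)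
        alg = NR.solve-∀

theorem1p2 : (n : ℕ) (W : Web n) → Symmetrical W →
    (ds hs : ℕ → ℕ) →
    (∀ i → i ≤ 3 * n → WD W 0 i (ds i)) →
    (∀ j → j ≤ (3 * n) / 2 → WD W j (3 * n ∸ j) (hs j)) →
    Fold (3 * n) (tabOf (wordT (3 * n) ds)) ≡ tabOf (wordD (3 * n) hs)
-- Without boundary vertices both words are empty.
theorem1p2 zero     W sym-W ds hs hd hh = refl
theorem1p2 (suc n′) W sym-W ds hs hd hh = trans (cong (λ w → Fold (3 * suc n′) (tabOf w)) (Folding.wordT-letters W ds hd))
  (Folding.Folded.result W sym-W hs hh)
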